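{- For integers $n\ge 1$ and $k\ge 0$, let $$\tilde\gamma_{n,k}(\mathbf{x}) := \sum_{D\in\tilde{\mathcal H}_{n,k}} s_D(\mathbf{x}),$$ where $s_D(\mathbf{x})$ is the skew Schur function of shape $D$. Then for all $n\ge 1$, $$\tilde Q_n(\mathbf{x},t)=\sum_{k=0}^{\lfloor n/2\rfloor}\tilde\gamma_{n,k}(\mathbf{x})\,t^k(1+t)^{n-2k}.$$ Consequently the polynomial $\tilde Q_n(\mathbf{x},t)$ is Schur-$\gamma$-positive.
   Context: Let $\mathbf{x}=(x_1,x_2,\dots)$, let $\Lambda$ be the $\mathbb{R}$-algebra of symmetric functions in $\mathbf{x}$, let $h_n(\mathbf{x})$ be the complete homogeneous symmetric function of degree $n$, and let $H(z):=\sum_{n\ge0}h_n(\mathbf{x})z^n$. The polynomials $Q_n(\mathbf{x},t)\in\Lambda[t]$ are defined by $$\sum_{n\ge0}Q_n(\mathbf{x},t)z^n:=\frac{(1-t)H(z)}{H(tz)-tH(z)},$$ and for $n\ge0$, $\tilde Q_n(\mathbf{x},t):=h_n(\mathbf{x})+t\sum_{m=1}^n h_{n-m}(\mathbf{x})Q_m(\mathbf{x},t)$. A skew hook is a connected skew diagram (English notation, considered up to translation) containing no $2\times2$ square. $\tilde{\mathcal H}_{n,k}$ is the set of skew hooks of size $n$ (i.e. with $n$ cells) for which $k$ columns have size $2$ and the remaining $n-2k$ columns have size $1$. A symmetric function is Schur-positive if its expansion in the basis of Schur functions has nonnegative coefficients. A polynomial $A(t)\in\Lambda[t]$ is Schur-$\gamma$-positive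 if for some $d$ there exist Schur-positive $\gamma_0,\dots,\gamma_{\lfloor d/2\rfloor}\in\Lambda$ such that $A(t)=\sum_{k=0}^{\lfloor d/2\rfloor}\gamma_kt^k(1+t)^{d-2k}$. -}

module Defs where

open import Algebra.Bundles using (CommutativeRing)
open import Algebra.Bundles.Raw using (RawRing)
import Algebra.Definitions.RawSemiring as RawSemiringDefinitions
open import Data.Bool.Base using (if_then_else_)
open import Data.Fin.Base using (toℕ)
open import Data.List.Base as List
  using (List; []; _∷_; _∷ʳ_; map; foldr; filter; length; zip; upTo; concatMap;
         cartesianProduct; cartesianProductWith)
import Data.List.Membership.DecPropositional as DecMembership
open import Data.List.Membership.Propositional using (_∈_)
import Data.List.Properties as List
open import Data.List.Relation.Binary.Permutation.Propositional using (_↭_)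
open import Data.List.Relation.Binary.Prefix.Heterogeneous using (Prefix)
open import Data.List.Relation.Binary.Prefix.Heterogeneous.Properties using (prefix?)
open import Data.List.Relation.Unary.All using (All; all?)
open import Data.List.Relation.Unary.Any using (Any; here; there; any?)
open import Data.List.Relation.Unary.Linked using (Linked; linked?)
open import Data.List.Relation.Unary.Unique.Propositional using (Unique)
open import Data.Nat.Base using (ℕ; zero; suc; _≤_; _<_; _≥_; _∸_; ∣_-_∣; ⌊_/2⌋)
  renaming (_+_ to _+ᴺ_; _*_ to _*ᴺ_)
open import Data.Nat.ListAction using () renaming (sum to sumᴺ)
open import Data.Nat.Properties using (_≟_; _≤?_; _<?_; _≥?_)
open import Data.Product.Base using (Σ-syntax; ∃-syntax; _×_; _,_; proj₁; proj₂)
open import Data.Product.Properties using (≡-dec)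
open import Data.Sum.Base using (_⊎_; inj₁; inj₂)
open import Level using (Level; _⊔_) renaming (suc to lsuc)
open import Relation.Binary.Construct.Closure.ReflexiveTransitive using (Star; ε; _◅_; _◅◅_)
open import Relation.Binary.Core using (Rel)
open import Relation.Binary.Definitions using (DecidableEquality; Decidable)
open import Relation.Binary.PropositionalEquality using (_≡_; refl)
open import Relation.Binary.Structures using (IsPartialOrder)
open import Relation.Nullary.Decidable using (does; map′; _×-dec_; _⊎-dec_; _→-dec_; ¬?)
open import Relation.Nullary.Negation using (¬_)
open import Relation.Unary using (Pred) renaming (Decidable to Decidable₁)

private
  variable
    a p : Level
    A : Set a

------------------------------------------------------------------------
-- Coefficients

-- The real numbers are one instance.  Only a partial order is assumed, so
-- that constructive versions of ℝ qualify as well; 0 ≤ 1 is then an axiom.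
record OrderedCommutativeRing c ℓ₁ ℓ₂ : Set (lsuc (c ⊔ ℓ₁ ⊔ ℓ₂)) where
  field
    commutativeRing : CommutativeRing c ℓ₁
  open CommutativeRing commutativeRing public
  field
    _≼_            : Rel Carrier ℓ₂
    isPartialOrder : IsPartialOrder _≈_ _≼_
    +-monoʳ-≼      : ∀ z {x y} → x ≼ y → (z + x) ≼ (z + y)
    *-nonneg       : ∀ {x y} → 0# ≼ x → 0# ≼ y → 0# ≼ (x * y)
    0≼1            : 0# ≼ 1#

------------------------------------------------------------------------
-- Formal power series

module _ {c ℓ} (R : RawRing c ℓ) where
  open RawRing R
  open RawSemiringDefinitions rawSemiring using (sum)

  constant : Carrier → ℕ → Carrier
  constant r zero    = r
  constant r (suc _) = 0#

  variable₁ : ℕ → Carrier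
  variable₁ 1 = 1#
  variable₁ _ = 0#

  PowerSeries : RawRing c ℓ
  PowerSeries = record
    { Carrier = ℕ → Carrier
    ; _≈_     = λ f g → ∀ n → f n ≈ g n
    ; _+_     = λ f g n → f n + g n
    ; _*_     = λ f g n → sum {suc n} (λ i → f (toℕ i) * g (n ∸ toℕ i))
    ; -_      = λ f n → - f n
    ; 0#      = constant 0#
    ; 1#      = constant 1#
    }

  -- The list α = a₁ ∷ … ∷ a_N ∷ [] stands for the monomial x₁^a₁ ⋯ x_N^a_N
  -- in the N variables x₁, …, x_N, so that an element is a family consisting
  -- of one power series in x₁, …, x_N for each N.  A series in infinitely many
  -- variables is such a family with f (α ∷ʳ 0) ≈ f α for all α.
  multiply : (f g : List ℕ → Carrier) → List ℕ → Carrier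
  multiply f g []      = f [] * g []
  multiply f g (a ∷ α) =
    sum {suc a} (λ i → multiply (λ β → f (toℕ i ∷ β)) (λ γ → g ((a ∸ toℕ i) ∷ γ)) α)

  SeriesInX : RawRing c ℓ
  SeriesInX = record
    { Carrier = List ℕ → Carrier
    ; _≈_     = λ f g → ∀ α → f α ≈ g α
    ; _+_     = λ f g α → f α + g α
    ; _*_     = multiply
    ; -_      = λ f α → - f α
    ; 0#      = λ _ → 0#
    ; 1#      = λ α → if does (sumᴺ α ≟ 0) then 1# else 0#
    }

------------------------------------------------------------------------
-- Partitions and skew diagrams

count : {P : Pred A p} → Decidable₁ P → List A → ℕ
count P? xs = length (filter P? xs)

words : ℕ → List A → List (List A)
words zero    xs = [] ∷ []
words (suc m) xs = cartesianProductWith _∷_ xs (words m xs)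

Partition : List ℕ → Set
Partition λs = Linked _≥_ λs × All (0 <_) λs

partition? : Decidable₁ Partition
partition? λs = linked? _≥?_ λs ×-dec all? (0 <?_) λs

part : List ℕ → ℕ → ℕ
part []       _       = 0
part (r ∷ λs) zero    = r
part (r ∷ λs) (suc i) = part λs i

-- The pair (λs , μs) stands for the diagram λs / μs.
Skew : Set
Skew = List ℕ × List ℕ

IsSkew : Skew → Set
IsSkew (λs , μs) = Partition λs × Partition μs × Prefix _≤_ μs λs

isSkew? : Decidable₁ IsSkew
isSkew? (λs , μs) = partition? λs ×-dec partition? μs ×-dec prefix? _≤?_ μs λs

-- (i , j) is the cell in row i (from the top) and column j (from the left),
-- both counted from 0.
Cell : Set
Cell = ℕ × ℕ

cells : Skew → List Cell
cells (λs , μs) =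
  concatMap (λ i → map (i ,_) (filter (part μs i ≤?_) (upTo (part λs i))))
            (upTo (length λs))

size : Skew → ℕ
size D = length (cells D)

open DecMembership (≡-dec _≟_ _≟_) using (_∈?_)

Adjacent : Rel Cell _
Adjacent (i , j) (i′ , j′) = ∣ i - i′ ∣ +ᴺ ∣ j - j′ ∣ ≡ 1

Step : Skew → Rel Cell _
Step D x y = x ∈ cells D × y ∈ cells D × Adjacent x y

step? : ∀ D → Decidable (Step D)
step? D x@(i , j) y@(i′ , j′) =
  x ∈? cells D ×-dec y ∈? cells D ×-dec (∣ i - i′ ∣ +ᴺ ∣ j - j′ ∣) ≟ 1

Connected : Skew → Set
Connected D = All (λ x → All (λ y → Star (Step D) x y) (cells D)) (cells D)

-- Reachability in a finite graph is decidable (Floyd–Warshall): Via vs x y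
-- says that y can be reached from x with all intermediate vertices in vs.
module Reachability (_≟ᴬ_ : DecidableEquality A) {_⟶_ : Rel A p} (_⟶?_ : Decidable _⟶_) where

  Via : List A → Rel A _
  Via []       x y = x ≡ y ⊎ x ⟶ y
  Via (v ∷ vs) x y = Via vs x y ⊎ (Via vs x v × Via vs v y)

  via? : ∀ vs → Decidable (Via vs)
  via? []       x y = (x ≟ᴬ y) ⊎-dec (x ⟶? y)
  via? (v ∷ vs) x y = via? vs x y ⊎-dec (via? vs x v ×-dec via? vs v y)

  base : ∀ vs {x y} → x ≡ y ⊎ x ⟶ y → Via vs x y
  base []       e = e
  base (v ∷ vs) e = inj₁ (base vs e)

  via⇒star : ∀ vs {x y} → Via vs x y → Star _⟶_ x y
  via⇒star []       (inj₁ refl)    = ε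
  via⇒star []       (inj₂ e)       = e ◅ ε
  via⇒star (v ∷ vs) (inj₁ q)       = via⇒star vs q
  via⇒star (v ∷ vs) (inj₂ (q , r)) = via⇒star vs q ◅◅ via⇒star vs r

  via-trans : ∀ vs {x m y} → m ∈ vs → Via vs x m → Via vs m y → Via vs x y
  via-trans (v ∷ vs) (here refl) q r = inj₂ (to q , from r)
    where
    to : ∀ {x} → Via (v ∷ vs) x v → Via vs x v
    to (inj₁ q)       = q
    to (inj₂ (q , _)) = q
    from : ∀ {y} → Via (v ∷ vs) v y → Via vs v y
    from (inj₁ r)       = r
    from (inj₂ (_ , r)) = r
  via-trans (v ∷ vs) (there m) (inj₁ q)       (inj₁ r)       = inj₁ (via-trans vs m q r)
  via-trans (v ∷ vs) (there m) (inj₁ q)       (inj₂ (r , s)) = inj₂ (via-trans vs m q r , s)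
  via-trans (v ∷ vs) (there m) (inj₂ (q , s)) (inj₁ r)       = inj₂ (q , via-trans vs m s r)
  via-trans (v ∷ vs) (there m) (inj₂ (q , _)) (inj₂ (_ , s)) = inj₂ (q , s)

  star⇒via : ∀ vs → (∀ {x y} → x ⟶ y → y ∈ vs) → ∀ {x y} → Star _⟶_ x y → Via vs x y
  star⇒via vs target ε        = base vs (inj₁ refl)
  star⇒via vs target (e ◅ es) =
    via-trans vs (target e) (base vs (inj₂ e)) (star⇒via vs target es)

  star? : ∀ vs → (∀ {x y} → x ⟶ y → y ∈ vs) → Decidable (Star _⟶_)
  star? vs target x y = map′ (via⇒star vs) (star⇒via vs target) (via? vs x y)

connected? : Decidable₁ Connected
connected? D = all? (λ x → all? (star? (cells D) (λ (_ , y∈D , _) → y∈D) x) (cells D)) (cells D)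
  where open Reachability (≡-dec _≟_ _≟_) (step? D)

Has2×2At : Skew → Cell → Set
Has2×2At D (i , j) =
  (i , suc j) ∈ cells D × (suc i , j) ∈ cells D × (suc i , suc j) ∈ cells D

No2×2 : Skew → Set
No2×2 D = All (λ x → ¬ Has2×2At D x) (cells D)

no2×2? : Decidable₁ No2×2
no2×2? D = all? (λ (i , j) → ¬? ((i , suc j) ∈? cells D ×-dec (suc i , j) ∈? cells D
                                   ×-dec (suc i , suc j) ∈? cells D)) (cells D)

-- Row 0 and column 0 are nonempty.  Every nonempty connected skew diagram has
-- exactly one translate λs / μs with this property, and this translate comes
-- from exactly one pair of partitions (λs , μs).
Normalized : Skew → Set
Normalized D = Any (λ x → proj₁ x ≡ 0) (cells D) × Any (λ x → proj₂ x ≡ 0) (cells D)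

normalized? : Decidable₁ Normalized
normalized? D =
  any? (λ x → proj₁ x ≟ 0) (cells D) ×-dec any? (λ x → proj₂ x ≟ 0) (cells D)

SkewHook : Skew → Set
SkewHook D = IsSkew D × Normalized D × Connected D × No2×2 D

skewHook? : Decidable₁ SkewHook
skewHook? D = isSkew? D ×-dec normalized? D ×-dec connected? D ×-dec no2×2? D

columnSize : Skew → ℕ → ℕ
columnSize D j = count (λ x → proj₂ x ≟ j) (cells D)

columnsOfSize : ℕ → Skew → ℕ
columnsOfSize s D@(λs , _) = count (λ j → columnSize D j ≟ s) (upTo (part λs 0))

-- The last equation says that there are n - 2k columns of size 1; as D has n
-- cells, this leaves no cell for any column of another size.
InH̃ : ℕ → ℕ → Skew → Set
InH̃ n k D = SkewHook D × size D ≡ n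
           × columnsOfSize 2 D ≡ k × columnsOfSize 1 D +ᴺ 2 *ᴺ k ≡ n

inH̃? : ∀ n k → Decidable₁ (InH̃ n k)
inH̃? n k D = skewHook? D ×-dec size D ≟ n
            ×-dec columnsOfSize 2 D ≟ k ×-dec (columnsOfSize 1 D +ᴺ 2 *ᴺ k) ≟ n

partitionsInSquare : ℕ → List (List ℕ)
partitionsInSquare n =
  filter partition? (concatMap (λ r → words r (upTo (suc n))) (upTo (suc n)))

-- A connected diagram with n cells meets at most n rows and n columns, so the
-- normalized ones all lie in the n × n square.
H̃ : ℕ → ℕ → List Skew
H̃ n k = filter (inH̃? n k) (cartesianProduct (partitionsInSquare n) (partitionsInSquare n))

------------------------------------------------------------------------
-- Semistandard tableaux

Compatible : Rel (Cell × ℕ) _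
Compatible ((i , j) , v) ((i′ , j′) , v′) =
  (i ≡ i′ → j < j′ → v ≤ v′) × (j ≡ j′ → i < i′ → v < v′)

compatible? : Decidable Compatible
compatible? ((i , j) , v) ((i′ , j′) , v′) =
  (i ≟ i′ →-dec (j <? j′ →-dec v ≤? v′)) ×-dec (j ≟ j′ →-dec (i <? i′ →-dec v <? v′))

-- A filling of D is the list of its entries, in the order of cells D.
Semistandard : Skew → List ℕ → Set
Semistandard D w = All (λ x → All (Compatible x) T) T
  where T = zip (cells D) w

semistandard? : ∀ D → Decidable₁ (Semistandard D)
semistandard? D w = all? (λ x → all? (compatible? x) T) T
  where T = zip (cells D) w

content : ℕ → List ℕ → List ℕ
content N w = map (λ i → count (_≟ i) w) (upTo N)

-- The entry i of a tableau contributes the variable x_{i+1}; α lists the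
-- exponents of x₁, …, x_N, where N = length α.
tableaux : Skew → List ℕ → List (List ℕ)
tableaux D α =
  filter (λ w → semistandard? D w ×-dec List.≡-dec _≟_ (content (length α) w) α)
         (words (size D) (upTo (length α)))

------------------------------------------------------------------------
-- Symmetric functions

module SymmetricFunctions {c ℓ₁ ℓ₂} (R : OrderedCommutativeRing c ℓ₁ ℓ₂) where

  private
    module R = OrderedCommutativeRing R
    open RawSemiringDefinitions (RawRing.rawSemiring R.rawRing) using () renaming (_×_ to _×ᴿ_)

  R[[x]] : RawRing c ℓ₁
  R[[x]] = SeriesInX R.rawRing

  private
    module X = RawRing R[[x]]

  -- Membership in Λ ⊆ R[[x]].
  record _∈Λ (f : X.Carrier) : Set ℓ₁ where
    field
      stable    : ∀ α → f (α ∷ʳ 0) R.≈ f α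
      symmetric : ∀ {α β} → α ↭ β → f α R.≈ f β
      bounded   : ∃[ d ] ∀ α → d < sumᴺ α → f α R.≈ R.0#

  h : ℕ → X.Carrier
  h n α = if does (sumᴺ α ≟ n) then R.1# else R.0#

  skewSchur : Skew → X.Carrier
  skewSchur D α = length (tableaux D α) ×ᴿ R.1#

  schur : List ℕ → X.Carrier
  schur λs = skewSchur (λs , [])

  ∑ : List A → (A → X.Carrier) → X.Carrier
  ∑ xs f = foldr X._+_ X.0# (map f xs)

  _•_ : R.Carrier → X.Carrier → X.Carrier
  (r • f) α = r R.* f α

  SchurPositive : X.Carrier → Set (c ⊔ ℓ₁ ⊔ ℓ₂)
  SchurPositive f =
    Σ[ Λs ∈ List (List ℕ) ] Σ[ coeff ∈ (List ℕ → R.Carrier) ]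
      Unique Λs × All Partition Λs × All (λ λs → R.0# R.≼ coeff λs) Λs
      × f X.≈ ∑ Λs (λ λs → coeff λs • schur λs)

  γ̃ : ℕ → ℕ → X.Carrier
  γ̃ n k = ∑ (H̃ n k) skewSchur

  -- Λ[t] is regarded as a subset of R[[x]][[t]], with the coefficient of t^k
  -- as value at k.
  R[[x]][[t]] : RawRing c ℓ₁
  R[[x]][[t]] = PowerSeries R[[x]]

  R[[x]][[t]][[z]] : RawRing c ℓ₁
  R[[x]][[t]][[z]] = PowerSeries R[[x]][[t]]

  open RawRing R[[x]][[t]] public
  open RawSemiringDefinitions rawSemiring public using (sum; _^_)

  private
    module Z = RawRing R[[x]][[t]][[z]]

  _∈Λ[t] : Carrier → Set ℓ₁
  A ∈Λ[t] = (∀ k → A k ∈Λ) × (∃[ d ] ∀ k → d < k → A k X.≈ X.0#)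

  t : Carrier
  t = variable₁ R[[x]]

  C : X.Carrier → Carrier
  C = constant R[[x]]

  Cz : Carrier → Z.Carrier
  Cz = constant R[[x]][[t]]

  H[z] H[tz] : Z.Carrier
  H[z]  n = C (h n)
  H[tz] n = C (h n) * t ^ n

  -- ∑ Qₙ zⁿ = (1 - t) H(z) / (H(tz) - t H(z)).  Since 1 - t, the constant term
  -- of the denominator, is not a zero divisor, this determines Q.
  IsQ : (ℕ → Carrier) → Set ℓ₁
  IsQ Q = Q Z.* (H[tz] Z.+ Z.- (Cz t Z.* H[z])) Z.≈ Cz (1# + - t) Z.* H[z]

  -- The sum over 1 ≤ m ≤ n, with m = suc i.
  Q̃ : (ℕ → Carrier) → ℕ → Carrier
  Q̃ Q n = C (h n) + t * sum {n} (λ i → C (h (n ∸ suc (toℕ i))) * Q (suc (toℕ i)))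

  γ-expansion : ℕ → (ℕ → X.Carrier) → Carrier
  γ-expansion d γ =
    sum {suc ⌊ d /2⌋} (λ k → C (γ (toℕ k)) * t ^ toℕ k * (1# + t) ^ (d ∸ 2 *ᴺ toℕ k))

  SchurγPositive : Carrier → Set (c ⊔ ℓ₁ ⊔ ℓ₂)
  SchurγPositive A =
    Σ[ d ∈ ℕ ] Σ[ γ ∈ (ℕ → X.Carrier) ]
      (∀ k → k ≤ ⌊ d /2⌋ → SchurPositive (γ k)) × A ≈ γ-expansion d γ

{-# OPTIONS --safe #-}
module Submission where

-- Reading a ribbon from its lowest row upwards turns its tableaux into words with
-- a prescribed descent set, and h_a times a ribbon Schur function is the sum of
-- the two ribbons in which a row of length a is put on top of, or glued to, the
-- top row.  Let P a j be the weighted sum of the ribbons with columns of size at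
-- most 2 whose top row has at least a cells and D a j that of those where it has
-- exactly a cells.  Then P a (j+1) = (1+t) P (a+1) j + t D (a+1) j and
-- D a j + P (a+1) (j-1) = h_a P 1 (j-1).  Eliminating D shows that the F (j+1) = P 1 j
-- satisfy the equation defining Q, and that h_n + t Σ h_(n-m) F m is the
-- γ-expansion.
--
-- For the Schur positivity, iterating Pieri's rule expands the ribbons in
-- Schur functions.  The coefficients are numbers of Yamanouchi words with a
-- prescribed descent set, by induction on the number of descents: words split in
-- the same way as the products of ribbons by h_a.  Pieri's rule itself is proved by
-- removing the last variable, that is, by commuting the operators that add
-- and remove horizontal strips.

-- Tableaux, words and ribbons are counted in ℕ, one exponent list at a time and hence in finitely
-- many variables. The counts enter the coefficient ring through the map from ℕ, whose values are
-- nonnegative; this is where positivity comes from. The quotient of series is never formed: 1 - t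
-- can be cancelled, so the defining equation has at most one solution, and it is enough to exhibit
-- one.
--
-- Elimination of D: the factor 1 + t in the recurrence yields two copies of the same P. Induction
-- can be applied to either copy. Each time a multiple of t appears that, together with the term in
-- D, forms a product of some h with some F. This gives F n = t p + A and F n = p + B with the same
-- p and with A and B explicit in the h and F. Replacing F n by t p + A, and t F n by t (p + B),
-- makes p cancel and leaves the equation for Q.
--
-- In Pieri's rule, branching at the last variable turns the two sides into counts of paths, up and
-- then down against down and then up, from one partition to another. Row by row the intermediate
-- partitions fill the same intervals, and only the first row, which has no upper limit, needs a
-- separate argument.

open import Defs
open import Algebra.Bundles using (CommutativeRing)
open import Algebra.Bundles.Raw using (RawRing)
import Algebra.Definitions.RawSemiring as RawSemiringDefinitions
import Algebra.Properties.CommutativeSemigroup as CommutativeSemigroupProperties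
import Algebra.Properties.Monoid.Mult as MonoidMultiples
import Algebra.Properties.Ring as RingProperties
import Algebra.Properties.Semiring.Mult as Multiples
import Algebra.Solver.Ring.NaturalCoefficients.Default as NaturalCoefficients
open import Data.Bool.Base using (Bool; true; false; if_then_else_)
open import Data.Empty using (⊥)
open import Data.Fin.Base using (toℕ)
open import Data.List.Base
  using (List; []; _∷_; _∷ʳ_; _++_; map; foldr; filter; length; zip; upTo; applyUpTo; concatMap;
         cartesianProduct; cartesianProductWith; replicate; take; drop; initLast; _∷ʳ′_)
open import Data.List.Membership.Propositional using (_∈_; find; lose)
open import Data.List.Membership.Propositional.Properties
  using (∈-concatMap⁺; ∈-concatMap⁻; ∈-map⁺; ∈-map⁻; ∈-filter⁺; ∈-filter⁻; ∈-upTo⁺; ∈-upTo⁻;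
         ∈-++⁺ˡ; ∈-++⁺ʳ; ∈-++⁻; ∈-cartesianProductWith⁺; ∈-cartesianProductWith⁻; ∈-cartesianProduct⁺)
open import Data.List.Membership.Propositional.Properties.WithK using (unique∧set⇒bag)
open import Data.List.Properties
  using (length-++; length-replicate; length-map; length-upTo; length-filter; ++-assoc; ++-identityʳ;
         map-++; map-upTo; map-cong-local; concatMap-map; concatMap-cong; foldr-++; upTo-∷ʳ;
         filter-++; filter-none; filter-all; filter-accept; filter-reject; take++drop≡id;
         ∷-injective; ∷ʳ-injective)
  renaming (≡-dec to ≡-decᴸ)
open import Data.List.Relation.Binary.BagAndSetEquality using (∼bag⇒↭)
open import Data.List.Relation.Binary.Permutation.Propositional using (_↭_; prep; swap)
  renaming (refl to ↭-refl; trans to ↭-trans)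
open import Data.List.Relation.Binary.Prefix.Heterogeneous using (Prefix; []; _∷_)
open import Data.List.Relation.Unary.All as All using (All; []; _∷_; all?)
import Data.List.Relation.Unary.All.Properties as AllP
open import Data.List.Relation.Unary.AllPairs as AllPairs using (AllPairs; []; _∷_; allPairs?)
import Data.List.Relation.Unary.AllPairs.Properties as AllPairsP
open import Data.List.Relation.Unary.Any using (Any; here; there)
open import Data.List.Relation.Unary.Linked using (Linked; []; [-]; _∷_)
import Data.List.Relation.Unary.Linked.Properties as LinkedP
open import Data.List.Relation.Unary.Unique.Propositional using (Unique)
import Data.List.Relation.Unary.Unique.Propositional.Properties as UniqueP
open import Data.Maybe.Base as Maybe using (Maybe; just; nothing; _>>=_)
open import Data.Nat.Base as ℕ using (ℕ; zero; suc; _∸_; _<_; _≤_; z<s; s<s; z≤n; s≤s)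
open import Data.Nat.ListAction using () renaming (sum to total)
import Data.Nat.Properties as ℕ
open import Data.Nat.Tactic.RingSolver using (solve-∀)
open import Data.Product.Base using (∃-syntax; _×_; _,_; proj₁; proj₂; uncurry)
open import Data.Sum.Base using (inj₁; inj₂)
open import Data.Unit.Base using (⊤; tt)
open import Function.Base using (_∘_; id)
open import Function.Bundles using (mk⇔)
open import Relation.Binary.Construct.Closure.ReflexiveTransitive using (Star; ε; _◅_; _◅◅_; reverse)
open import Relation.Binary.Definitions using (tri<; tri≈; tri>)
open import Relation.Binary.PropositionalEquality
  using (_≡_; _≢_; refl; sym; trans; cong; cong₂; subst; subst₂; module ≡-Reasoning)
import Relation.Binary.Reasoning.Setoid as SetoidReasoning
open import Relation.Binary.Structures using (IsPartialOrder)
open import Relation.Nullary.Decidable using (Dec; yes; no; does; _×-dec_; _→-dec_; dec-true; dec-false)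
open import Relation.Nullary.Negation using (¬_; contradiction)
open import Relation.Unary using (Pred) renaming (Decidable to Decidable₁)

-- Rings of power series

module RingSum {c ℓ} (A : CommutativeRing c ℓ) where
  open CommutativeRing A hiding (sym; trans; refl)
  open CommutativeRing A using () renaming (sym to ≈-sym; trans to ≈-trans; refl to ≈-refl)
  open RawSemiringDefinitions (RawRing.rawSemiring rawRing) using (sum)
  open SetoidReasoning setoid

  interchange : ∀ a b c d → (a + b) + (c + d) ≈ (a + c) + (b + d)
  interchange = CommutativeSemigroupProperties.interchange (CommutativeRing.+-commutativeSemigroup A)

  ∑< : ℕ → (ℕ → Carrier) → Carrier
  ∑< zero    f = 0#
  ∑< (suc n) f = f 0 + ∑< n (λ i → f (suc i))

  sum-∑< : ∀ n f → sum {n} (λ i → f (toℕ i)) ≡ ∑< n f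
  sum-∑< zero    f = refl
  sum-∑< (suc n) f = cong (f 0 +_) (sum-∑< n (λ i → f (suc i)))

  ∑<-congᵇ : ∀ n {f g} → (∀ i → i < n → f i ≈ g i) → ∑< n f ≈ ∑< n g
  ∑<-congᵇ zero    e = ≈-refl
  ∑<-congᵇ (suc n) e = +-cong (e 0 z<s) (∑<-congᵇ n λ i i<n → e (suc i) (s<s i<n))

  ∑<-cong : ∀ n {f g} → (∀ i → f i ≈ g i) → ∑< n f ≈ ∑< n g
  ∑<-cong n e = ∑<-congᵇ n λ i _ → e i

  ∑<-0 : ∀ n → ∑< n (λ _ → 0#) ≈ 0#
  ∑<-0 zero    = ≈-refl
  ∑<-0 (suc n) = ≈-trans (+-identityˡ _) (∑<-0 n)

  ∑<-+ : ∀ n f g → ∑< n (λ i → f i + g i) ≈ ∑< n f + ∑< n g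
  ∑<-+ zero    f g = ≈-sym (+-identityˡ 0#)
  ∑<-+ (suc n) f g = ≈-trans (+-congˡ (∑<-+ n _ _)) (interchange (f 0) (g 0) _ _)

  ∑<-*ˡ : ∀ n x f → ∑< n (λ i → x * f i) ≈ x * ∑< n f
  ∑<-*ˡ zero    x f = ≈-sym (zeroʳ x)
  ∑<-*ˡ (suc n) x f = ≈-trans (+-congˡ (∑<-*ˡ n x _)) (≈-sym (distribˡ x _ _))

  ∑<-last : ∀ n f → ∑< (suc n) f ≈ ∑< n f + f n
  ∑<-last zero    f = +-comm (f 0) 0#
  ∑<-last (suc n) f = ≈-trans (+-congˡ (∑<-last n _)) (≈-sym (+-assoc (f 0) _ _))

  ∑<-reverse : ∀ n f → ∑< (suc n) f ≈ ∑< (suc n) (λ i → f (n ∸ i))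
  ∑<-reverse zero    f = ≈-refl
  ∑<-reverse (suc n) f = begin
    ∑< (suc (suc n)) f                               ≈⟨ ∑<-last (suc n) f ⟩
    ∑< (suc n) f + f (suc n)                         ≈⟨ +-comm _ _ ⟩
    f (suc n) + ∑< (suc n) f                         ≈⟨ +-congˡ (∑<-reverse n f) ⟩
    f (suc n) + ∑< (suc n) (λ i → f (n ∸ i))         ∎

  ∑<-single : ∀ n f k → k < n → (∀ i → i < n → i ≢ k → f i ≈ 0#) → ∑< n f ≈ f k
  ∑<-single (suc n) f zero    _         z =
    ≈-trans (+-congˡ (≈-trans (∑<-congᵇ n λ i i<n → z (suc i) (s<s i<n) λ ()) (∑<-0 n))) (+-identityʳ (f 0))
  ∑<-single (suc n) f (suc k) (s<s k<n) z =
    ≈-trans (+-congʳ (z 0 z<s λ ()))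
      (≈-trans (+-identityˡ _) (∑<-single n _ k k<n λ i i<n i≢k → z (suc i) (s<s i<n) λ e → i≢k (ℕ.suc-injective e)))

module PowerSeriesRing {c ℓ} (A : CommutativeRing c ℓ) where
  open CommutativeRing A hiding (sym; trans; refl)
  open CommutativeRing A using () renaming (sym to ≈-sym; trans to ≈-trans; refl to ≈-refl)
  open RingSum A
  open SetoidReasoning setoid
  private
    module S = RawRing (PowerSeries rawRing)
    shift : S.Carrier → S.Carrier
    shift f n = f (suc n)

  convolution : ∀ f g n → (f S.* g) n ≡ ∑< (suc n) (λ i → f i * g (n ∸ i))
  convolution f g n = sum-∑< (suc n) (λ i → f i * g (n ∸ i))

  *-congᴾ : ∀ {f f′ g g′} → f S.≈ f′ → g S.≈ g′ → (f S.* g) S.≈ (f′ S.* g′)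
  *-congᴾ {f} {f′} {g} {g′} e e′ n = begin
    (f S.* g) n                                ≡⟨ convolution f g n ⟩
    ∑< (suc n) (λ i → f i * g (n ∸ i))         ≈⟨ ∑<-cong (suc n) (λ i → *-cong (e i) (e′ (n ∸ i))) ⟩
    ∑< (suc n) (λ i → f′ i * g′ (n ∸ i))       ≡⟨ sym (convolution f′ g′ n) ⟩
    (f′ S.* g′) n                              ∎

  distribʳᴾ : ∀ h f g → ((f S.+ g) S.* h) S.≈ ((f S.* h) S.+ (g S.* h))
  distribʳᴾ h f g n = begin
    ((f S.+ g) S.* h) n                                                           ≡⟨ convolution (f S.+ g) h n ⟩
    ∑< (suc n) (λ i → (f i + g i) * h (n ∸ i))                                    ≈⟨ ∑<-cong (suc n) (λ i → distribʳ (h (n ∸ i)) (f i) (g i)) ⟩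
    ∑< (suc n) (λ i → f i * h (n ∸ i) + g i * h (n ∸ i))                          ≈⟨ ∑<-+ (suc n) (λ i → f i * h (n ∸ i)) (λ i → g i * h (n ∸ i)) ⟩
    ∑< (suc n) (λ i → f i * h (n ∸ i)) + ∑< (suc n) (λ i → g i * h (n ∸ i))       ≡⟨ sym (cong₂ _+_ (convolution f h n) (convolution g h n)) ⟩
    (f S.* h) n + (g S.* h) n                                                     ∎

  scale : ∀ x f g n → ((λ i → x * f i) S.* g) n ≈ x * (f S.* g) n
  scale x f g n = begin
    ((λ i → x * f i) S.* g) n                         ≡⟨ convolution (λ i → x * f i) g n ⟩
    ∑< (suc n) (λ i → x * f i * g (n ∸ i))            ≈⟨ ∑<-cong (suc n) (λ i → *-assoc x (f i) (g (n ∸ i))) ⟩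
    ∑< (suc n) (λ i → x * (f i * g (n ∸ i)))          ≈⟨ ∑<-*ˡ (suc n) x (λ i → f i * g (n ∸ i)) ⟩
    x * ∑< (suc n) (λ i → f i * g (n ∸ i))            ≡⟨ cong (x *_) (sym (convolution f g n)) ⟩
    x * (f S.* g) n                                   ∎

  -- The convolution unfolds at the first coefficient of its left factor. Exchanging the factors
  -- turns this into the last term of the sum, so commutativity needs the unfolding at the other end
  -- too.
  *-last : ∀ f g n → (f S.* g) (suc n) ≈ (f S.* shift g) n + f (suc n) * g 0
  *-last f g zero    = begin
    f 0 * g 1 + (f 1 * g 0 + 0#)     ≈⟨ +-congˡ (+-identityʳ _) ⟩
    f 0 * g 1 + f 1 * g 0            ≈⟨ +-congʳ (≈-sym (+-identityʳ _)) ⟩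
    f 0 * g 1 + 0# + f 1 * g 0       ∎
  *-last f g (suc n) = ≈-trans (+-congˡ (*-last (shift f) g n)) (≈-sym (+-assoc _ _ _))

  *-commᴾ : ∀ f g → (f S.* g) S.≈ (g S.* f)
  *-commᴾ f g zero    = +-congʳ (*-comm (f 0) (g 0))
  *-commᴾ f g (suc n) = begin
    f 0 * g (suc n) + (shift f S.* g) n      ≈⟨ +-cong (*-comm (f 0) _) (*-commᴾ (shift f) g n) ⟩
    g (suc n) * f 0 + (g S.* shift f) n      ≈⟨ +-comm _ _ ⟩
    (g S.* shift f) n + g (suc n) * f 0      ≈⟨ ≈-sym (*-last g f n) ⟩
    (g S.* f) (suc n)                        ∎

  -- Induction on the degree, with the coefficient `f 0` split off: the shift of a product is `f 0`
  -- times the shift of `g` plus the product of the shift of `f` with `g`, and distributivity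
  -- separates the two.
  *-assocᴾ : ∀ f g h → ((f S.* g) S.* h) S.≈ (f S.* (g S.* h))
  *-assocᴾ f g h zero    = +-congʳ (begin
    (f 0 * g 0 + 0#) * h 0      ≈⟨ *-congʳ (+-identityʳ _) ⟩
    f 0 * g 0 * h 0             ≈⟨ *-assoc _ _ _ ⟩
    f 0 * (g 0 * h 0)           ≈⟨ *-congˡ (≈-sym (+-identityʳ _)) ⟩
    f 0 * (g 0 * h 0 + 0#)      ∎)
  *-assocᴾ f g h (suc n) = begin
    (f 0 * g 0 + 0#) * h (suc n) + ((λ i → f 0 * shift g i + (shift f S.* g) i) S.* h) n
      ≈⟨ +-cong (≈-trans (*-congʳ (+-identityʳ _)) (*-assoc _ _ _))
                (≈-trans (distribʳᴾ h (λ i → f 0 * shift g i) (shift f S.* g) n) (+-cong (scale (f 0) (shift g) h n) (*-assocᴾ (shift f) g h n))) ⟩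
    f 0 * (g 0 * h (suc n)) + (f 0 * (shift g S.* h) n + (shift f S.* (g S.* h)) n)
      ≈⟨ ≈-sym (+-assoc _ _ _) ⟩
    f 0 * (g 0 * h (suc n)) + f 0 * (shift g S.* h) n + (shift f S.* (g S.* h)) n
      ≈⟨ +-congʳ (≈-sym (distribˡ (f 0) _ _)) ⟩
    f 0 * (g S.* h) (suc n) + (shift f S.* (g S.* h)) n ∎

  *-constantˡ : ∀ x f n → (constant rawRing x S.* f) n ≈ x * f n
  *-constantˡ x f n = begin
    (constant rawRing x S.* f) n                                ≡⟨ convolution (constant rawRing x) f n ⟩
    ∑< (suc n) (λ i → constant rawRing x i * f (n ∸ i))         ≈⟨ ∑<-single (suc n) (λ i → constant rawRing x i * f (n ∸ i)) 0 z<s (λ { zero _ c → contradiction refl c ; (suc i) _ _ → zeroˡ (f (n ∸ suc i)) }) ⟩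
    x * f n                                                     ∎

  *-identityˡᴾ : ∀ f → (S.1# S.* f) S.≈ f
  *-identityˡᴾ f n = ≈-trans (*-constantˡ 1# f n) (*-identityˡ (f n))

  constant-0 : ∀ n → constant rawRing 0# n ≈ 0#
  constant-0 zero    = ≈-refl
  constant-0 (suc n) = ≈-refl

  powerSeriesRing : CommutativeRing c ℓ
  powerSeriesRing = record
    { isCommutativeRing = record
      { isRing = record
        { +-isAbelianGroup = record
          { isGroup = record
            { isMonoid = record
              { isSemigroup = record
                { isMagma = record
                  { isEquivalence = record
                    { refl = λ _ → ≈-refl ; sym = λ e n → ≈-sym (e n) ; trans = λ e e′ n → ≈-trans (e n) (e′ n) }
                  ; ∙-cong = λ e e′ n → +-cong (e n) (e′ n) }
                ; assoc = λ f g h n → +-assoc (f n) (g n) (h n) }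
              ; identity = (λ f n → ≈-trans (+-congʳ (constant-0 n)) (+-identityˡ (f n))) ,
                           (λ f n → ≈-trans (+-congˡ (constant-0 n)) (+-identityʳ (f n))) }
            ; inverse = (λ f n → ≈-trans (-‿inverseˡ (f n)) (≈-sym (constant-0 n))) ,
                        (λ f n → ≈-trans (-‿inverseʳ (f n)) (≈-sym (constant-0 n)))
            ; ⁻¹-cong = λ e n → -‿cong (e n) }
          ; comm = λ f g n → +-comm (f n) (g n) }
        ; *-cong = *-congᴾ
        ; *-assoc = *-assocᴾ
        ; *-identity = *-identityˡᴾ , λ f n → ≈-trans (*-commᴾ f S.1# n) (*-identityˡᴾ f n)
        ; distrib = (λ h f g n → ≈-trans (*-commᴾ h (f S.+ g) n) (≈-trans (distribʳᴾ h f g n) (+-cong (*-commᴾ f h n) (*-commᴾ g h n)))) ,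
                    distribʳᴾ }
      ; *-comm = *-commᴾ } }

module SeriesRing {c ℓ} (A : CommutativeRing c ℓ) where
  private
    module A = CommutativeRing A
    module X = RawRing (SeriesInX A.rawRing)

    PS : ℕ → CommutativeRing c ℓ
    PS zero    = A
    PS (suc n) = PowerSeriesRing.powerSeriesRing (PS n)
    module PS (n : ℕ) = CommutativeRing (PS n)

    at : X.Carrier → ℕ → X.Carrier
    at f a β = f (a ∷ β)

    -- In n variables a series is an n-fold iterated power series, and to n is a
    -- homomorphism; the ring laws are read off from its values.
    to : ∀ n → X.Carrier → PS.Carrier n
    to zero    f = f []
    to (suc n) f a = to n (at f a)

    to-cong : ∀ n {f g} → (∀ α → length α ≡ n → f α A.≈ g α) → PS._≈_ n (to n f) (to n g)
    to-cong zero    e = e [] refl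
    to-cong (suc n) e a = to-cong n λ α l → e (a ∷ α) (cong suc l)

    from : ∀ n {f g} → PS._≈_ n (to n f) (to n g) → ∀ α → length α ≡ n → f α A.≈ g α
    from zero    e []      l = e
    from (suc n) e (a ∷ α) l = from n (e a) α (ℕ.suc-injective l)

    to-+ : ∀ n f g → PS._≈_ n (to n (f X.+ g)) (PS._+_ n (to n f) (to n g))
    to-+ zero    f g = A.refl
    to-+ (suc n) f g a = to-+ n (at f a) (at g a)

    to-0 : ∀ n → PS._≈_ n (to n X.0#) (PS.0# n)
    to-0 zero    = A.refl
    to-0 (suc n) zero    = to-0 n
    to-0 (suc n) (suc a) = to-0 n

    to-1 : ∀ n → PS._≈_ n (to n X.1#) (PS.1# n)
    to-1 zero    = A.refl
    to-1 (suc n) zero    = to-1 n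
    to-1 (suc n) (suc a) = to-0 n

    to-∑ : ∀ n k (F : ℕ → X.Carrier) →
      PS._≈_ n (to n (λ β → RingSum.∑< A k (λ i → F i β))) (RingSum.∑< (PS n) k (λ i → to n (F i)))
    to-∑ n zero    F = to-0 n
    to-∑ n (suc k) F = PS.trans n (to-+ n (F 0) _) (PS.+-cong n (PS.refl n) (to-∑ n k (λ i → F (suc i))))

    to-* : ∀ n f g → PS._≈_ n (to n (f X.* g)) (PS._*_ n (to n f) (to n g))
    to-* zero    f g = A.refl
    to-* (suc n) f g a = PS.trans n
      (to-cong n λ α _ → A.reflexive (RingSum.sum-∑< A (suc a) (λ i → (at f i X.* at g (a ∸ i)) α)))
      (PS.trans n (to-∑ n (suc a) (λ i → at f i X.* at g (a ∸ i)))
      (PS.trans n (RingSum.∑<-cong (PS n) (suc a) (λ i → to-* n (at f i) (at g (a ∸ i))))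
        (PS.reflexive n (sym (PowerSeriesRing.convolution (PS n) (to (suc n) f) (to (suc n) g) a)))))

    -- A list of exponents is seen by `to` at its own length, so an equation of series may be tested
    -- for each number of variables separately.
    law : ∀ {f g} → (∀ n → PS._≈_ n (to n f) (to n g)) → f X.≈ g
    law e α = from (length α) (e (length α)) α refl

    *-congˣ : ∀ {f f′ g g′} → f X.≈ f′ → g X.≈ g′ → (f X.* g) X.≈ (f′ X.* g′)
    *-congˣ {f} {f′} {g} {g′} e e′ = law λ n → PS.trans n (to-* n f g)
      (PS.trans n (PS.*-cong n (to-cong n λ α _ → e α) (to-cong n λ α _ → e′ α)) (PS.sym n (to-* n f′ g′)))

    *-assocˣ : ∀ f g h → ((f X.* g) X.* h) X.≈ (f X.* (g X.* h))
    *-assocˣ f g h = law λ n → PS.trans n (to-* n (f X.* g) h) (PS.trans n (PS.*-cong n (to-* n f g) (PS.refl n))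
      (PS.trans n (PS.*-assoc n _ _ _) (PS.sym n (PS.trans n (to-* n f (g X.* h)) (PS.*-cong n (PS.refl n) (to-* n g h))))))

    *-commˣ : ∀ f g → (f X.* g) X.≈ (g X.* f)
    *-commˣ f g = law λ n → PS.trans n (to-* n f g) (PS.trans n (PS.*-comm n _ _) (PS.sym n (to-* n g f)))

    *-identityˡˣ : ∀ f → (X.1# X.* f) X.≈ f
    *-identityˡˣ f = law λ n → PS.trans n (to-* n X.1# f) (PS.trans n (PS.*-cong n (to-1 n) (PS.refl n)) (PS.*-identityˡ n _))

    distribʳˣ : ∀ h f g → ((f X.+ g) X.* h) X.≈ ((f X.* h) X.+ (g X.* h))
    distribʳˣ h f g = law λ n → PS.trans n (to-* n (f X.+ g) h) (PS.trans n (PS.*-cong n (to-+ n f g) (PS.refl n))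
      (PS.trans n (PS.distribʳ n _ _ _) (PS.sym n (PS.trans n (to-+ n (f X.* h) (g X.* h)) (PS.+-cong n (to-* n f h) (to-* n g h))))))

  seriesRing : CommutativeRing c ℓ
  seriesRing = record
    { isCommutativeRing = record
      { isRing = record
        { +-isAbelianGroup = record
          { isGroup = record
            { isMonoid = record
              { isSemigroup = record
                { isMagma = record
                  { isEquivalence = record
                    { refl = λ _ → A.refl ; sym = λ e α → A.sym (e α) ; trans = λ e e′ α → A.trans (e α) (e′ α) }
                  ; ∙-cong = λ e e′ α → A.+-cong (e α) (e′ α) }
                ; assoc = λ f g h α → A.+-assoc (f α) (g α) (h α) }
              ; identity = (λ f α → A.+-identityˡ (f α)) , (λ f α → A.+-identityʳ (f α)) }
            ; inverse = (λ f α → A.-‿inverseˡ (f α)) , (λ f α → A.-‿inverseʳ (f α))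
            ; ⁻¹-cong = λ e α → A.-‿cong (e α) }
          ; comm = λ f g α → A.+-comm (f α) (g α) }
        ; *-cong = *-congˣ
        ; *-assoc = *-assocˣ
        ; *-identity = *-identityˡˣ , λ f α → A.trans (*-commˣ f X.1# α) (*-identityˡˣ f α)
        ; distrib = (λ h f g α → A.trans (*-commˣ h (f X.+ g) α) (A.trans (distribʳˣ h f g α) (A.+-cong (*-commˣ f h α) (*-commˣ g h α)))) ,
                    distribʳˣ }
      ; *-comm = *-commˣ } }

-- The recurrence for sums over ribbons

widen : List ℕ → List ℕ
widen []       = []
widen (s ∷ ss) = suc s ∷ ss

widenBy : ℕ → List ℕ → List ℕ
widenBy a []       = []
widenBy a (s ∷ ss) = (s ℕ.+ a) ∷ ss

-- The bookkeeping of the elimination. Subtracted terms have been moved across the equations, so a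
-- solver for commutative semirings applies.
module RingIdentities {c ℓ} (T : CommutativeRing c ℓ) where
  open CommutativeRing T using (_≈_; _+_; _*_; commutativeSemiring) renaming (refl to ≈-refl)
  open NaturalCoefficients commutativeSemiring using (solve; _:=_; _:+_; _:*_)

  *-swapˡᵀ : ∀ x y z → x * (y * z) ≈ y * (x * z)
  *-swapˡᵀ = solve 3 (λ x y z → x :* (y :* z) := y :* (x :* z)) ≈-refl

  combine-* : ∀ o t x p d → o * (x * p) + t * (x * d) ≈ x * (o * p + t * d)
  combine-* = solve 5 (λ o t x p d → o :* (x :* p) :+ t :* (x :* d) := x :* (o :* p :+ t :* d)) ≈-refl

  combine-+ : ∀ o t p q d e → o * (p + q) + t * (d + e) ≈ (o * p + t * d) + (o * q + t * e)
  combine-+ = solve 6 (λ o t p q d e → o :* (p :+ q) :+ t :* (d :+ e) := (o :* p :+ t :* d) :+ (o :* q :+ t :* e)) ≈-refl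

  extract-A : ∀ t p₁ d p₂ A → (p₁ + (t * p₂ + A)) + t * d ≈ p₁ + (t * (d + p₂) + A)
  extract-A = solve 5 (λ t p₁ d p₂ A → (p₁ :+ (t :* p₂ :+ A)) :+ t :* d := p₁ :+ (t :* (d :+ p₂) :+ A)) ≈-refl

  extract-B : ∀ t p₁ p₂ B d → (p₁ + t * (p₂ + B)) + t * d ≈ p₁ + (t * B + t * (d + p₂))
  extract-B = solve 5 (λ t p₁ p₂ B d → (p₁ :+ t :* (p₂ :+ B)) :+ t :* d := p₁ :+ (t :* B :+ t :* (d :+ p₂))) ≈-refl

  collect-A : ∀ t x y H S → t * (x * y) + (H + t * S) ≈ H + t * (x * y + S)
  collect-A = solve 5 (λ t x y H S → t :* (x :* y) :+ (H :+ t :* S) := H :+ t :* (x :* y :+ S)) ≈-refl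

  collect-plus : ∀ y x t u w → y * (x * (t * u)) + t * u * w ≈ u * (t * w + t * (x * y))
  collect-plus = solve 5 (λ y x t u w → y :* (x :* (t :* u)) :+ t :* u :* w := u :* (t :* w :+ t :* (x :* y))) ≈-refl

  collect-minus : ∀ y x t W H → y * (t * x) + W + H ≈ t * (x * y) + (W + H)
  collect-minus = solve 5 (λ y x t W H → y :* (t :* x) :+ W :+ H := t :* (x :* y) :+ (W :+ H)) ≈-refl

  collect-minus′ : ∀ y A H → y + (A + H) ≈ (y + A) + H
  collect-minus′ = solve 3 (λ y A H → y :+ (A :+ H) := (y :+ A) :+ H) ≈-refl

  top-coefficient : ∀ t p A B X H → ((t * p + A) + (X + t * B)) + t * H ≈ (t * (p + B) + X) + (A + t * H)
  top-coefficient = solve 6 (λ t p A B X H → ((t :* p :+ A) :+ (X :+ t :* B)) :+ t :* H := (t :* (p :+ B) :+ X) :+ (A :+ t :* H)) ≈-refl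

  regroup-minus : ∀ F X W H → (F + (X + W)) + H ≈ (F + X) + (W + H)
  regroup-minus = solve 4 (λ F X W H → (F :+ (X :+ W)) :+ H := (F :+ X) :+ (W :+ H)) ≈-refl

  Q̃-collect : ∀ t F p₁ A d → ((t * p₁ + A) + t * F) + t * d ≈ t * F + (A + t * (d + p₁))
  Q̃-collect = solve 5 (λ t F p₁ A d → ((t :* p₁ :+ A) :+ t :* F) :+ t :* d := t :* F :+ (A :+ t :* (d :+ p₁))) ≈-refl

  Q̃-assemble : ∀ t F H S x y → t * F + ((H + t * S) + t * (x * y)) ≈ H + t * (F + (x * y + S))
  Q̃-assemble = solve 6 (λ t F H S x y → t :* F :+ ((H :+ t :* S) :+ t :* (x :* y)) := H :+ t :* (F :+ (x :* y :+ S))) ≈-refl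

-- N ss stands for the ribbon Schur function of ss, and P j f for the sum of
-- t^k (1+t)^(j-2k) f ss over the ribbons ss with k + 1 rows and j + 1 cells whose
-- rows, except possibly the last, have at least two cells.
module Recurrence {c ℓ} (T : CommutativeRing c ℓ) (t : CommutativeRing.Carrier T)
                  (h : ℕ → CommutativeRing.Carrier T) (N : List ℕ → CommutativeRing.Carrier T) where
  open CommutativeRing T hiding (sym; trans; refl)
  open CommutativeRing T using () renaming (sym to ≈-sym; trans to ≈-trans; refl to ≈-refl)
  open RawSemiringDefinitions (RawRing.rawSemiring rawRing) using (_^_)
  open RingSum T
  open RingIdentities T
  open SetoidReasoning setoid

  -- A top row of two cells lying on another row can be removed: this lowers the number of cells by
  -- two and `k` by one and so costs a factor `t`. Any other ribbon with more than one cell arises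
  -- by widening the top row, which leaves `k` alone and costs `1# + t`.
  P D : ℕ → (List ℕ → Carrier) → Carrier
  P zero    f = f (0 ∷ [])
  P (suc j) f = (1# + t) * P j (λ ss → f (widen ss)) + t * D j f
  D zero    f = 0#
  D (suc j) f = P j (λ ss → f (1 ∷ ss))

  P-cong : ∀ j {f g} → (∀ s ss → f (s ∷ ss) ≈ g (s ∷ ss)) → P j f ≈ P j g
  D-cong : ∀ j {f g} → (∀ s ss → f (s ∷ ss) ≈ g (s ∷ ss)) → D j f ≈ D j g
  P-cong zero    e = e 0 []
  P-cong (suc j) e = +-cong (*-congˡ (P-cong j λ s ss → e (suc s) ss)) (*-congˡ (D-cong j e))
  D-cong zero    e = ≈-refl
  D-cong (suc j) e = P-cong j λ s ss → e 1 (s ∷ ss)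

  P-*ˡ : ∀ j x f → P j (λ ss → x * f ss) ≈ x * P j f
  D-*ˡ : ∀ j x f → D j (λ ss → x * f ss) ≈ x * D j f
  P-*ˡ zero    x f = ≈-refl
  P-*ˡ (suc j) x f = ≈-trans (+-cong (*-congˡ (P-*ˡ j x _)) (*-congˡ (D-*ˡ j x f))) (combine-* (1# + t) t x _ _)
  D-*ˡ zero    x f = ≈-sym (zeroʳ x)
  D-*ˡ (suc j) x f = P-*ˡ j x _

  P-+ : ∀ j f g → P j (λ ss → f ss + g ss) ≈ P j f + P j g
  D-+ : ∀ j f g → D j (λ ss → f ss + g ss) ≈ D j f + D j g
  P-+ zero    f g = ≈-refl
  P-+ (suc j) f g = ≈-trans (+-cong (*-congˡ (P-+ j _ _)) (*-congˡ (D-+ j f g))) (combine-+ (1# + t) t _ _ _ _)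
  D-+ zero    f g = ≈-sym (+-identityˡ 0#)
  D-+ (suc j) f g = P-+ j _ _

  1+t : ∀ x → (1# + t) * x ≈ t * x + x
  1+t x = ≈-trans (distribʳ x 1# t) (≈-trans (+-congʳ (*-identityˡ x)) (+-comm x (t * x)))

  -- `F` will be the sequence of the Qₙ and `G` that of the γ-expansions. In the latter the exponent
  -- of 1 + t is n - 2k instead of n - 1 - 2k, hence the additional `1# + t`. A single cell on top,
  -- `0 ∷ ss`, raises n by one and k by one; compared with the weight in `P j` this costs only `t`.
  F G : ℕ → Carrier
  F zero    = 1#
  F (suc j) = P j N
  G zero    = 1#
  G (suc zero)    = (1# + t) * P 0 N
  G (suc (suc j)) = (1# + t) * P (suc j) N + t * P j (λ ss → N (0 ∷ ss))

  module _ (h₀ : h 0 ≈ 1#) (N-row : ∀ a → N (a ∷ []) ≈ h (suc a))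
           (N-split : ∀ a s ss → h (suc a) * N (s ∷ ss) ≈ N (a ∷ s ∷ ss) + N ((s ℕ.+ suc a) ∷ ss)) where

    private
      -- The `a` cells added in `p`, and the new row in `d`, carry no weight: the powers of `t` and
      -- `1# + t` are those of the smaller ribbon.
      p d : ℕ → ℕ → Carrier
      p a j = P j (λ ss → N (widenBy a ss))
      d a j = P j (λ ss → N (a ∷ ss))

      p-0 : ∀ a → p a 0 ≈ h (suc a)
      p-0 a = N-row a

      p-widen : ∀ a j → P j (λ ss → N (widenBy a (widen ss))) ≈ p (suc a) j
      p-widen a j = P-cong j λ s ss → reflexive (cong (λ z → N (z ∷ ss)) (sym (ℕ.+-suc s a)))

      p-1 : ∀ a → p a 1 ≈ t * p (suc a) 0 + h (suc (suc a))
      p-1 a = begin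
        (1# + t) * N (suc a ∷ []) + t * 0#      ≈⟨ +-congˡ (zeroʳ t) ⟩
        (1# + t) * N (suc a ∷ []) + 0#          ≈⟨ +-identityʳ _ ⟩
        (1# + t) * N (suc a ∷ [])               ≈⟨ 1+t _ ⟩
        t * N (suc a ∷ []) + N (suc a ∷ [])     ≈⟨ +-congˡ (N-row (suc a)) ⟩
        t * N (suc a ∷ []) + h (suc (suc a))    ∎

      p-suc : ∀ a j → p a (suc (suc j)) ≈ (t * p (suc a) (suc j) + p (suc a) (suc j)) + t * d (suc a) j
      p-suc a j = +-congʳ (≈-trans (*-congˡ (p-widen a (suc j))) (1+t _))

      p-0-N : ∀ j → p 0 j ≈ P j N
      p-0-N j = P-cong j λ s ss → reflexive (cong (λ z → N (z ∷ ss)) (ℕ.+-identityʳ s))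

      split : ∀ a j → d a j + p (suc a) j ≈ h (suc a) * F (suc j)
      split a j = begin
        d a j + p (suc a) j                                       ≈⟨ ≈-sym (P-+ j _ _) ⟩
        P j (λ ss → N (a ∷ ss) + N (widenBy (suc a) ss))          ≈⟨ P-cong j (λ s ss → ≈-sym (N-split a s ss)) ⟩
        P j (λ ss → h (suc a) * N ss)                             ≈⟨ P-*ˡ j (h (suc a)) N ⟩
        h (suc a) * P j N                                         ∎

      -- `A` and `B` are the remainders of the two eliminations. `W⁺ a j` and `W⁻ a j` are the parts
      -- of the convolutions of `F` with H(tz) and t H(z) in which the degree of h is at least a +
      -- 2. `hh a j` is h of degree j + a + 2, written with the recursion that the others follow.
      A B W⁺ W⁻ hh : ℕ → ℕ → Carrier
      A a zero    = h (suc (suc a))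
      A a (suc j) = t * (h (suc (suc a)) * F (suc j)) + A (suc a) j
      B a zero    = t * h (suc (suc a))
      B a (suc j) = t * B (suc a) j + t * (h (suc (suc a)) * F (suc j))
      hh a zero    = h (suc (suc a))
      hh a (suc j) = hh (suc a) j

      -- Of the two copies of `p (suc a) (suc j)` in `p-suc`, the induction hypothesis rewrites the
      -- one without the factor `t`. The resulting `t * p (suc (suc a)) j` joins `t * d (suc a) j`,
      -- and `split` turns their sum into a product of h and F.
      p-A : ∀ j a → p a (suc j) ≈ t * p (suc a) j + A a j
      p-A zero    a = p-1 a
      p-A (suc j) a = begin
        p a (suc (suc j))
          ≈⟨ p-suc a j ⟩
        (t * p (suc a) (suc j) + p (suc a) (suc j)) + t * d (suc a) j
          ≈⟨ +-congʳ (+-congˡ (p-A j (suc a))) ⟩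
        (t * p (suc a) (suc j) + (t * p (suc (suc a)) j + A (suc a) j)) + t * d (suc a) j
          ≈⟨ extract-A t (t * p (suc a) (suc j)) (d (suc a) j) (p (suc (suc a)) j) (A (suc a) j) ⟩
        t * p (suc a) (suc j) + (t * (d (suc a) j + p (suc (suc a)) j) + A (suc a) j)
          ≈⟨ +-congˡ (+-congʳ (*-congˡ (split (suc a) j))) ⟩
        t * p (suc a) (suc j) + A a (suc j) ∎

      -- As for `p-A`, but the induction hypothesis rewrites the copy that has the factor `t`.
      p-B : ∀ j a → p a (suc j) ≈ p (suc a) j + B a j
      p-B zero    a = ≈-trans (p-1 a) (≈-trans (+-cong (*-congˡ (p-0 (suc a))) (≈-sym (p-0 (suc a)))) (+-comm _ _))
      p-B (suc j) a = begin
        p a (suc (suc j))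
          ≈⟨ p-suc a j ⟩
        (t * p (suc a) (suc j) + p (suc a) (suc j)) + t * d (suc a) j
          ≈⟨ +-congʳ (≈-trans (+-comm _ _) (+-congˡ (*-congˡ (p-B j (suc a))))) ⟩
        (p (suc a) (suc j) + t * (p (suc (suc a)) j + B (suc a) j)) + t * d (suc a) j
          ≈⟨ extract-B t (p (suc a) (suc j)) (p (suc (suc a)) j) (B (suc a) j) (d (suc a) j) ⟩
        p (suc a) (suc j) + (t * B (suc a) j + t * (d (suc a) j + p (suc (suc a)) j))
          ≈⟨ +-congˡ (+-congˡ (*-congˡ (split (suc a) j))) ⟩
        p (suc a) (suc j) + B a (suc j) ∎

      hh-h : ∀ a j → hh a j ≡ h (suc (suc (j ℕ.+ a)))
      hh-h a zero    = refl
      hh-h a (suc j) = trans (hh-h (suc a) j) (cong (λ z → h (suc (suc z))) (ℕ.+-suc j a))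

      A-sum : ∀ j a → A a j ≈ hh a j + t * ∑< j (λ i → h (suc (suc (i ℕ.+ a))) * F (j ∸ i))
      A-sum zero    a = ≈-sym (≈-trans (+-congˡ (zeroʳ t)) (+-identityʳ _))
      A-sum (suc j) a = begin
        t * (h (suc (suc a)) * F (suc j)) + A (suc a) j
          ≈⟨ +-congˡ (A-sum j (suc a)) ⟩
        t * (h (suc (suc a)) * F (suc j)) + (hh (suc a) j + t * ∑< j (λ i → h (suc (suc (i ℕ.+ suc a))) * F (j ∸ i)))
          ≈⟨ collect-A t _ _ _ _ ⟩
        hh (suc a) j + t * (h (suc (suc a)) * F (suc j) + ∑< j (λ i → h (suc (suc (i ℕ.+ suc a))) * F (j ∸ i)))
          ≈⟨ +-congˡ (*-congˡ (+-congˡ (∑<-cong j λ i → reflexive (cong (λ z → h (suc (suc z)) * F (j ∸ i)) (ℕ.+-suc i a))))) ⟩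
        hh a (suc j) + t * ∑< (suc j) (λ i → h (suc (suc (i ℕ.+ a))) * F (suc j ∸ i)) ∎

      h₁ : h 1 ≈ F 1
      h₁ = ≈-sym (N-row 0)

      w⁺ w⁻ : ℕ → Carrier
      w⁺ m = h m * t ^ m
      w⁻ m = t * h m

      W⁺ a zero    = w⁺ (suc (suc a))
      W⁺ a (suc j) = F (suc j) * w⁺ (suc (suc a)) + W⁺ (suc a) j
      W⁻ a zero    = w⁻ (suc (suc a))
      W⁻ a (suc j) = F (suc j) * w⁻ (suc (suc a)) + W⁻ (suc a) j

      -- Each unfolding of `B` contributes a factor `t`, and so does each further degree in H(tz).
      W⁺-B : ∀ j a → W⁺ a j ≈ t ^ suc a * B a j
      W⁺-B zero    a = *-assemble (h (suc (suc a))) t (t ^ suc a)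
        where
        *-assemble : ∀ x t u → x * (t * u) ≈ u * (t * x)
        *-assemble x t u = ≈-trans (*-swapˡᵀ x t u) (≈-trans (*-congˡ (*-comm x u)) (*-swapˡᵀ t u x))
      W⁺-B (suc j) a = ≈-trans (+-congˡ (W⁺-B j (suc a)))
        (collect-plus (F (suc j)) (h (suc (suc a))) t (t ^ suc a) (B (suc a) j))

      W⁻-A : ∀ j a → W⁻ a j + hh a j ≈ A a j + t * hh a j
      W⁻-A zero    a = +-comm _ _
      W⁻-A (suc j) a = begin
        F (suc j) * (t * h (suc (suc a))) + W⁻ (suc a) j + hh (suc a) j
          ≈⟨ collect-minus (F (suc j)) (h (suc (suc a))) t (W⁻ (suc a) j) (hh (suc a) j) ⟩
        t * (h (suc (suc a)) * F (suc j)) + (W⁻ (suc a) j + hh (suc a) j)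
          ≈⟨ +-congˡ (W⁻-A j (suc a)) ⟩
        t * (h (suc (suc a)) * F (suc j)) + (A (suc a) j + t * hh (suc a) j)
          ≈⟨ collect-minus′ _ _ _ ⟩
        A a (suc j) + t * hh a (suc j) ∎

      W-sum : ∀ (w : ℕ → Carrier) (W : ℕ → ℕ → Carrier) → (∀ a → W a 0 ≡ w (suc (suc a))) →
        (∀ a j → W a (suc j) ≡ F (suc j) * w (suc (suc a)) + W (suc a) j) →
        ∀ j a → ∑< (suc j) (λ i → F (j ∸ i) * w (suc (suc (i ℕ.+ a)))) ≈ W a j
      W-sum w W base step zero    a = ≈-trans (+-identityʳ _) (≈-trans (*-identityˡ _) (reflexive (sym (base a))))
      W-sum w W base step (suc j) a = ≈-trans
        (+-congˡ (≈-trans (∑<-cong (suc j) λ i → reflexive (cong (λ z → F (j ∸ i) * w (suc (suc z))) (sym (ℕ.+-suc i a)))) (W-sum w W base step j (suc a))))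
        (reflexive (sym (step a j)))

    -- The defining equation of the Qₙ, with the subtracted terms moved to the
    -- other side so that it is an identity of semirings.
    Defining : (ℕ → Carrier) → Set ℓ
    Defining Q = ∀ n → ∑< (suc n) (λ i → Q i * w⁺ (n ∸ i)) + t * h n ≈ ∑< (suc n) (λ i → Q i * w⁻ (n ∸ i)) + h n

    private
      reversed : ∀ n (w : ℕ → Carrier) → ∑< (suc n) (λ i → F i * w (n ∸ i)) ≈ ∑< (suc n) (λ i → F (n ∸ i) * w i)
      reversed n w = ≈-trans (∑<-reverse n (λ i → F i * w (n ∸ i))) (∑<-congᵇ (suc n) λ i i≤n →
        reflexive (cong (λ z → F (n ∸ i) * w z) (ℕ.m∸[m∸n]≡n (ℕ.≤-pred i≤n))))

      w⁺-0 : w⁺ 0 ≈ 1#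
      w⁺-0 = ≈-trans (*-identityʳ _) h₀

      w⁻-0 : w⁻ 0 ≈ t
      w⁻-0 = ≈-trans (*-congˡ h₀) (*-identityʳ t)

      w-1 : w⁺ 1 ≈ w⁻ 1
      w-1 = ≈-trans (*-congˡ (*-identityʳ t)) (*-comm (h 1) t)

    -- From degree 2 on, the summands with h of degree 1 agree on both sides because t¹ = t. On the
    -- left `F n` is replaced by `t * p 1 j + A 0 j` and the tail by `t * B 0 j`; on the right `F n`
    -- becomes `p 1 j + B 0 j`, multiplied by `t`, and the tail together with h of degree n becomes
    -- `A 0 j + t * hh 0 j`. Then both sides have the same terms.
    F-defining : Defining F
    F-defining zero = begin
      (1# * w⁺ 0 + 0#) + t * h 0     ≈⟨ +-congʳ (≈-trans (+-identityʳ _) (≈-trans (*-identityˡ _) (≈-trans (*-identityʳ _) ≈-refl))) ⟩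
      h 0 + t * h 0                  ≈⟨ +-comm _ _ ⟩
      t * h 0 + h 0                  ≈⟨ +-congʳ (≈-sym (≈-trans (+-identityʳ _) (*-identityˡ _))) ⟩
      (1# * w⁻ 0 + 0#) + h 0         ∎
    F-defining (suc zero) = begin
      ∑< 2 (λ i → F i * w⁺ (1 ∸ i)) + t * h 1
        ≈⟨ +-cong (≈-trans (reversed 1 w⁺) (+-cong (≈-trans (*-congˡ w⁺-0) (*-identityʳ _)) (+-congʳ (*-congˡ w-1)))) (*-congˡ h₁) ⟩
      (F 1 + (1# * w⁻ 1 + 0#)) + t * F 1
        ≈⟨ ≈-trans (+-comm _ _) (≈-trans (+-cong (*-comm t (F 1)) (+-comm _ _)) (≈-sym (+-assoc _ _ _))) ⟩
      (F 1 * t + (1# * w⁻ 1 + 0#)) + F 1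
        ≈⟨ +-cong (≈-trans (+-congʳ (*-congˡ (≈-sym w⁻-0))) (≈-sym (reversed 1 w⁻))) (≈-sym h₁) ⟩
      ∑< 2 (λ i → F i * w⁻ (1 ∸ i)) + h 1 ∎
    F-defining (suc (suc j)) = begin
      ∑< (suc n) (λ i → F i * w⁺ (n ∸ i)) + t * h n
        ≈⟨ +-congʳ (reversed n w⁺) ⟩
      (F n * w⁺ 0 + (F (suc j) * w⁺ 1 + ∑< (suc j) (λ i → F (j ∸ i) * w⁺ (suc (suc i))))) + t * h n
        ≈⟨ +-cong (+-cong (≈-trans (*-congˡ w⁺-0) (≈-trans (*-identityʳ _) F-A))
             (+-cong (*-congˡ w-1) (≈-trans (unshift w⁺) (≈-trans (W-sum w⁺ W⁺ (λ _ → refl) (λ _ _ → refl) j 0)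
               (≈-trans (W⁺-B j 0) (*-congʳ (*-identityʳ t))))))) (*-congˡ (reflexive hn)) ⟩
      ((t * p 1 j + A 0 j) + (X + t * B 0 j)) + t * hh 0 j
        ≈⟨ top-coefficient t (p 1 j) (A 0 j) (B 0 j) X (hh 0 j) ⟩
      (t * (p 1 j + B 0 j) + X) + (A 0 j + t * hh 0 j)
        ≈⟨ +-cong (+-congʳ (≈-trans (*-congˡ (≈-sym F-B)) (≈-trans (*-comm t _) (*-congˡ (≈-sym w⁻-0))))) (≈-sym (W⁻-A j 0)) ⟩
      (F n * w⁻ 0 + X) + (W⁻ 0 j + hh 0 j)
        ≈⟨ ≈-sym (regroup-minus _ _ _ _) ⟩
      (F n * w⁻ 0 + (X + W⁻ 0 j)) + hh 0 j
        ≈⟨ +-cong (+-congˡ (+-congˡ (≈-sym (≈-trans (unshift w⁻) (W-sum w⁻ W⁻ (λ _ → refl) (λ _ _ → refl) j 0))))) (reflexive (sym hn)) ⟩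
      (F n * w⁻ 0 + (F (suc j) * w⁻ 1 + ∑< (suc j) (λ i → F (j ∸ i) * w⁻ (suc (suc i))))) + h n
        ≈⟨ +-congʳ (≈-sym (reversed n w⁻)) ⟩
      ∑< (suc n) (λ i → F i * w⁻ (n ∸ i)) + h n ∎
      where
      n : ℕ
      n = suc (suc j)
      X : Carrier
      X = F (suc j) * w⁻ 1
      hn : h n ≡ hh 0 j
      hn = sym (trans (hh-h 0 j) (cong (λ z → h (suc (suc z))) (ℕ.+-identityʳ j)))
      F-A : F n ≈ t * p 1 j + A 0 j
      F-A = ≈-trans (≈-sym (p-0-N (suc j))) (p-A j 0)
      F-B : F n ≈ p 1 j + B 0 j
      F-B = ≈-trans (≈-sym (p-0-N (suc j))) (p-B j 0)
      unshift : ∀ (w : ℕ → Carrier) → ∑< (suc j) (λ i → F (j ∸ i) * w (suc (suc i))) ≈ ∑< (suc j) (λ i → F (j ∸ i) * w (suc (suc (i ℕ.+ 0))))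
      unshift w = ∑<-cong (suc j) λ i → reflexive (cong (λ z → F (j ∸ i) * w (suc (suc z))) (sym (ℕ.+-identityʳ i)))

    module _ (cancel : ∀ x y → x + t * y ≈ y + t * x → x ≈ y) where

      -- Strong induction. Once the earlier terms agree, the equation in degree n contains the
      -- unknown as `Q n` on one side and as `t * Q n` on the other. Comparison with the equation
      -- for `F` gives the hypothesis of `cancel`, which expresses without subtraction that 1 - t is
      -- not a zero divisor.
      unique : ∀ Q → Defining Q → ∀ n → Q n ≈ F n
      unique Q def n = below (suc n) n ℕ.≤-refl
        where
        cancel-+ : ∀ x y z → x + z ≈ y + z → x ≈ y
        cancel-+ x y z e = RingProperties.+-cancelʳ ring′ z x y e
          where ring′ = CommutativeRing.ring T
        below : ∀ m n → n < m → Q n ≈ F n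
        below (suc m) n (s≤s n≤m) = cancel (Q n) (F n) (cancel-+ _ _ (Y⁺ + Y⁻) (begin
          (Q n + t * F n) + (Y⁺ + Y⁻)          ≈⟨ interchange _ _ _ _ ⟩
          (Q n + Y⁺) + (t * F n + Y⁻)          ≈⟨ mixed ⟩
          (F n + Y⁺) + (t * Q n + Y⁻)          ≈⟨ interchange _ _ _ _ ⟩
          (F n + t * Q n) + (Y⁺ + Y⁻)          ∎))
          where
          Y⁺ Y⁻ : Carrier
          Y⁺ = ∑< n (λ i → F i * w⁺ (n ∸ i))
          Y⁻ = ∑< n (λ i → F i * w⁻ (n ∸ i))
          last : ∀ (Q′ : ℕ → Carrier) w v → w 0 ≈ v → (∀ i → i < n → Q′ i ≈ F i) →
            ∑< (suc n) (λ i → Q′ i * w (n ∸ i)) ≈ v * Q′ n + ∑< n (λ i → F i * w (n ∸ i))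
          last Q′ w v w₀ e = ≈-trans (∑<-last n _) (≈-trans (+-comm _ _) (+-cong
            (≈-trans (*-congˡ (≈-trans (reflexive (cong w (ℕ.n∸n≡0 n))) w₀)) (*-comm _ v))
            (∑<-congᵇ n λ i i<n → *-congʳ (e i i<n))))
          equation : ∀ Q′ → Defining Q′ → (∀ i → i < n → Q′ i ≈ F i) → (Q′ n + Y⁺) + t * h n ≈ (t * Q′ n + Y⁻) + h n
          equation Q′ def′ e = ≈-trans (+-congʳ (≈-trans (+-congʳ (≈-sym (*-identityˡ _))) (≈-sym (last Q′ w⁺ 1# w⁺-0 e))))
            (≈-trans (def′ n) (+-congʳ (last Q′ w⁻ t w⁻-0 e)))
          mixed : (Q n + Y⁺) + (t * F n + Y⁻) ≈ (F n + Y⁺) + (t * Q n + Y⁻)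
          mixed = cancel-+ _ _ (t * h n + h n) (begin
            ((Q n + Y⁺) + (t * F n + Y⁻)) + (t * h n + h n)      ≈⟨ interchange _ _ _ _ ⟩
            ((Q n + Y⁺) + t * h n) + ((t * F n + Y⁻) + h n)
              ≈⟨ +-cong (equation Q def λ i i<n → below m i (ℕ.≤-trans i<n n≤m)) (≈-sym (equation F F-defining λ _ _ → ≈-refl)) ⟩
            ((t * Q n + Y⁻) + h n) + ((F n + Y⁺) + t * h n)      ≈⟨ +-comm _ _ ⟩
            ((F n + Y⁺) + t * h n) + ((t * Q n + Y⁻) + h n)      ≈⟨ interchange _ _ _ _ ⟩
            ((F n + Y⁺) + (t * Q n + Y⁻)) + (t * h n + h n)      ∎)

      -- Of `(1# + t) * F n`, the part `t * F n` is the summand with h of degree 0. The other part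
      -- is expanded by `p-A`; its `t * p 1 j` combines with the ribbons that have a single cell on
      -- top to the summand with h of degree 1, and `A 0 j` supplies all remaining ones.
      Q̃-G : ∀ Q → Defining Q → ∀ n → h (suc n) + t * ∑< (suc n) (λ i → h (n ∸ i) * Q (suc i)) ≈ G (suc n)
      Q̃-G Q def n = ≈-trans (+-congˡ (*-congˡ (∑<-cong (suc n) λ i → *-congˡ {h (n ∸ i)} (unique Q def (suc i))))) (F-G n)
        where
        F-G : ∀ n → h (suc n) + t * ∑< (suc n) (λ i → h (n ∸ i) * F (suc i)) ≈ G (suc n)
        F-G zero    = begin
          h 1 + t * (h 0 * F 1 + 0#)     ≈⟨ +-cong h₁ (*-congˡ (≈-trans (+-identityʳ _) (≈-trans (*-congʳ h₀) (*-identityˡ _)))) ⟩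
          F 1 + t * F 1                  ≈⟨ +-comm _ _ ⟩
          t * F 1 + F 1                  ≈⟨ ≈-sym (1+t (F 1)) ⟩
          (1# + t) * F 1                 ∎
        F-G (suc j) = ≈-sym (begin
          (1# + t) * P (suc j) N + t * d 0 j
            ≈⟨ +-congʳ (≈-trans (1+t _) (≈-trans (+-comm _ _) (+-congʳ (≈-trans (≈-sym (p-0-N (suc j))) (p-A j 0))))) ⟩
          ((t * p 1 j + A 0 j) + t * F (suc (suc j))) + t * d 0 j
            ≈⟨ Q̃-collect t (F (suc (suc j))) (p 1 j) (A 0 j) (d 0 j) ⟩
          t * F (suc (suc j)) + (A 0 j + t * (d 0 j + p 1 j))
            ≈⟨ +-congˡ (+-cong (A-sum j 0) (*-congˡ (split 0 j))) ⟩
          t * F (suc (suc j)) + ((hh 0 j + t * ∑< j (λ i → h (suc (suc (i ℕ.+ 0))) * F (j ∸ i))) + t * (h 1 * F (suc j)))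
            ≈⟨ Q̃-assemble t _ _ _ _ _ ⟩
          hh 0 j + t * (F (suc (suc j)) + (h 1 * F (suc j) + ∑< j (λ i → h (suc (suc (i ℕ.+ 0))) * F (j ∸ i))))
            ≈⟨ +-cong (reflexive (trans (hh-h 0 j) (cong (λ z → h (suc (suc z))) (ℕ.+-identityʳ j))))
                 (*-congˡ (+-cong (≈-sym (≈-trans (*-congʳ h₀) (*-identityˡ _)))
                   (+-congˡ (∑<-congᵇ j λ i i<j → reflexive (cong₂ (λ x y → h (suc (suc x)) * F y) (ℕ.+-identityʳ i) (ℕ.+-∸-assoc 1 i<j)))))) ⟩
          h (suc (suc j)) + t * ∑< (suc (suc j)) (λ i → h i * F (suc (suc j ∸ i)))
            ≈⟨ +-congˡ (*-congˡ (≈-trans (∑<-congᵇ (suc (suc j)) λ i i≤ → reflexive (cong (λ z → h z * F (suc (suc j ∸ i))) (sym (ℕ.m∸[m∸n]≡n (ℕ.≤-pred i≤)))))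
                 (≈-sym (∑<-reverse (suc j) (λ i → h (suc j ∸ i) * F (suc i)))))) ⟩
          h (suc (suc j)) + t * ∑< (suc (suc j)) (λ i → h (suc j ∸ i) * F (suc i)) ∎)

open import Data.Nat.Base hiding (_^_; _!; less)
open import Data.Nat.Properties

-- Finite sums of natural numbers

private
  variable
    𝒜 ℬ : Set
    𝒫 𝒬 : Set

𝟙 : Dec 𝒫 → ℕ
𝟙 p = if does p then 1 else 0

𝟙-cong : (p : Dec 𝒫) (q : Dec 𝒬) → (𝒫 → 𝒬) → (𝒬 → 𝒫) → 𝟙 p ≡ 𝟙 q
𝟙-cong (yes _) (yes _) _ _ = refl
𝟙-cong (no _)  (no _)  _ _ = refl
𝟙-cong (yes p) (no ¬q) f _ = contradiction (f p) ¬q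
𝟙-cong (no ¬p) (yes q) _ g = contradiction (g q) ¬p

𝟙-× : (p : Dec 𝒫) (q : Dec 𝒬) → 𝟙 (p ×-dec q) ≡ 𝟙 p * 𝟙 q
𝟙-× (yes _) (yes _) = refl
𝟙-× (yes _) (no _)  = refl
𝟙-× (no _)  _       = refl

𝟙-yes : (p : Dec 𝒫) → 𝒫 → 𝟙 p ≡ 1
𝟙-yes (yes _) _ = refl
𝟙-yes (no ¬p) p = contradiction p ¬p

𝟙-no : (p : Dec 𝒫) → ¬ 𝒫 → 𝟙 p ≡ 0
𝟙-no (yes p) ¬p = contradiction p ¬p
𝟙-no (no _)  _  = refl

𝟙*-cong : ∀ {m n} (p : Dec 𝒫) (q : Dec 𝒬) → (𝒫 → 𝒬) → (𝒬 → 𝒫) → (𝒫 → m ≡ n) → 𝟙 p * m ≡ 𝟙 q * n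
𝟙*-cong (yes p) q f g e = cong₂ _*_ (𝟙-cong (yes p) q f g) (e p)
𝟙*-cong (no ¬p) q f g e rewrite 𝟙-no q (¬p ∘ g) = refl

𝟙-yes* : ∀ {n} (p : Dec 𝒫) → 𝒫 → 𝟙 p * n ≡ n
𝟙-yes* {n = n} p x = trans (cong (_* n) (𝟙-yes p x)) (*-identityˡ n)

𝟙-no* : ∀ {n} (p : Dec 𝒫) → ¬ 𝒫 → 𝟙 p * n ≡ 0
𝟙-no* {n = n} p x = cong (_* n) (𝟙-no p x)

*-swapˡ : ∀ a b c → a * (b * c) ≡ b * (a * c)
*-swapˡ = solve-∀

+-interchange : ∀ a b c d → (a + b) + (c + d) ≡ (a + c) + (b + d)
+-interchange = solve-∀

sumOver : List 𝒜 → (𝒜 → ℕ) → ℕ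
sumOver []       f = 0
sumOver (x ∷ xs) f = f x + sumOver xs f

sumOver-cong : ∀ (xs : List 𝒜) {f g} → (∀ x → f x ≡ g x) → sumOver xs f ≡ sumOver xs g
sumOver-cong []       e = refl
sumOver-cong (x ∷ xs) e = cong₂ _+_ (e x) (sumOver-cong xs e)

sumOver-congAll : ∀ {xs : List 𝒜} {f g} → All (λ x → f x ≡ g x) xs → sumOver xs f ≡ sumOver xs g
sumOver-congAll []       = refl
sumOver-congAll (e ∷ es) = cong₂ _+_ e (sumOver-congAll es)

sumOver-++ : ∀ (xs : List 𝒜) {ys} f → sumOver (xs ++ ys) f ≡ sumOver xs f + sumOver ys f
sumOver-++ []       f = refl
sumOver-++ (x ∷ xs) f = trans (cong (f x +_) (sumOver-++ xs f)) (sym (+-assoc (f x) _ _))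

sumOver-map : ∀ (g : 𝒜 → ℬ) xs f → sumOver (map g xs) f ≡ sumOver xs (f ∘ g)
sumOver-map g []       f = refl
sumOver-map g (x ∷ xs) f = cong (f (g x) +_) (sumOver-map g xs f)

sumOver-filter : ∀ {𝒫 : Pred 𝒜 _} (𝒫? : Decidable₁ 𝒫) xs f →
                 sumOver (filter 𝒫? xs) f ≡ sumOver xs λ x → 𝟙 (𝒫? x) * f x
sumOver-filter 𝒫? []       f = refl
sumOver-filter 𝒫? (x ∷ xs) f with does (𝒫? x)
... | true  = cong₂ _+_ (sym (*-identityˡ (f x))) (sumOver-filter 𝒫? xs f)
... | false = sumOver-filter 𝒫? xs f

length-sumOver : ∀ (xs : List 𝒜) → length xs ≡ sumOver xs λ _ → 1
length-sumOver []       = refl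
length-sumOver (x ∷ xs) = cong suc (length-sumOver xs)

count-sumOver : ∀ {𝒫 : Pred 𝒜 _} (𝒫? : Decidable₁ 𝒫) xs → count 𝒫? xs ≡ sumOver xs (𝟙 ∘ 𝒫?)
count-sumOver 𝒫? xs = begin
  count 𝒫? xs                       ≡⟨ length-sumOver (filter 𝒫? xs) ⟩
  sumOver (filter 𝒫? xs) (λ _ → 1)  ≡⟨ sumOver-filter 𝒫? xs _ ⟩
  sumOver xs (λ x → 𝟙 (𝒫? x) * 1)   ≡⟨ sumOver-cong xs (λ x → *-identityʳ _) ⟩
  sumOver xs (𝟙 ∘ 𝒫?)               ∎
  where open ≡-Reasoning

sumOver-+ : ∀ (xs : List 𝒜) f g → sumOver xs (λ x → f x + g x) ≡ sumOver xs f + sumOver xs g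
sumOver-+ []       f g = refl
sumOver-+ (x ∷ xs) f g =
  trans (cong (f x + g x +_) (sumOver-+ xs f g)) (+-interchange (f x) (g x) _ _)

sumOver-cartesianProductWith : ∀ {C : Set} (g : 𝒜 → ℬ → C) xs ys f →
  sumOver (cartesianProductWith g xs ys) f ≡ sumOver xs λ x → sumOver ys λ y → f (g x y)
sumOver-cartesianProductWith g []       ys f = refl
sumOver-cartesianProductWith g (x ∷ xs) ys f =
  trans (sumOver-++ (map (g x) ys) f)
        (cong₂ _+_ (sumOver-map (g x) ys f) (sumOver-cartesianProductWith g xs ys f))

IsWord : ℕ → ℕ → List ℕ → Set
IsWord m n w = length w ≡ m × All (_< n) w

opaque
  sumTo : ℕ → (ℕ → ℕ) → ℕ
  sumTo zero    f = 0
  sumTo (suc n) f = f 0 + sumTo n (f ∘ suc)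

  sumW : ℕ → ℕ → (List ℕ → ℕ) → ℕ
  sumW zero    n f = f []
  sumW (suc m) n f = sumTo n λ x → sumW m n λ w → f (x ∷ w)

  sumTo-zero : ∀ f → sumTo 0 f ≡ 0
  sumTo-zero f = refl

  sumTo-suc : ∀ n f → sumTo (suc n) f ≡ f 0 + sumTo n (f ∘ suc)
  sumTo-suc n f = refl

  sumW-zero : ∀ n f → sumW 0 n f ≡ f []
  sumW-zero n f = refl

  sumW-suc : ∀ m n f → sumW (suc m) n f ≡ sumTo n λ x → sumW m n λ w → f (x ∷ w)
  sumW-suc m n f = refl

  sumTo-congᵇ : ∀ n {f g} → (∀ i → i < n → f i ≡ g i) → sumTo n f ≡ sumTo n g
  sumTo-congᵇ zero    e = refl
  sumTo-congᵇ (suc n) e = cong₂ _+_ (e 0 z<s) (sumTo-congᵇ n λ i i<n → e (suc i) (s<s i<n))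

  sumTo-cong : ∀ n {f g} → (∀ i → f i ≡ g i) → sumTo n f ≡ sumTo n g
  sumTo-cong n e = sumTo-congᵇ n λ i _ → e i

  sumTo-0 : ∀ n → sumTo n (λ _ → 0) ≡ 0
  sumTo-0 zero    = refl
  sumTo-0 (suc n) = sumTo-0 n

  sumTo-zeroᵇ : ∀ n {f} → (∀ i → i < n → f i ≡ 0) → sumTo n f ≡ 0
  sumTo-zeroᵇ n e = trans (sumTo-congᵇ n e) (sumTo-0 n)

  sumTo-+ : ∀ n f g → sumTo n (λ i → f i + g i) ≡ sumTo n f + sumTo n g
  sumTo-+ zero    f g = refl
  sumTo-+ (suc n) f g =
    trans (cong (f 0 + g 0 +_) (sumTo-+ n (f ∘ suc) (g ∘ suc))) (+-interchange (f 0) (g 0) _ _)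

  sumTo-*ˡ : ∀ n c f → sumTo n (λ i → c * f i) ≡ c * sumTo n f
  sumTo-*ˡ zero    c f = sym (*-zeroʳ c)
  sumTo-*ˡ (suc n) c f =
    trans (cong (c * f 0 +_) (sumTo-*ˡ n c (f ∘ suc))) (sym (*-distribˡ-+ c (f 0) _))

  sumTo-*ʳ : ∀ n c f → sumTo n (λ i → f i * c) ≡ sumTo n f * c
  sumTo-*ʳ n c f =
    trans (sumTo-cong n (λ i → *-comm (f i) c)) (trans (sumTo-*ˡ n c f) (*-comm c _))

  sumTo-swap : ∀ m n (f : ℕ → ℕ → ℕ) →
               sumTo m (λ i → sumTo n (f i)) ≡ sumTo n (λ j → sumTo m (λ i → f i j))
  sumTo-swap zero    n f = sym (sumTo-0 n)
  sumTo-swap (suc m) n f =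
    trans (cong (sumTo n (f 0) +_) (sumTo-swap m n (f ∘ suc))) (sym (sumTo-+ n (f 0) _))

  sumTo-last : ∀ n f → sumTo (suc n) f ≡ sumTo n f + f n
  sumTo-last zero    f = +-identityʳ (f 0)
  sumTo-last (suc n) f = trans (cong (f 0 +_) (sumTo-last n (f ∘ suc))) (sym (+-assoc (f 0) _ _))

  sumTo-reverse : ∀ n f → sumTo (suc n) f ≡ sumTo (suc n) (λ i → f (n ∸ i))
  sumTo-reverse zero    f = refl
  sumTo-reverse (suc n) f = begin
    sumTo (suc (suc n)) f                              ≡⟨ sumTo-last (suc n) f ⟩
    sumTo (suc n) f + f (suc n)                        ≡⟨ +-comm _ (f (suc n)) ⟩
    f (suc n) + sumTo (suc n) f                        ≡⟨ cong (f (suc n) +_) (sumTo-reverse n f) ⟩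
    f (suc n) + sumTo (suc n) (λ i → f (n ∸ i))        ∎
    where open ≡-Reasoning

  sumTo-single : ∀ n (f : ℕ → ℕ) k → k < n → (∀ i → i < n → i ≢ k → f i ≡ 0) → sumTo n f ≡ f k
  sumTo-single (suc n) f zero    _         z =
    trans (cong (f 0 +_) (sumTo-zeroᵇ n λ i i<n → z (suc i) (s<s i<n) λ ())) (+-identityʳ (f 0))
  sumTo-single (suc n) f (suc k) (s<s k<n) z =
    trans (cong (_+ sumTo n (f ∘ suc)) (z 0 z<s λ ()))
          (sumTo-single n (f ∘ suc) k k<n λ i i<n i≢k → z (suc i) (s<s i<n) (i≢k ∘ suc-injective))

  sumTo-truncate : ∀ m k (f : ℕ → ℕ) → sumTo (m + k) (λ i → 𝟙 (i <? m) * f i) ≡ sumTo m f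
  sumTo-truncate zero    k f = sumTo-zeroᵇ k λ _ _ → refl
  sumTo-truncate (suc m) k f = cong₂ _+_ (*-identityˡ (f 0))
    (trans (sumTo-cong (m + k) λ i → cong (_* f (suc i)) (𝟙-cong (suc i <? suc m) (i <? m) s<s⁻¹ s<s))
           (sumTo-truncate m k (f ∘ suc)))

  sumOver-applyUpTo : ∀ n (g : ℕ → 𝒜) f → sumOver (applyUpTo g n) f ≡ sumTo n (f ∘ g)
  sumOver-applyUpTo zero    g f = refl
  sumOver-applyUpTo (suc n) g f = cong (f (g 0) +_) (sumOver-applyUpTo n (g ∘ suc) f)

  sumOver-upTo : ∀ n f → sumOver (upTo n) f ≡ sumTo n f
  sumOver-upTo n f = sumOver-applyUpTo n id f

  sumOver-words : ∀ m n f → sumOver (words m (upTo n)) f ≡ sumW m n f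
  sumOver-words zero    n f = +-identityʳ (f [])
  sumOver-words (suc m) n f =
    trans (sumOver-cartesianProductWith _∷_ (upTo n) (words m (upTo n)) f)
    (trans (sumOver-upTo n _) (sumTo-cong n λ x → sumOver-words m n (f ∘ (x ∷_))))

  sumW-congᵇ : ∀ m n {f g} → (∀ w → IsWord m n w → f w ≡ g w) → sumW m n f ≡ sumW m n g
  sumW-congᵇ zero    n e = e [] (refl , [])
  sumW-congᵇ (suc m) n e =
    sumTo-congᵇ n λ x x<n → sumW-congᵇ m n λ w (l , b) → e (x ∷ w) (cong suc l , x<n ∷ b)

  sumW-cong : ∀ m n {f g} → (∀ w → f w ≡ g w) → sumW m n f ≡ sumW m n g
  sumW-cong m n e = sumW-congᵇ m n λ w _ → e w

  sumW-0 : ∀ m n → sumW m n (λ _ → 0) ≡ 0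
  sumW-0 zero    n = refl
  sumW-0 (suc m) n = trans (sumTo-cong n λ _ → sumW-0 m n) (sumTo-0 n)

  sumW-zeroᵇ : ∀ m n {f} → (∀ w → IsWord m n w → f w ≡ 0) → sumW m n f ≡ 0
  sumW-zeroᵇ m n e = trans (sumW-congᵇ m n e) (sumW-0 m n)

  sumW-+ : ∀ m n f g → sumW m n (λ w → f w + g w) ≡ sumW m n f + sumW m n g
  sumW-+ zero    n f g = refl
  sumW-+ (suc m) n f g =
    trans (sumTo-cong n λ x → sumW-+ m n (f ∘ (x ∷_)) (g ∘ (x ∷_))) (sumTo-+ n _ _)

  sumW-*ˡ : ∀ m n c f → sumW m n (λ w → c * f w) ≡ c * sumW m n f
  sumW-*ˡ zero    n c f = refl
  sumW-*ˡ (suc m) n c f =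
    trans (sumTo-cong n λ x → sumW-*ˡ m n c (f ∘ (x ∷_))) (sumTo-*ˡ n c _)

  sumW-sumTo : ∀ m n k (f : List ℕ → ℕ → ℕ) →
               sumW m n (λ w → sumTo k (f w)) ≡ sumTo k (λ i → sumW m n (λ w → f w i))
  sumW-sumTo zero    n k f = refl
  sumW-sumTo (suc m) n k f =
    trans (sumTo-cong n λ x → sumW-sumTo m n k (f ∘ (x ∷_))) (sumTo-swap n k _)

  sumW-swap : ∀ m n m′ n′ (f : List ℕ → List ℕ → ℕ) →
              sumW m n (λ v → sumW m′ n′ (f v)) ≡ sumW m′ n′ (λ w → sumW m n (λ v → f v w))
  sumW-swap zero    n m′ n′ f = refl
  sumW-swap (suc m) n m′ n′ f =
    trans (sumTo-cong n λ x → sumW-swap m n m′ n′ (f ∘ (x ∷_))) (sym (sumW-sumTo m′ n′ n _))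

  sumW-++ : ∀ k m n f → sumW (k + m) n f ≡ sumW k n λ u → sumW m n λ v → f (u ++ v)
  sumW-++ zero    m n f = refl
  sumW-++ (suc k) m n f = sumTo-cong n λ x → sumW-++ k m n (f ∘ (x ∷_))

-- Words and their descents

Inc : List ℕ → Set
Inc = AllPairs _≤_

inc? : Decidable₁ Inc
inc? = allPairs? _≤?_

𝟙-inc-∷ : ∀ x w → 𝟙 (inc? (x ∷ w)) ≡ 𝟙 (all? (x ≤?_) w) * 𝟙 (inc? w)
𝟙-inc-∷ x w = trans
  (𝟙-cong (inc? (x ∷ w)) (all? (x ≤?_) w ×-dec inc? w) (λ { (a ∷ i) → a , i }) (λ (a , i) → a ∷ i))
  (𝟙-× (all? (x ≤?_) w) (inc? w))

opaque
  sumInc : ℕ → ℕ → (List ℕ → ℕ) → ℕ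
  sumInc m n f = sumW m n λ w → 𝟙 (inc? w) * f w

  sumInc-def : ∀ m n f → sumInc m n f ≡ sumW m n λ w → 𝟙 (inc? w) * f w
  sumInc-def m n f = refl

sumInc-zero : ∀ n f → sumInc 0 n f ≡ f []
sumInc-zero n f = trans (sumInc-def 0 n f) (trans (sumW-zero n _) (*-identityˡ (f [])))

sumInc-suc : ∀ m n f →
  sumInc (suc m) n f ≡ sumTo n λ x → sumInc m n λ w → 𝟙 (all? (x ≤?_) w) * f (x ∷ w)
sumInc-suc m n f = trans (sumInc-def (suc m) n f) (trans (sumW-suc m n _)
  (sumTo-cong n λ x → trans (sumW-cong m n λ w → begin
    𝟙 (inc? (x ∷ w)) * f (x ∷ w)                     ≡⟨ cong (_* f (x ∷ w)) (𝟙-inc-∷ x w) ⟩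
    𝟙 (all? (x ≤?_) w) * 𝟙 (inc? w) * f (x ∷ w)      ≡⟨ rearrange (𝟙 (all? (x ≤?_) w)) _ _ ⟩
    𝟙 (inc? w) * (𝟙 (all? (x ≤?_) w) * f (x ∷ w))    ∎)
  (sym (sumInc-def m n _))))
  where
  open ≡-Reasoning
  rearrange : ∀ a b c → a * b * c ≡ b * (a * c)
  rearrange = solve-∀

opaque
  unfolding sumInc

  sumInc-congᵇ : ∀ m n {f g} → (∀ w → IsWord m n w → f w ≡ g w) → sumInc m n f ≡ sumInc m n g
  sumInc-congᵇ m n e = sumW-congᵇ m n λ w b → cong (𝟙 (inc? w) *_) (e w b)

  sumInc-cong : ∀ m n {f g} → (∀ w → f w ≡ g w) → sumInc m n f ≡ sumInc m n g
  sumInc-cong m n e = sumInc-congᵇ m n λ w _ → e w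

  sumInc-0 : ∀ m n → sumInc m n (λ _ → 0) ≡ 0
  sumInc-0 m n = trans (sumW-cong m n λ w → *-zeroʳ (𝟙 (inc? w))) (sumW-0 m n)

  sumInc-zeroᵇ : ∀ m n {f} → (∀ w → IsWord m n w → f w ≡ 0) → sumInc m n f ≡ 0
  sumInc-zeroᵇ m n e = trans (sumInc-congᵇ m n e) (sumInc-0 m n)

  sumInc-*ˡ : ∀ m n c f → sumInc m n (λ w → c * f w) ≡ c * sumInc m n f
  sumInc-*ˡ m n c f = trans (sumW-cong m n λ w → *-swapˡ (𝟙 (inc? w)) c (f w)) (sumW-*ˡ m n c _)

  sumInc-+ : ∀ m n f g → sumInc m n (λ w → f w + g w) ≡ sumInc m n f + sumInc m n g
  sumInc-+ m n f g = trans (sumW-cong m n λ w → *-distribˡ-+ (𝟙 (inc? w)) (f w) (g w)) (sumW-+ m n _ _)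

  sumInc-sumW : ∀ m n k r (f : List ℕ → List ℕ → ℕ) →
    sumInc m n (λ u → sumW k r (f u)) ≡ sumW k r (λ v → sumInc m n (λ u → f u v))
  sumInc-sumW m n k r f = trans (sumW-cong m n λ u → sym (sumW-*ˡ k r (𝟙 (inc? u)) (f u)))
    (sumW-swap m n k r λ u v → 𝟙 (inc? u) * f u v)

private
  base : ∀ n f (g : ℕ → List ℕ → ℕ) → g 0 [] ≡ f [] → sumInc 0 (suc n) f ≡ sumTo 1 λ i → sumInc i n (g i)
  base n f g e = begin
    sumInc 0 (suc n) f                       ≡⟨ sumInc-zero (suc n) f ⟩
    f []                                     ≡⟨ sym e ⟩
    g 0 []                                   ≡⟨ sym (sumInc-zero n (g 0)) ⟩
    sumInc 0 n (g 0)                         ≡⟨ sym (sumTo-single 1 (λ i → sumInc i n (g i)) 0 z<s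
                                                  λ { zero _ c → contradiction refl c ; (suc _) (s≤s ()) _ }) ⟩
    sumTo 1 (λ i → sumInc i n (g i))         ∎
    where open ≡-Reasoning

-- The occurrences of the largest letter `n` form a block at the end of an increasing word; `i` is
-- the length of what precedes the block.
sumInc-snoc : ∀ m n f →
  sumInc m (suc n) f ≡ sumTo (suc m) λ i → sumInc i n λ v → f (v ++ replicate (m ∸ i) n)
sumInc-snoc zero    n f = base n f _ refl
sumInc-snoc (suc m) n f = begin
  sumInc (suc m) (suc n) f
    ≡⟨ sumInc-suc m (suc n) f ⟩
  sumTo (suc n) (λ x → sumInc m (suc n) (g x))
    ≡⟨ sumTo-cong (suc n) (λ x → sumInc-snoc m n (g x)) ⟩
  sumTo (suc n) (λ x → sumTo (suc m) (G x))
    ≡⟨ sumTo-last n (λ x → sumTo (suc m) (G x)) ⟩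
  sumTo n (λ x → sumTo (suc m) (G x)) + sumTo (suc m) (G n)
    ≡⟨ cong₂ _+_ small large ⟩
  sumTo (suc m) (λ i → F (suc i)) + F 0
    ≡⟨ +-comm _ (F 0) ⟩
  F 0 + sumTo (suc m) (λ i → F (suc i))
    ≡⟨ sym (sumTo-suc (suc m) F) ⟩
  sumTo (suc (suc m)) F ∎
  where
  open ≡-Reasoning
  g : ℕ → List ℕ → ℕ
  g x w = 𝟙 (all? (x ≤?_) w) * f (x ∷ w)
  G : ℕ → ℕ → ℕ
  G x i = sumInc i n λ v → g x (v ++ replicate (m ∸ i) n)
  F : ℕ → ℕ
  F i = sumInc i n λ v → f (v ++ replicate (suc m ∸ i) n)
  small : sumTo n (λ x → sumTo (suc m) (G x)) ≡ sumTo (suc m) (λ i → F (suc i))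
  small = trans (sumTo-swap n (suc m) G) (sumTo-cong (suc m) λ i → sym (trans
    (sumInc-suc i n _)
    (sumTo-congᵇ n λ x x<n → sumInc-congᵇ i n λ v _ →
      cong (_* f (x ∷ v ++ replicate (m ∸ i) n))
        (𝟙-cong (all? (x ≤?_) v) (all? (x ≤?_) (v ++ replicate (m ∸ i) n))
          (λ a → AllP.++⁺ a (AllP.replicate⁺ (m ∸ i) (<⇒≤ x<n))) (AllP.++⁻ˡ v)))))
  large : sumTo (suc m) (G n) ≡ F 0
  large = trans
    (sumTo-single (suc m) (G n) 0 z<s λ where
      zero    _ 0≢0 → contradiction refl 0≢0
      (suc i) _ _   → sumInc-zeroᵇ (suc i) n λ where
        (y ∷ v) (_ , y<n ∷ _) → 𝟙-no* (all? (n ≤?_) (y ∷ v ++ replicate (m ∸ suc i) n))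
          λ a → <⇒≱ y<n (All.head a))
    (sumInc-congᵇ 0 n λ where
      [] _ → 𝟙-yes* (all? (n ≤?_) (replicate m n)) (AllP.replicate⁺ m ≤-refl))

-- The mirror image of `sumInc-snoc`: the zeros form a block at the beginning. It is used where
-- letters are rows of a shape and 0 is the first row.
sumInc-cons : ∀ m n f →
  sumInc m (suc n) f ≡ sumTo (suc m) λ i → sumInc i n λ v → f (replicate (m ∸ i) 0 ++ map suc v)
sumInc-cons zero    n f = base n f _ refl
sumInc-cons (suc m) n f = begin
  sumInc (suc m) (suc n) f
    ≡⟨ trans (sumInc-suc m (suc n) f) (sumTo-suc n _) ⟩
  sumInc m (suc n) (g 0) + sumTo n (λ y → sumInc m (suc n) (g (suc y)))
    ≡⟨ cong₂ _+_ (sumInc-cons m n (g 0)) (sumTo-cong n λ y → sumInc-cons m n (g (suc y))) ⟩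
  sumTo (suc m) (G 0) + sumTo n (λ y → sumTo (suc m) (G (suc y)))
    ≡⟨ cong₂ _+_ zeros positive ⟩
  sumTo (suc m) F + F (suc m)
    ≡⟨ sym (sumTo-last (suc m) F) ⟩
  sumTo (suc (suc m)) F ∎
  where
  open ≡-Reasoning
  g : ℕ → List ℕ → ℕ
  g x w = 𝟙 (all? (x ≤?_) w) * f (x ∷ w)
  G : ℕ → ℕ → ℕ
  G x i = sumInc i n λ v → g x (replicate (m ∸ i) 0 ++ map suc v)
  F : ℕ → ℕ
  F i = sumInc i n λ v → f (replicate (suc m ∸ i) 0 ++ map suc v)
  zeros : sumTo (suc m) (G 0) ≡ sumTo (suc m) F
  zeros = sumTo-congᵇ (suc m) λ i i≤m → sumInc-congᵇ i n λ v _ → trans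
    (𝟙-yes* (all? (0 ≤?_) (replicate (m ∸ i) 0 ++ map suc v)) (All.universal (λ _ → z≤n) _))
    (cong (λ k → f (replicate k 0 ++ map suc v)) (sym (+-∸-assoc 1 (s≤s⁻¹ i≤m))))
  positive : sumTo n (λ y → sumTo (suc m) (G (suc y))) ≡ F (suc m)
  positive = sym (trans (sumInc-suc m n _) (sumTo-cong n λ y → sym (trans
    (sumTo-single (suc m) (G (suc y)) m (n<1+n m) λ i i≤m i≢m → sumInc-zeroᵇ i n λ v _ →
      𝟙-no* (all? (suc y ≤?_) (replicate (m ∸ i) 0 ++ map suc v))
        (not-all (m<n⇒0<n∸m (≤∧≢⇒< (s≤s⁻¹ i≤m) i≢m))))
    (sumInc-congᵇ m n λ v _ → last-term y v))))
    where
    not-all : ∀ {k y v} → 0 < k → ¬ All (suc y ≤_) (replicate k 0 ++ v)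
    not-all {suc k} _ (() ∷ _)
    last-term : ∀ y v → g (suc y) (replicate (m ∸ m) 0 ++ map suc v) ≡
      𝟙 (all? (y ≤?_) v) * f (replicate (m ∸ m) 0 ++ suc y ∷ map suc v)
    last-term y v rewrite n∸n≡0 m = cong (_* f (suc y ∷ map suc v))
      (𝟙-cong (all? (suc y ≤?_) (map suc v)) (all? (y ≤?_) v)
        (All.map s≤s⁻¹ ∘ AllP.map⁻) (AllP.map⁺ ∘ All.map s≤s))

related : Bool → ℕ → ℕ → ℕ
related true  x y = 𝟙 (y <? x)
related false x y = 𝟙 (x ≤? y)

-- The indicator of the words whose descents x > y are exactly at the positions
-- of true in the pattern.
matches : List Bool → List ℕ → ℕ
matches []      (x ∷ [])    = 1
matches (b ∷ p) (x ∷ y ∷ w) = related b x y * matches p (y ∷ w)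
matches _       _           = 0

sumMatch : List Bool → ℕ → (List ℕ → ℕ) → ℕ
sumMatch p n f = sumW (suc (length p)) n λ w → matches p w * f w

related-total : ∀ x y → related true x y + related false x y ≡ 1
related-total x y = split (y <? x)
  where
  split : Dec (y < x) → related true x y + related false x y ≡ 1
  split (yes y<x) = cong₂ _+_ (𝟙-yes (y <? x) y<x) (𝟙-no (x ≤? y) (<⇒≱ y<x))
  split (no y≮x)  = cong₂ _+_ (𝟙-no (y <? x) y≮x) (𝟙-yes (x ≤? y) (≮⇒≥ y≮x))

𝟙-inc-∷∷ : ∀ x y w → 𝟙 (inc? (x ∷ y ∷ w)) ≡ related false x y * 𝟙 (inc? (y ∷ w))
𝟙-inc-∷∷ x y w = trans
  (𝟙-cong (inc? (x ∷ y ∷ w)) ((x ≤? y) ×-dec inc? (y ∷ w))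
    (λ { ((x≤y ∷ _) ∷ i) → x≤y , i })
    (λ { (x≤y , (y≤w ∷ i)) → (x≤y ∷ All.map (≤-trans x≤y) y≤w) ∷ (y≤w ∷ i) }))
  (𝟙-× (x ≤? y) (inc? (y ∷ w)))

matches-inc : ∀ a w → length w ≡ suc a → matches (replicate a false) w ≡ 𝟙 (inc? w)
matches-inc zero    (x ∷ [])    _  = refl
matches-inc (suc a) (x ∷ y ∷ w) l =
  trans (cong (related false x y *_) (matches-inc a (y ∷ w) (suc-injective l))) (sym (𝟙-inc-∷∷ x y w))

sumMatch-inc : ∀ a n f → sumMatch (replicate a false) n f ≡ sumInc (suc a) n f
sumMatch-inc a n f rewrite length-replicate a {false} =
  trans (sumW-congᵇ (suc a) n λ w (l , _) → cong (_* f w) (matches-inc a w l)) (sym (sumInc-def (suc a) n f))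

-- Between the last letter of `u` and the first of `v` there is either a descent or none, and the
-- two patterns differ only there.
matches-split : ∀ a p u v → length u ≡ suc a → length v ≡ suc (length p) →
  𝟙 (inc? u) * matches p v ≡
  matches (replicate a false ++ true ∷ p) (u ++ v) + matches (replicate a false ++ false ∷ p) (u ++ v)
matches-split zero p (x ∷ []) (y ∷ v) _ _ = begin
  1 * matches p (y ∷ v)                                         ≡⟨ cong (_* matches p (y ∷ v)) (sym (related-total x y)) ⟩
  (related true x y + related false x y) * matches p (y ∷ v)    ≡⟨ *-distribʳ-+ (matches p (y ∷ v)) (related true x y) _ ⟩
  related true x y * matches p (y ∷ v) + related false x y * matches p (y ∷ v) ∎
  where open ≡-Reasoning
matches-split (suc a) p (x ∷ y ∷ u) v lu lv = begin
  𝟙 (inc? (x ∷ y ∷ u)) * matches p v                      ≡⟨ cong (_* matches p v) (𝟙-inc-∷∷ x y u) ⟩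
  related false x y * 𝟙 (inc? (y ∷ u)) * matches p v      ≡⟨ *-assoc (related false x y) _ _ ⟩
  related false x y * (𝟙 (inc? (y ∷ u)) * matches p v)    ≡⟨ cong (related false x y *_) (matches-split a p (y ∷ u) v (suc-injective lu) lv) ⟩
  related false x y * _                                   ≡⟨ *-distribˡ-+ (related false x y) _ _ ⟩
  _ ∎
  where open ≡-Reasoning

sumMatch-++ : ∀ a b p n f → sumMatch (replicate a false ++ b ∷ p) n f ≡
  sumW (suc a) n λ u → sumW (suc (length p)) n λ v →
    matches (replicate a false ++ b ∷ p) (u ++ v) * f (u ++ v)
sumMatch-++ a b p n f
  rewrite length-++ (replicate a false) {b ∷ p} | length-replicate a {false}
  = sumW-++ (suc a) (suc (length p)) n _

-- The summand `f` is arbitrary so that the same splitting serves for contents, where it gives the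
-- product of a ribbon with h, and for shapes, where it meets Pieri's rule.
sumMatch-split : ∀ a p n f →
  sumInc (suc a) n (λ u → sumMatch p n λ v → f (u ++ v)) ≡
  sumMatch (replicate a false ++ true ∷ p) n f + sumMatch (replicate a false ++ false ∷ p) n f
sumMatch-split a p n f = begin
  sumInc (suc a) n (λ u → sumMatch p n λ v → f (u ++ v))
    ≡⟨ trans (sumInc-def (suc a) n _) (sumW-congᵇ (suc a) n λ u (lu , _) → trans
         (sym (sumW-*ˡ (suc (length p)) n (𝟙 (inc? u)) _))
         (trans (sumW-congᵇ (suc (length p)) n λ v (lv , _) → pointwise u v lu lv)
                (sumW-+ (suc (length p)) n _ _))) ⟩
  sumW (suc a) n (λ u → T true u + T false u)
    ≡⟨ sumW-+ (suc a) n (T true) (T false) ⟩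
  sumW (suc a) n (T true) + sumW (suc a) n (T false)
    ≡⟨ sym (cong₂ _+_ (sumMatch-++ a true p n f) (sumMatch-++ a false p n f)) ⟩
  sumMatch (replicate a false ++ true ∷ p) n f + sumMatch (replicate a false ++ false ∷ p) n f ∎
  where
  open ≡-Reasoning
  M : Bool → List ℕ → List ℕ → ℕ
  M b u v = matches (replicate a false ++ b ∷ p) (u ++ v)
  T : Bool → List ℕ → ℕ
  T b u = sumW (suc (length p)) n λ v → M b u v * f (u ++ v)
  pointwise : ∀ u v → length u ≡ suc a → length v ≡ suc (length p) →
    𝟙 (inc? u) * (matches p v * f (u ++ v)) ≡ M true u v * f (u ++ v) + M false u v * f (u ++ v)
  pointwise u v lu lv = trans (sym (*-assoc (𝟙 (inc? u)) _ _))
    (trans (cong (_* f (u ++ v)) (matches-split a p u v lu lv)) (*-distribʳ-+ (f (u ++ v)) (M true u v) _))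

sumMatch-sumInc-swap : ∀ p m n (f : List ℕ → List ℕ → ℕ) →
  sumMatch p n (λ v → sumInc m n λ u → f u v) ≡ sumInc m n (λ u → sumMatch p n λ v → f u v)
sumMatch-sumInc-swap p m n f = trans
  (sumW-cong (suc (length p)) n λ v → sym (sumInc-*ˡ m n (matches p v) (λ u → f u v)))
  (sym (sumInc-sumW m n (suc (length p)) n λ u v → matches p v * f u v))

-- Products with complete homogeneous functions, and ribbon Schur functions, by coefficients

infix 4 _≟ᴸ_

_≟ᴸ_ : (xs ys : List ℕ) → Dec (xs ≡ ys)
_≟ᴸ_ = ≡-decᴸ _≟_

-- Both sums are extended to the common range `m + n`, where the indicators cut them off again; what
-- remains is a comparison of summands.
sumTo-exchange : ∀ m n {f g : ℕ → ℕ} →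
  (∀ i → 𝟙 (i <? m) * f i ≡ 𝟙 (i <? n) * g i) → sumTo m f ≡ sumTo n g
sumTo-exchange m n {f} {g} e = begin
  sumTo m f                                 ≡⟨ sym (sumTo-truncate m n f) ⟩
  sumTo (m + n) (λ i → 𝟙 (i <? m) * f i)    ≡⟨ sumTo-cong (m + n) e ⟩
  sumTo (m + n) (λ i → 𝟙 (i <? n) * g i)    ≡⟨ cong (λ k → sumTo k (λ i → 𝟙 (i <? n) * g i)) (+-comm m n) ⟩
  sumTo (n + m) (λ i → 𝟙 (i <? n) * g i)    ≡⟨ sumTo-truncate n m g ⟩
  sumTo n g                                 ∎
  where open ≡-Reasoning

-- The coefficient of x^α in h_m(x) g(x), where g is given by its coefficients.
H : ℕ → (List ℕ → ℕ) → List ℕ → ℕ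
H m g []      = 𝟙 (m ≟ 0) * g []
H m g (a ∷ α) = sumTo (suc a) λ i → 𝟙 (i ≤? m) * H (m ∸ i) (λ γ → g ((a ∸ i) ∷ γ)) α

H-cong : ∀ m α {f g} → (∀ γ → length γ ≡ length α → f γ ≡ g γ) → H m f α ≡ H m g α
H-cong m []      e = cong (𝟙 (m ≟ 0) *_) (e [] refl)
H-cong m (a ∷ α) e = sumTo-cong (suc a) λ i →
  cong (𝟙 (i ≤? m) *_) (H-cong (m ∸ i) α λ γ l → e (a ∸ i ∷ γ) (cong suc l))

H-sumW : ∀ m α k n (f : List ℕ → List ℕ → ℕ) →
         H m (λ γ → sumW k n (λ v → f v γ)) α ≡ sumW k n (λ v → H m (f v) α)
H-sumW m []      k n f = sym (sumW-*ˡ k n (𝟙 (m ≟ 0)) (λ v → f v []))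
H-sumW m (a ∷ α) k n f = trans
  (sumTo-cong (suc a) λ i → trans
    (cong (𝟙 (i ≤? m) *_) (H-sumW (m ∸ i) α k n (λ v γ → f v (a ∸ i ∷ γ))))
    (sym (sumW-*ˡ k n (𝟙 (i ≤? m)) _)))
  (sym (sumW-sumTo k n (suc a) _))

H-*ˡ : ∀ m α c f → H m (λ γ → c * f γ) α ≡ c * H m f α
H-*ˡ m []      c f = *-swapˡ (𝟙 (m ≟ 0)) c (f [])
H-*ˡ m (a ∷ α) c f = trans
  (sumTo-cong (suc a) λ i → trans
    (cong (𝟙 (i ≤? m) *_) (H-*ˡ (m ∸ i) α c (λ γ → f (a ∸ i ∷ γ)))) (*-swapˡ (𝟙 (i ≤? m)) c _))
  (sumTo-*ˡ (suc a) c _)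

H-0 : ∀ m α → H m (λ _ → 0) α ≡ 0
H-0 m α = H-*ˡ m α 0 (λ _ → 0)

-- `H` takes up the variables from the first on, whereas the inductions below remove the last one.
-- The parts `i` and `j` of the degree `m` given to two variables can be chosen in either order.
H-snoc : ∀ m g α a → H m g (α ∷ʳ a) ≡
  sumTo (suc a) λ i → 𝟙 (i ≤? m) * H (m ∸ i) (λ γ → g (γ ∷ʳ (a ∸ i))) α
H-snoc m g []      a = refl
H-snoc m g (b ∷ α) a = begin
  sumTo (suc b) (λ j → 𝟙 (j ≤? m) * H (m ∸ j) (λ γ → g (b ∸ j ∷ γ)) (α ∷ʳ a))
    ≡⟨ (sumTo-cong (suc b) λ j → trans
         (cong (𝟙 (j ≤? m) *_) (H-snoc (m ∸ j) (λ γ → g (b ∸ j ∷ γ)) α a))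
         (sym (sumTo-*ˡ (suc a) (𝟙 (j ≤? m)) _))) ⟩
  sumTo (suc b) (λ j → sumTo (suc a) λ i → 𝟙 (j ≤? m) * (𝟙 (i ≤? m ∸ j) * H (m ∸ j ∸ i) (G i j) α))
    ≡⟨ sumTo-swap (suc b) (suc a) _ ⟩
  sumTo (suc a) (λ i → sumTo (suc b) λ j → 𝟙 (j ≤? m) * (𝟙 (i ≤? m ∸ j) * H (m ∸ j ∸ i) (G i j) α))
    ≡⟨ (sumTo-cong (suc a) λ i → trans (sumTo-cong (suc b) λ j → exchange i j) (sumTo-*ˡ (suc b) (𝟙 (i ≤? m)) _)) ⟩
  sumTo (suc a) (λ i → 𝟙 (i ≤? m) * H (m ∸ i) (λ γ → g (γ ∷ʳ (a ∸ i))) (b ∷ α)) ∎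
  where
  open ≡-Reasoning
  G : ℕ → ℕ → List ℕ → ℕ
  G i j γ = g (b ∸ j ∷ γ ∷ʳ (a ∸ i))
  both : ∀ {i j} → j ≤ m → i ≤ m ∸ j → i ≤ m × j ≤ m ∸ i
  both {i} {j} j≤m i≤m∸j = ≤-trans i≤m∸j (m∸n≤m m j) ,
    m+n≤o⇒m≤o∸n j (subst (j + i ≤_) (m+[n∸m]≡n j≤m) (+-monoʳ-≤ j i≤m∸j))
  conj : ∀ i j → 𝟙 (j ≤? m) * 𝟙 (i ≤? m ∸ j) ≡ 𝟙 (i ≤? m) * 𝟙 (j ≤? m ∸ i)
  conj i j = trans (sym (𝟙-× (j ≤? m) (i ≤? m ∸ j))) (trans
    (𝟙-cong ((j ≤? m) ×-dec (i ≤? m ∸ j)) ((i ≤? m) ×-dec (j ≤? m ∸ i)) (uncurry both) (uncurry both))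
    (𝟙-× (i ≤? m) (j ≤? m ∸ i)))
  exchange : ∀ i j → 𝟙 (j ≤? m) * (𝟙 (i ≤? m ∸ j) * H (m ∸ j ∸ i) (G i j) α) ≡
                     𝟙 (i ≤? m) * (𝟙 (j ≤? m ∸ i) * H (m ∸ i ∸ j) (G i j) α)
  exchange i j = begin
    𝟙 (j ≤? m) * (𝟙 (i ≤? m ∸ j) * H (m ∸ j ∸ i) (G i j) α)
      ≡⟨ sym (*-assoc (𝟙 (j ≤? m)) _ _) ⟩
    𝟙 (j ≤? m) * 𝟙 (i ≤? m ∸ j) * H (m ∸ j ∸ i) (G i j) α
      ≡⟨ cong₂ (λ x k → x * H k (G i j) α) (conj i j) (trans (∸-+-assoc m j i) (trans (cong (m ∸_) (+-comm j i)) (sym (∸-+-assoc m i j)))) ⟩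
    𝟙 (i ≤? m) * 𝟙 (j ≤? m ∸ i) * H (m ∸ i ∸ j) (G i j) α
      ≡⟨ *-assoc (𝟙 (i ≤? m)) _ _ ⟩
    𝟙 (i ≤? m) * (𝟙 (j ≤? m ∸ i) * H (m ∸ i ∸ j) (G i j) α) ∎

occurrences : ℕ → List ℕ → ℕ
occurrences i = count (_≟ i)

occurrences-++ : ∀ i u v → occurrences i (u ++ v) ≡ occurrences i u + occurrences i v
occurrences-++ i u v = trans (cong length (filter-++ (_≟ i) u v)) (length-++ (filter (_≟ i) u))

occurrences-∷ : ∀ i x u → occurrences i (x ∷ u) ≡ 𝟙 (x ≟ i) + occurrences i u
occurrences-∷ i x u with does (x ≟ i)
... | true  = refl
... | false = refl

occurrences-replicate : ∀ k i → occurrences i (replicate k i) ≡ k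
occurrences-replicate zero    i = refl
occurrences-replicate (suc k) i = trans (occurrences-∷ i i (replicate k i))
  (cong₂ _+_ (𝟙-yes (i ≟ i) refl) (occurrences-replicate k i))

occurrences-none : ∀ i u → All (_≢ i) u → occurrences i u ≡ 0
occurrences-none i []      []         = refl
occurrences-none i (x ∷ u) (x≢i ∷ a) =
  trans (occurrences-∷ i x u) (cong₂ _+_ (𝟙-no (x ≟ i) x≢i) (occurrences-none i u a))

content-suc : ∀ n w → content (suc n) w ≡ content n w ∷ʳ occurrences n w
content-suc n w = trans (cong (map (λ i → occurrences i w)) (sym (upTo-∷ʳ n))) (map-++ _ (upTo n) (n ∷ []))

content-cong : ∀ n v w → (∀ i → i < n → occurrences i v ≡ occurrences i w) → content n v ≡ content n w
content-cong n v w e = map-cong-local (AllP.applyUpTo⁺₁ id n (λ {i} i<n → e i i<n))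

𝟙-∷ʳ : ∀ xs ys x y → 𝟙 (xs ∷ʳ x ≟ᴸ ys ∷ʳ y) ≡ 𝟙 (x ≟ y) * 𝟙 (xs ≟ᴸ ys)
𝟙-∷ʳ xs ys x y = trans
  (𝟙-cong (xs ∷ʳ x ≟ᴸ ys ∷ʳ y) ((x ≟ y) ×-dec (xs ≟ᴸ ys))
    (λ e → proj₂ (∷ʳ-injective xs ys e) , proj₁ (∷ʳ-injective xs ys e)) (λ { (refl , refl) → refl }))
  (𝟙-× (x ≟ y) (xs ≟ᴸ ys))

largest-letters : ∀ n u k v → All (_< n) u →
  content (suc n) ((u ++ replicate k n) ++ v) ≡ content n (u ++ v) ∷ʳ (k + occurrences n v)
largest-letters n u k v u<n = trans (content-suc n ((u ++ replicate k n) ++ v)) (cong₂ _∷ʳ_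
  (content-cong n ((u ++ replicate k n) ++ v) (u ++ v) λ i i<n → begin
    occurrences i ((u ++ replicate k n) ++ v)                            ≡⟨ parts i ⟩
    occurrences i u + occurrences i (replicate k n) + occurrences i v
      ≡⟨ cong (λ z → occurrences i u + z + occurrences i v)
           (occurrences-none i (replicate k n) (AllP.replicate⁺ k (<⇒≢ i<n ∘ sym))) ⟩
    occurrences i u + 0 + occurrences i v                                ≡⟨ cong (_+ occurrences i v) (+-identityʳ _) ⟩
    occurrences i u + occurrences i v                                    ≡⟨ sym (occurrences-++ i u v) ⟩
    occurrences i (u ++ v)                                               ∎)
  (trans (parts n) (cong₂ (λ y z → y + z + occurrences n v)
    (occurrences-none n u (All.map <⇒≢ u<n)) (occurrences-replicate k n))))
  where
  open ≡-Reasoning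
  parts : ∀ i → occurrences i ((u ++ replicate k n) ++ v) ≡
                occurrences i u + occurrences i (replicate k n) + occurrences i v
  parts i = trans (occurrences-++ i (u ++ replicate k n) v)
                  (cong (_+ occurrences i v) (occurrences-++ i u (replicate k n)))

length-∷ʳ : ∀ (xs : List ℕ) x → length (xs ∷ʳ x) ≡ suc (length xs)
length-∷ʳ xs x = trans (length-++ xs) (+-comm (length xs) 1)

-- The monomials of h of degree m correspond to the increasing words of length m. In the induction
-- on the number of variables, the power of the last variable taken from h is the length of the
-- block of largest letters at the end of `u`.
H-content : ∀ n m v α → length α ≡ n →
  H m (λ γ → 𝟙 (content n v ≟ᴸ γ)) α ≡ sumInc m n (λ u → 𝟙 (content n (u ++ v) ≟ᴸ α))
H-content zero    zero    v [] _ = sym (sumInc-zero 0 _)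
H-content zero    (suc m) v [] _ = sym (trans (sumInc-def (suc m) 0 _) (trans (sumW-suc m 0 _) (sumTo-zero _)))
H-content (suc n) m v α l with initLast α
... | β ∷ʳ′ a = begin
  H m (λ γ → 𝟙 (content (suc n) v ≟ᴸ γ)) (β ∷ʳ a)
    ≡⟨ H-snoc m _ β a ⟩
  sumTo (suc a) (λ i → 𝟙 (i ≤? m) * H (m ∸ i) (λ γ → 𝟙 (content (suc n) v ≟ᴸ γ ∷ʳ (a ∸ i))) β)
    ≡⟨ sumTo-cong (suc a) (λ i → cong (𝟙 (i ≤? m) *_) (left i)) ⟩
  sumTo (suc a) (λ i → 𝟙 (i ≤? m) * (𝟙 (occurrences n v ≟ a ∸ i) * S (m ∸ i)))
    -- The first sum has `i` at most the exponent `a`, the second has `i` at most the degree `m`. In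
    -- both, the indicators leave the `i` with `i ≤ m` and `i + occurrences n v ≡ a`.
    ≡⟨ sumTo-exchange (suc a) (suc m) exchange ⟩
  sumTo (suc m) (λ i → 𝟙 (m ∸ (m ∸ i) + occurrences n v ≟ a) * S (m ∸ i))
    ≡⟨ sym (sumTo-reverse m (λ j → 𝟙 (m ∸ j + occurrences n v ≟ a) * S j)) ⟩
  sumTo (suc m) (λ j → 𝟙 (m ∸ j + occurrences n v ≟ a) * S j)
    ≡⟨ sym (sumTo-cong (suc m) right) ⟩
  sumTo (suc m) (λ j → sumInc j n λ u → 𝟙 (content (suc n) ((u ++ replicate (m ∸ j) n) ++ v) ≟ᴸ β ∷ʳ a))
    ≡⟨ sym (sumInc-snoc m n _) ⟩
  sumInc m (suc n) (λ u → 𝟙 (content (suc n) (u ++ v) ≟ᴸ β ∷ʳ a)) ∎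
  where
  open ≡-Reasoning
  lβ : length β ≡ n
  lβ = suc-injective (trans (sym (length-∷ʳ β a)) l)
  S : ℕ → ℕ
  S j = sumInc j n λ u → 𝟙 (content n (u ++ v) ≟ᴸ β)
  left : ∀ i → H (m ∸ i) (λ γ → 𝟙 (content (suc n) v ≟ᴸ γ ∷ʳ (a ∸ i))) β ≡
               𝟙 (occurrences n v ≟ a ∸ i) * S (m ∸ i)
  left i = trans
    (H-cong (m ∸ i) β λ γ _ → trans (cong (λ c → 𝟙 (c ≟ᴸ γ ∷ʳ (a ∸ i))) (content-suc n v))
                                    (𝟙-∷ʳ (content n v) γ (occurrences n v) (a ∸ i)))
    (trans (H-*ˡ (m ∸ i) β (𝟙 (occurrences n v ≟ a ∸ i)) _)
           (cong (𝟙 (occurrences n v ≟ a ∸ i) *_) (H-content n (m ∸ i) v β lβ)))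
  right : ∀ j → sumInc j n (λ u → 𝟙 (content (suc n) ((u ++ replicate (m ∸ j) n) ++ v) ≟ᴸ β ∷ʳ a)) ≡
                𝟙 (m ∸ j + occurrences n v ≟ a) * S j
  right j = trans
    (sumInc-congᵇ j n λ u (_ , u<n) → trans
      (cong (λ c → 𝟙 (c ≟ᴸ β ∷ʳ a)) (largest-letters n u (m ∸ j) v u<n))
      (𝟙-∷ʳ (content n (u ++ v)) β (m ∸ j + occurrences n v) a))
    (sumInc-*ˡ j n (𝟙 (m ∸ j + occurrences n v ≟ a)) _)
  exchange : ∀ i → 𝟙 (i <? suc a) * (𝟙 (i ≤? m) * (𝟙 (occurrences n v ≟ a ∸ i) * S (m ∸ i))) ≡
                   𝟙 (i <? suc m) * (𝟙 (m ∸ (m ∸ i) + occurrences n v ≟ a) * S (m ∸ i))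
  exchange i = begin
    𝟙 (i <? suc a) * (𝟙 (i ≤? m) * (𝟙 (o ≟ a ∸ i) * S (m ∸ i)))
      ≡⟨ *-swapˡ (𝟙 (i <? suc a)) (𝟙 (i ≤? m)) _ ⟩
    𝟙 (i ≤? m) * (𝟙 (i <? suc a) * (𝟙 (o ≟ a ∸ i) * S (m ∸ i)))
      ≡⟨ 𝟙*-cong (i ≤? m) (i <? suc m) s≤s s≤s⁻¹ (λ i≤m → trans (sym (*-assoc (𝟙 (i <? suc a)) _ _))
           (cong (_* S (m ∸ i)) (trans (sym (𝟙-× (i <? suc a) (o ≟ a ∸ i)))
             (𝟙-cong ((i <? suc a) ×-dec (o ≟ a ∸ i)) (m ∸ (m ∸ i) + o ≟ a)
               (λ (i≤a , e) → trans (cong₂ _+_ (m∸[m∸n]≡n i≤m) e) (m+[n∸m]≡n (s≤s⁻¹ i≤a)))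
               (λ e → let e′ = trans (cong (_+ o) (sym (m∸[m∸n]≡n i≤m))) e in
                 s≤s (subst (i ≤_) e′ (m≤m+n i o)) , trans (sym (m+n∸m≡n i o)) (cong (_∸ i) e′)))))) ⟩
    𝟙 (i <? suc m) * (𝟙 (m ∸ (m ∸ i) + o ≟ a) * S (m ∸ i)) ∎
    where
    o : ℕ
    o = occurrences n v

-- The coefficient of x^α in the ribbon Schur function of the pattern.
ribbon : List Bool → List ℕ → ℕ
ribbon p α = sumMatch p (length α) λ w → 𝟙 (content (length α) w ≟ᴸ α)

ribbon-split : ∀ a p α → H (suc a) (ribbon p) α ≡
  ribbon (replicate a false ++ true ∷ p) α + ribbon (replicate a false ++ false ∷ p) α
ribbon-split a p α = begin
  H (suc a) (ribbon p) α
    ≡⟨ H-cong (suc a) α (λ γ l → cong (λ k → sumMatch p k λ w → 𝟙 (content k w ≟ᴸ γ)) l) ⟩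
  H (suc a) (λ γ → sumMatch p n λ w → 𝟙 (content n w ≟ᴸ γ)) α
    ≡⟨ H-sumW (suc a) α (suc (length p)) n _ ⟩
  sumW (suc (length p)) n (λ v → H (suc a) (λ γ → matches p v * 𝟙 (content n v ≟ᴸ γ)) α)
    ≡⟨ (sumW-cong (suc (length p)) n λ v → trans (H-*ˡ (suc a) α (matches p v) _)
         (cong (matches p v *_) (H-content n (suc a) v α refl))) ⟩
  sumMatch p n (λ v → sumInc (suc a) n λ u → 𝟙 (content n (u ++ v) ≟ᴸ α))
    ≡⟨ sumMatch-sumInc-swap p (suc a) n (λ u v → 𝟙 (content n (u ++ v) ≟ᴸ α)) ⟩
  sumInc (suc a) n (λ u → sumMatch p n λ v → 𝟙 (content n (u ++ v) ≟ᴸ α))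
    ≡⟨ sumMatch-split a p n _ ⟩
  ribbon (replicate a false ++ true ∷ p) α + ribbon (replicate a false ++ false ∷ p) α ∎
  where
  open ≡-Reasoning
  n : ℕ
  n = length α

-- The indicator of the zero exponents is the series 1, so this is the coefficient of h itself:
-- every exponent has to be taken entirely from the factor h.
H-one : ∀ m α → H m (λ γ → 𝟙 (replicate (length α) 0 ≟ᴸ γ)) α ≡ 𝟙 (total α ≟ m)
H-one zero    []      = refl
H-one (suc m) []      = refl
H-one m       (a ∷ α) = begin
  sumTo (suc a) (λ i → 𝟙 (i ≤? m) * H (m ∸ i) (λ γ → 𝟙 (0 ∷ z ≟ᴸ (a ∸ i) ∷ γ)) α)
    ≡⟨ sumTo-single (suc a) _ a (n<1+n a) (λ i i≤a i≢a → trans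
         (cong (𝟙 (i ≤? m) *_) (trans
           (H-cong (m ∸ i) α λ γ _ → 𝟙-no (0 ∷ z ≟ᴸ (a ∸ i) ∷ γ) λ e →
             i≢a (≤-antisym (s≤s⁻¹ i≤a) (m∸n≡0⇒m≤n (sym (proj₁ (∷-injective e))))))
           (H-0 (m ∸ i) α)))
         (*-zeroʳ (𝟙 (i ≤? m)))) ⟩
  𝟙 (a ≤? m) * H (m ∸ a) (λ γ → 𝟙 (0 ∷ z ≟ᴸ (a ∸ a) ∷ γ)) α
    ≡⟨ cong (𝟙 (a ≤? m) *_) (trans
         (H-cong (m ∸ a) α λ γ _ → 𝟙-cong (0 ∷ z ≟ᴸ (a ∸ a) ∷ γ) (z ≟ᴸ γ)
           (λ e → proj₂ (∷-injective e)) (λ e → cong₂ _∷_ (sym (n∸n≡0 a)) e))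
         (H-one (m ∸ a) α)) ⟩
  𝟙 (a ≤? m) * 𝟙 (total α ≟ m ∸ a)
    ≡⟨ trans (sym (𝟙-× (a ≤? m) (total α ≟ m ∸ a)))
         (𝟙-cong ((a ≤? m) ×-dec (total α ≟ m ∸ a)) (a + total α ≟ m)
           (λ (a≤m , e) → trans (cong (a +_) e) (m+[n∸m]≡n a≤m))
           (λ e → subst (a ≤_) e (m≤m+n a _) , trans (sym (m+n∸m≡n a _)) (cong (_∸ a) e))) ⟩
  𝟙 (a + total α ≟ m) ∎
  where
  open ≡-Reasoning
  z : List ℕ
  z = replicate (length α) 0

content-[] : ∀ n → content n [] ≡ replicate n 0
content-[] n = trans (map-zero (upTo n)) (cong (λ k → replicate k 0) (length-upTo n))
  where
  map-zero : ∀ (xs : List ℕ) → map (λ _ → 0) xs ≡ replicate (length xs) 0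
  map-zero []       = refl
  map-zero (x ∷ xs) = cong (0 ∷_) (map-zero xs)

ribbon-row : ∀ a α → ribbon (replicate a false) α ≡ 𝟙 (total α ≟ suc a)
ribbon-row a α = begin
  ribbon (replicate a false) α
    ≡⟨ sumMatch-inc a n _ ⟩
  sumInc (suc a) n (λ u → 𝟙 (content n u ≟ᴸ α))
    ≡⟨ sumInc-cong (suc a) n (λ u → cong (λ w → 𝟙 (content n w ≟ᴸ α)) (sym (++-identityʳ u))) ⟩
  sumInc (suc a) n (λ u → 𝟙 (content n (u ++ []) ≟ᴸ α))
    ≡⟨ sym (H-content n (suc a) [] α refl) ⟩
  H (suc a) (λ γ → 𝟙 (content n [] ≟ᴸ γ)) α
    ≡⟨ cong (λ c → H (suc a) (λ γ → 𝟙 (c ≟ᴸ γ)) α) (content-[] n) ⟩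
  H (suc a) (λ γ → 𝟙 (replicate n 0 ≟ᴸ γ)) α
    ≡⟨ H-one (suc a) α ⟩
  𝟙 (total α ≟ suc a) ∎
  where
  open ≡-Reasoning
  n : ℕ
  n = length α

-- Tableaux row by row

interval : ℕ → ℕ → List ℕ
interval m zero    = []
interval m (suc r) = m ∷ interval (suc m) r

length-interval : ∀ m r → length (interval m r) ≡ r
length-interval m zero    = refl
length-interval m (suc r) = cong suc (length-interval (suc m) r)

interval-+ : ∀ m a b → interval m (a + b) ≡ interval m a ++ interval (m + a) b
interval-+ m zero    b = cong (λ k → interval k b) (sym (+-identityʳ m))
interval-+ m (suc a) b = cong (m ∷_)
  (trans (interval-+ (suc m) a b) (cong (λ k → interval (suc m) a ++ interval k b) (sym (+-suc m a))))

upTo-interval : ∀ n → upTo n ≡ interval 0 n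
upTo-interval n = shifted n id 0 λ _ → refl
  where
  shifted : ∀ n (f : ℕ → ℕ) m → (∀ i → f i ≡ m + i) → applyUpTo f n ≡ interval m n
  shifted zero    f m e = refl
  shifted (suc n) f m e = cong₂ _∷_ (trans (e 0) (+-identityʳ m))
    (shifted n (f ∘ suc) (suc m) λ i → trans (e (suc i)) (+-suc m i))

interval-≥ : ∀ m r → All (m ≤_) (interval m r)
interval-≥ m zero    = []
interval-≥ m (suc r) = ≤-refl ∷ All.map (≤-trans (n≤1+n m)) (interval-≥ (suc m) r)

interval-< : ∀ m r → All (_< m + r) (interval m r)
interval-< m zero    = []
interval-< m (suc r) = m<m+n m z<s ∷ subst (λ k → All (_< k) (interval (suc m) r)) (sym (+-suc m r)) (interval-< (suc m) r)

filter-upTo : ∀ m r → filter (m ≤?_) (upTo (m + r)) ≡ interval m r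
filter-upTo m r = begin
  filter (m ≤?_) (upTo (m + r))                                        ≡⟨ cong (filter (m ≤?_)) (trans (upTo-interval (m + r)) (interval-+ 0 m r)) ⟩
  filter (m ≤?_) (interval 0 m ++ interval m r)                        ≡⟨ filter-++ (m ≤?_) (interval 0 m) _ ⟩
  filter (m ≤?_) (interval 0 m) ++ filter (m ≤?_) (interval m r)
    ≡⟨ cong₂ _++_ (filter-none (m ≤?_) (All.map <⇒≱ (interval-< 0 m))) (filter-all (m ≤?_) (interval-≥ m r)) ⟩
  interval m r ∎
  where open ≡-Reasoning

-- A diagram as the list of its rows, each with its first column and its length.
Rows : Set
Rows = List (ℕ × ℕ)

rowCells : ℕ → ℕ → ℕ → List Cell
rowCells i m r = map (i ,_) (interval m r)

rowsCells : ℕ → Rows → List Cell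
rowsCells i []            = []
rowsCells i ((m , r) ∷ ρ) = rowCells i m r ++ rowsCells (suc i) ρ

rowsSize : Rows → ℕ
rowsSize []            = 0
rowsSize ((m , r) ∷ ρ) = r + rowsSize ρ

rowsOf : List ℕ → List ℕ → Rows
rowsOf []       _        = []
rowsOf (l ∷ λs) []       = (0 , l) ∷ rowsOf λs []
rowsOf (l ∷ λs) (m ∷ μs) = (m , l ∸ m) ∷ rowsOf λs μs

length-rowCells : ∀ i m r → length (rowCells i m r) ≡ r
length-rowCells i m r = trans (length-map (i ,_) (interval m r)) (length-interval m r)

length-rowsCells : ∀ i ρ → length (rowsCells i ρ) ≡ rowsSize ρ
length-rowsCells i []            = refl
length-rowsCells i ((m , r) ∷ ρ) =
  trans (length-++ (rowCells i m r)) (cong₂ _+_ (length-rowCells i m r) (length-rowsCells (suc i) ρ))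

private
  concatMap-suc : ∀ {A : Set} n (F : ℕ → List A) → concatMap F (applyUpTo suc n) ≡ concatMap (F ∘ suc) (upTo n)
  concatMap-suc n F = trans (cong (concatMap F) (sym (map-upTo suc n))) (concatMap-map F suc (upTo n))

  rowAt : ℕ → List ℕ → List ℕ → ℕ → List Cell
  rowAt k λs μs i = map (k + i ,_) (filter (part μs i ≤?_) (upTo (part λs i)))

  rowsFrom : ∀ k λs μs → Prefix _≤_ μs λs → concatMap (rowAt k λs μs) (upTo (length λs)) ≡ rowsCells k (rowsOf λs μs)
  rowsFrom k []       []       []         = refl
  rowsFrom k (l ∷ λs) []       []         = cong₂ _++_
    (cong₂ (λ i → map (i ,_)) (+-identityʳ k) (filter-upTo 0 l))
    (trans (concatMap-suc (length λs) (rowAt k (l ∷ λs) []))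
      (trans (concatMap-cong (λ i → cong (λ z → map (z ,_) (filter (0 ≤?_) (upTo (part λs i)))) (+-suc k i)) (upTo (length λs)))
             (rowsFrom (suc k) λs [] [])))
  rowsFrom k (l ∷ λs) (m ∷ μs) (m≤l ∷ pre) = cong₂ _++_
    (cong₂ (λ i → map (i ,_)) (+-identityʳ k)
      (trans (cong (λ z → filter (m ≤?_) (upTo z)) (sym (m+[n∸m]≡n m≤l))) (filter-upTo m (l ∸ m))))
    (trans (concatMap-suc (length λs) (rowAt k (l ∷ λs) (m ∷ μs)))
      (trans (concatMap-cong (λ i → cong (λ z → map (z ,_) (filter (part μs i ≤?_) (upTo (part λs i)))) (+-suc k i)) (upTo (length λs)))
             (rowsFrom (suc k) λs μs pre)))

cells-rows : ∀ λs μs → Prefix _≤_ μs λs → cells (λs , μs) ≡ rowsCells 0 (rowsOf λs μs)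
cells-rows λs μs pre = rowsFrom 0 λs μs pre

Entry : Set
Entry = Cell × ℕ

row col val : Entry → ℕ
row ((i , j) , v) = i
col ((i , j) , v) = j
val ((i , j) , v) = v

Good : List Entry → Set
Good T = All (λ x → All (Compatible x) T) T

good? : Decidable₁ Good
good? T = all? (λ x → all? (compatible? x) T) T

-- All that `Compatible` demands between a row and the rows below it: the clause about equal rows is
-- then void, and the inequality of rows in the other clause holds.
ColLess : List Entry → List Entry → Set
ColLess S T = All (λ x → All (λ y → col x ≡ col y → val x < val y) T) S

fill : ℕ → ℕ → List ℕ → List Entry
fill i m []      = []
fill i m (x ∷ u) = ((i , m) , x) ∷ fill i (suc m) u

fillRows : ℕ → Rows → List ℕ → List Entry
fillRows i ρ w = zip (rowsCells i ρ) w

zip-++ : ∀ {A B : Set} (xs : List A) (us : List B) {ys vs} → length us ≡ length xs →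
         zip (xs ++ ys) (us ++ vs) ≡ zip xs us ++ zip ys vs
zip-++ []       []       e = refl
zip-++ (x ∷ xs) (u ∷ us) e = cong ((x , u) ∷_) (zip-++ xs us (suc-injective e))

zip-fill : ∀ i m r u → length u ≡ r → zip (rowCells i m r) u ≡ fill i m u
zip-fill i m zero    []      e = refl
zip-fill i m (suc r) (x ∷ u) e = cong (_ ∷_) (zip-fill i (suc m) r u (suc-injective e))

fillRows-++ : ∀ i m r ρ u w → length u ≡ r →
              fillRows i ((m , r) ∷ ρ) (u ++ w) ≡ fill i m u ++ fillRows (suc i) ρ w
fillRows-++ i m r ρ u w e = trans
  (zip-++ (rowCells i m r) u (trans e (sym (length-rowCells i m r))))
  (cong (_++ fillRows (suc i) ρ w) (zip-fill i m r u e))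

fill-row : ∀ i m u → All (λ x → row x ≡ i) (fill i m u)
fill-row i m []      = []
fill-row i m (x ∷ u) = refl ∷ fill-row i (suc m) u

fill-col≥ : ∀ i m u → All (λ x → m ≤ col x) (fill i m u)
fill-col≥ i m []      = []
fill-col≥ i m (x ∷ u) = ≤-refl ∷ All.map (≤-trans (n≤1+n m)) (fill-col≥ i (suc m) u)

zip-All : ∀ {A B : Set} {P : A → Set} (xs : List A) (us : List B) → All P xs → All (P ∘ proj₁) (zip xs us)
zip-All []       _        _        = []
zip-All (x ∷ xs) []       _        = []
zip-All (x ∷ xs) (u ∷ us) (p ∷ ps) = p ∷ zip-All xs us ps

rowsCells-row : ∀ i ρ → All (λ c → i ≤ proj₁ c) (rowsCells i ρ)
rowsCells-row i []            = []
rowsCells-row i ((m , r) ∷ ρ) = AllP.++⁺ (AllP.map⁺ (All.universal (λ _ → ≤-refl) (interval m r)))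
  (All.map (≤-trans (n≤1+n i)) (rowsCells-row (suc i) ρ))

fillRows-row : ∀ i ρ w → All (λ x → i ≤ row x) (fillRows i ρ w)
fillRows-row i ρ w = zip-All (rowsCells i ρ) w (rowsCells-row i ρ)

good-fill⁻ : ∀ i m u → Good (fill i m u) → Inc u
good-fill⁻ i m []      _ = []
good-fill⁻ i m (x ∷ u) ((_ ∷ x≤) ∷ g) = heads (suc m) u (fill-col≥ i (suc m) u) x≤ ∷ good-fill⁻ i (suc m) u (All.map All.tail g)
  where
  heads : ∀ k u → All (λ y → suc m ≤ col y) (fill i k u) → All (Compatible ((i , m) , x)) (fill i k u) → All (x ≤_) u
  heads k []      _          _        = []
  heads k (y ∷ u) (m<k ∷ ms) (c ∷ cs) = proj₁ c refl m<k ∷ heads (suc k) u ms cs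

good-fill⁺ : ∀ i m u → Inc u → Good (fill i m u)
good-fill⁺ i m []      _          = []
good-fill⁺ i m (x ∷ u) (x≤ ∷ inc) =
  (((λ _ j<j → contradiction j<j (<-irrefl refl)) , λ _ i<i → contradiction i<i (<-irrefl refl)) ∷ after (suc m) u x≤) ∷
  All.zipWith (λ (c , cs) → c ∷ cs) (before (suc m) u ≤-refl , good-fill⁺ i (suc m) u inc)
  where
  after : ∀ k u → All (x ≤_) u → All (Compatible ((i , m) , x)) (fill i k u)
  after k []      []        = []
  after k (y ∷ u) (x≤y ∷ l) = ((λ _ _ → x≤y) , λ _ i<i → contradiction i<i (<-irrefl refl)) ∷ after (suc k) u l
  before : ∀ k u → suc m ≤ k → All (λ y → Compatible y ((i , m) , x)) (fill i k u)
  before k []      _   = []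
  before k (y ∷ u) m<k = ((λ _ k<m → contradiction k<m (<-asym m<k)) , λ _ i<i → contradiction i<i (<-irrefl refl)) ∷
                         before (suc k) u (≤-trans m<k (n≤1+n k))

good-++⁻ : ∀ i m u T → All (λ y → suc i ≤ row y) T → Good (fill i m u ++ T) →
           Inc u × Good T × ColLess (fill i m u) T
good-++⁻ i m u T below g =
  good-fill⁻ i m u (All.map (AllP.++⁻ˡ S) (AllP.++⁻ˡ S g)) ,
  All.map (AllP.++⁻ʳ S) (AllP.++⁻ʳ S g) ,
  All.zipWith (λ { (refl , cs) → All.zipWith (λ (i<i′ , c) → λ e → proj₂ c e i<i′) (below , AllP.++⁻ʳ S cs) })
    (fill-row i m u , AllP.++⁻ˡ S g)
  where
  S : List Entry
  S = fill i m u

good-++⁺ : ∀ i m u T → All (λ y → suc i ≤ row y) T → Inc u → Good T → ColLess (fill i m u) T →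
           Good (fill i m u ++ T)
good-++⁺ i m u T below inc g lt = AllP.++⁺
  (All.zipWith (λ { (cs , (refl , l)) → AllP.++⁺ cs (All.zipWith
      (λ (i<i′ , f) → (λ e → contradiction e (<⇒≢ i<i′)) , λ e _ → f e) (below , l)) })
    (good-fill⁺ i m u inc , All.zip (fill-row i m u , lt)))
  (All.zipWith (λ (i<i′ , cs) → AllP.++⁺
      (All.map (λ { refl → (λ e → contradiction (sym e) (<⇒≢ i<i′)) , λ _ c → contradiction c (<-asym i<i′) }) (fill-row i m u))
      cs)
    (below , g))

colLess? : ∀ S T → Dec (ColLess S T)
colLess? S T = all? (λ x → all? (λ y → (col x ≟ col y) →-dec (val x <? val y)) T) S

𝟙-good-++ : ∀ i m r ρ u w → length u ≡ r →
  𝟙 (good? (fillRows i ((m , r) ∷ ρ) (u ++ w))) ≡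
  𝟙 (inc? u) * (𝟙 (good? (fillRows (suc i) ρ w)) * 𝟙 (colLess? (fill i m u) (fillRows (suc i) ρ w)))
𝟙-good-++ i m r ρ u w e = begin
  𝟙 (good? (fillRows i ((m , r) ∷ ρ) (u ++ w)))   ≡⟨ cong (𝟙 ∘ good?) (fillRows-++ i m r ρ u w e) ⟩
  𝟙 (good? (fill i m u ++ T))
    ≡⟨ 𝟙-cong (good? (fill i m u ++ T)) (inc? u ×-dec (good? T ×-dec colLess? (fill i m u) T))
         (good-++⁻ i m u T below) (λ (inc , g , l) → good-++⁺ i m u T below inc g l) ⟩
  𝟙 (inc? u ×-dec (good? T ×-dec colLess? (fill i m u) T))
    ≡⟨ trans (𝟙-× (inc? u) (good? T ×-dec colLess? (fill i m u) T))
             (cong (𝟙 (inc? u) *_) (𝟙-× (good? T) (colLess? (fill i m u) T))) ⟩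
  𝟙 (inc? u) * (𝟙 (good? T) * 𝟙 (colLess? (fill i m u) T)) ∎
  where
  open ≡-Reasoning
  T : List Entry
  T = fillRows (suc i) ρ w
  below : All (λ y → suc i ≤ row y) T
  below = fillRows-row (suc i) ρ w

tableaux-sumW : ∀ D α → length (tableaux D α) ≡
  sumW (size D) (length α) λ w → 𝟙 (good? (zip (cells D) w)) * 𝟙 (content (length α) w ≟ᴸ α)
tableaux-sumW D α = trans (count-sumOver (λ w → good? (zip (cells D) w) ×-dec (content (length α) w ≟ᴸ α)) (words (size D) (upTo (length α))))
  (trans (sumOver-words (size D) (length α) _)
    (sumW-cong (size D) (length α) λ w → 𝟙-× (good? (zip (cells D) w)) (content (length α) w ≟ᴸ α)))

tableaux-rows : ∀ λs μs α → Prefix _≤_ μs λs → let ρ = rowsOf λs μs in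
  length (tableaux (λs , μs) α) ≡
  sumW (rowsSize ρ) (length α) λ w → 𝟙 (good? (fillRows 0 ρ w)) * 𝟙 (content (length α) w ≟ᴸ α)
tableaux-rows λs μs α pre = trans (tableaux-sumW (λs , μs) α) (cong₂
  (λ k cs → sumW k (length α) λ w → 𝟙 (good? (zip cs w)) * 𝟙 (content (length α) w ≟ᴸ α))
  (trans (cong length (cells-rows λs μs pre)) (length-rowsCells 0 (rowsOf λs μs)))
  (cells-rows λs μs pre))

-- Removing the largest letter

-- For rows that both start in column 0. Columns met by only one of the two rows impose nothing, so
-- that the lengths of the rows are left to the shape.
Above : List ℕ → List ℕ → Set
Above (x ∷ p) (y ∷ u) = x < y × Above p u
Above _       _       = ⊤

above? : ∀ p u → Dec (Above p u)
above? []      _       = yes tt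
above? (x ∷ p) []      = yes tt
above? (x ∷ p) (y ∷ u) = (x <? y) ×-dec above? p u

-- Sums over the semistandard fillings of λs that remain so with the row p on top.
sumSSYT : List ℕ → List ℕ → ℕ → (List ℕ → ℕ) → ℕ
sumSSYT p []       n ψ = ψ []
sumSSYT p (l ∷ λs) n ψ = sumInc l n λ u → 𝟙 (above? p u) * sumSSYT u λs n (λ w → ψ (u ++ w))

straight : List ℕ → Rows
straight λs = rowsOf λs []

colLess-fill⁻ : ∀ i i′ m p u → ColLess (fill i m p) (fill i′ m u) → Above p u
colLess-fill⁻ i i′ m []      u       _                = tt
colLess-fill⁻ i i′ m (x ∷ p) []      _                = tt
colLess-fill⁻ i i′ m (x ∷ p) (y ∷ u) ((c ∷ _) ∷ cs) = c refl , colLess-fill⁻ i i′ (suc m) p u (All.map All.tail cs)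

colLess-fill⁺ : ∀ i i′ m p u → Above p u → ColLess (fill i m p) (fill i′ m u)
colLess-fill⁺ i i′ m []      u       _         = []
colLess-fill⁺ i i′ m (x ∷ p) []      _         = All.universal (λ _ → []) _
colLess-fill⁺ i i′ m (x ∷ p) (y ∷ u) (x<y , a) =
  ((λ _ → x<y) ∷ All.map (λ m<c e → contradiction e (<⇒≢ m<c)) (fill-col≥ i′ (suc m) u)) ∷
  All.zipWith (λ (m<c , cs) → (λ e → contradiction (sym e) (<⇒≢ m<c)) ∷ cs)
    (fill-col≥ i (suc m) p , colLess-fill⁺ i i′ (suc m) p u a)

above-entry : ∀ i i′ m p u → Above p u → All (λ x → col x < m + length u →
  Any (λ z → col x ≡ col z × val x < val z) (fill i′ m u)) (fill i m p)
above-entry i i′ m []      u       _         = []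
above-entry i i′ m (x ∷ p) []      _         = All.map (λ m≤c c<m → contradiction c<m (≤⇒≯ (subst (_≤ _) (sym (+-identityʳ m)) m≤c)))
  (fill-col≥ i m (x ∷ p))
above-entry i i′ m (x ∷ p) (y ∷ u) (x<y , a) = (λ _ → here (refl , x<y)) ∷
  All.map (λ {z} f c< → there (f (subst (col z <_) (+-suc m (length u)) c<))) (above-entry i i′ (suc m) p u a)

-- Why it is enough to compare neighbouring rows: in a straight shape every column of the lower rows
-- `T` meets the row `u`, and the entry of `u` there lies strictly between.
colLess-trans : ∀ i i′ p u T → Above p u → All (λ y → col y < length u) T →
  ColLess (fill i′ 0 u) T → ColLess (fill i 0 p) T
colLess-trans i i′ p u T a T<u l = All.map
  (λ {x} f → All.zipWith (λ {y} (y<u , bounds) e →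
      lookup-column {x = x} {y} (f (subst (_< length u) (sym e) y<u)) bounds e)
    (T<u , columnwise l))
  (above-entry i i′ 0 p u a)
  where
  Bounds : List Entry → Entry → Set
  Bounds S y = All (λ z → col z ≡ col y → val z < val y) S
  columnwise : ∀ {S} → ColLess S T → All (Bounds S) T
  columnwise []       = All.universal (λ _ → []) T
  columnwise (c ∷ cs) = All.zipWith (λ (b , bs) → b ∷ bs) (c , columnwise cs)
  lookup-column : ∀ {S x y} → Any (λ z → col x ≡ col z × val x < val z) S → Bounds S y → col x ≡ col y → val x < val y
  lookup-column (here (e′ , v<)) (b ∷ _)  e = <-trans v< (b (trans (sym e′) e))
  lookup-column {x = x} {y} (there any)      (_ ∷ bs) e = lookup-column {x = x} {y} any bs e

straight-cols : ∀ i b λs w → All (_≤ b) λs → All (λ y → col y < b) (fillRows i (straight λs) w)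
straight-cols i b λs w λ≤b = zip-All (rowsCells i (straight λs)) w (go i λs λ≤b)
  where
  go : ∀ i λs → All (_≤ b) λs → All (λ c → proj₂ c < b) (rowsCells i (straight λs))
  go i []       []          = []
  go i (l ∷ λs) (l≤b ∷ bs) = AllP.++⁺ (AllP.map⁺ (All.map (λ c< → <-≤-trans c< l≤b) (interval-< 0 l))) (go (suc i) λs bs)

linked-≤ : ∀ {l λs} → Linked _≥_ (l ∷ λs) → All (_≤ l) λs
linked-≤ [-]           = []
linked-≤ (l≥x ∷ link) = l≥x ∷ All.map (λ z≤x → ≤-trans z≤x l≥x) (linked-≤ link)

linked-tail : ∀ {l λs} → Linked _≥_ (l ∷ λs) → Linked _≥_ λs
linked-tail [-]        = []
linked-tail (_ ∷ link) = link

sumSSYT-good : ∀ i p λs n ψ → Linked _≥_ (length p ∷ λs) →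
  sumW (rowsSize (straight λs)) n (λ w → let T = fillRows (suc i) (straight λs) w in
    𝟙 (good? T) * 𝟙 (colLess? (fill i 0 p) T) * ψ w) ≡ sumSSYT p λs n ψ
sumSSYT-good i p []       n ψ link = trans (sumW-zero n _) (trans
  (cong (λ k → 1 * k * ψ []) (𝟙-yes (colLess? (fill i 0 p) []) (All.universal (λ _ → []) _))) (*-identityˡ (ψ [])))
sumSSYT-good i p (l ∷ λs) n ψ link = begin
  sumW (l + s) n F
    ≡⟨ sumW-++ l s n F ⟩
  sumW l n (λ u → sumW s n λ w → F (u ++ w))
    ≡⟨ (sumW-congᵇ l n λ u (lu , _) → trans
         (sumW-cong s n λ w → pointwise u w lu)
         (trans (sumW-*ˡ s n (𝟙 (inc? u)) _) (cong (𝟙 (inc? u) *_) (trans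
           (sumW-*ˡ s n (𝟙 (above? p u)) _)
           (cong (𝟙 (above? p u) *_) (sumSSYT-good (suc i) u λs n _
             (subst (λ k → Linked _≥_ (k ∷ λs)) (sym lu) (linked-tail link)))))))) ⟩
  sumW l n (λ u → 𝟙 (inc? u) * (𝟙 (above? p u) * sumSSYT u λs n (λ w → ψ (u ++ w))))
    ≡⟨ sym (sumInc-def l n _) ⟩
  sumSSYT p (l ∷ λs) n ψ ∎
  where
  open ≡-Reasoning
  s : ℕ
  s = rowsSize (straight λs)
  P : List Entry
  P = fill i 0 p
  F : List ℕ → ℕ
  F w = let T = fillRows (suc i) (straight (l ∷ λs)) w in 𝟙 (good? T) * 𝟙 (colLess? P T) * ψ w
  pointwise : ∀ u w → length u ≡ l → let T = fillRows (suc (suc i)) (straight λs) w in F (u ++ w) ≡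
    𝟙 (inc? u) * (𝟙 (above? p u) * (𝟙 (good? T) * 𝟙 (colLess? (fill (suc i) 0 u) T) * ψ (u ++ w)))
  pointwise u w lu = begin
    F (u ++ w)
      ≡⟨ cong₂ (λ x y → x * y * ψ (u ++ w)) (𝟙-good-++ (suc i) 0 l (straight λs) u w lu)
           (cong (𝟙 ∘ colLess? P) (fillRows-++ (suc i) 0 l (straight λs) u w lu)) ⟩
    𝟙 (inc? u) * (𝟙 (good? T) * 𝟙 (colLess? S T)) * 𝟙 (colLess? P (S ++ T)) * ψ (u ++ w)
      ≡⟨ rearrange (𝟙 (inc? u)) (𝟙 (good? T)) _ _ _ ⟩
    𝟙 (inc? u) * (𝟙 (good? T) * (𝟙 (colLess? S T) * 𝟙 (colLess? P (S ++ T))) * ψ (u ++ w))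
      ≡⟨ cong (λ x → 𝟙 (inc? u) * (𝟙 (good? T) * x * ψ (u ++ w))) columns ⟩
    𝟙 (inc? u) * (𝟙 (good? T) * (𝟙 (above? p u) * 𝟙 (colLess? S T)) * ψ (u ++ w))
      ≡⟨ rearrange′ (𝟙 (inc? u)) (𝟙 (good? T)) (𝟙 (above? p u)) (𝟙 (colLess? S T)) _ ⟩
    𝟙 (inc? u) * (𝟙 (above? p u) * (𝟙 (good? T) * 𝟙 (colLess? S T) * ψ (u ++ w))) ∎
    where
    S T : List Entry
    S = fill (suc i) 0 u
    T = fillRows (suc (suc i)) (straight λs) w
    rearrange : ∀ a b c d e → a * (b * c) * d * e ≡ a * (b * (c * d) * e)
    rearrange = solve-∀
    rearrange′ : ∀ a b c d e → a * (b * (c * d) * e) ≡ a * (c * (b * d * e))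
    rearrange′ = solve-∀
    columns : 𝟙 (colLess? S T) * 𝟙 (colLess? P (S ++ T)) ≡ 𝟙 (above? p u) * 𝟙 (colLess? S T)
    columns = trans (sym (𝟙-× (colLess? S T) (colLess? P (S ++ T)))) (trans
      (𝟙-cong (colLess? S T ×-dec colLess? P (S ++ T)) (above? p u ×-dec colLess? S T)
        (λ (st , pst) → colLess-fill⁻ i (suc i) 0 p u (All.map (AllP.++⁻ˡ S) pst) , st)
        (λ (a , st) → st , All.zipWith (λ (x , y) → AllP.++⁺ x y) (colLess-fill⁺ i (suc i) 0 p u a ,
          colLess-trans i (suc i) p u T a
            (subst (λ k → All (λ y → col y < k) T) (sym lu) (straight-cols (suc (suc i)) l λs w (linked-≤ (linked-tail link)))) st)))
      (𝟙-× (above? p u) (colLess? S T)))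

sumSSYT-cong : ∀ p λs n {ψ ψ′} → (∀ w → ψ w ≡ ψ′ w) → sumSSYT p λs n ψ ≡ sumSSYT p λs n ψ′
sumSSYT-cong p []       n e = e []
sumSSYT-cong p (l ∷ λs) n e = sumInc-cong l n λ u → cong (𝟙 (above? p u) *_) (sumSSYT-cong u λs n λ w → e (u ++ w))

sumSSYT-*ˡ : ∀ p λs n c ψ → sumSSYT p λs n (λ w → c * ψ w) ≡ c * sumSSYT p λs n ψ
sumSSYT-*ˡ p []       n c ψ = refl
sumSSYT-*ˡ p (l ∷ λs) n c ψ = trans
  (sumInc-cong l n λ u → trans (cong (𝟙 (above? p u) *_) (sumSSYT-*ˡ u λs n c _)) (*-swapˡ (𝟙 (above? p u)) c _))
  (sumInc-*ˡ l n c _)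

-- The coefficient of x^α in the Schur polynomial of λs; zero rows are allowed.
kostka : List ℕ → List ℕ → ℕ
kostka λs α = sumSSYT [] λs (length α) λ w → 𝟙 (content (length α) w ≟ᴸ α)

kostka-tableaux : ∀ λs α → Linked _≥_ λs → length (tableaux (λs , []) α) ≡ kostka λs α
kostka-tableaux []       α link = trans (tableaux-rows [] [] α []) (trans (sumW-zero (length α) _) (*-identityˡ _))
kostka-tableaux (l ∷ λs) α link = trans (tableaux-rows (l ∷ λs) [] α []) (trans
  (sumW-++ l s n F)
  (trans (sumW-congᵇ l n λ u (lu , _) → trans
    (sumW-cong s n λ w → trans
      (cong (_* Ψ (u ++ w)) (𝟙-good-++ 0 0 l (straight λs) u w lu))
      (*-assoc (𝟙 (inc? u)) _ (Ψ (u ++ w))))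
    (trans (sumW-*ˡ s n (𝟙 (inc? u)) _) (cong (𝟙 (inc? u) *_) (trans
      (sumSSYT-good 0 u λs n _ (subst (λ k → Linked _≥_ (k ∷ λs)) (sym lu) link))
      (sym (*-identityˡ _))))))
  (sym (sumInc-def l n _))))
  where
  s n : ℕ
  s = rowsSize (straight λs)
  n = length α
  Ψ F : List ℕ → ℕ
  Ψ w = 𝟙 (content n w ≟ᴸ α)
  F w = 𝟙 (good? (fillRows 0 (straight (l ∷ λs)) w)) * Ψ w

-- The indicator of the interlacing μ₁ ≥ κ₁ ≥ μ₂ ≥ κ₂ ≥ ⋯ with μ₁ ≤ c.
strip : ℕ → List ℕ → List ℕ → ℕ
strip c []      []      = 1
strip c (x ∷ κ) (y ∷ μ) = 𝟙 (x ≤? y) * (𝟙 (y ≤? c) * strip x κ μ)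
strip c _       _       = 0

deficit : List ℕ → List ℕ → ℕ
deficit (l ∷ λs) (i ∷ μ) = (l ∸ i) + deficit λs μ
deficit _        _       = 0

below : ℕ → List ℕ → List ℕ
below n = filter (_<? n)

below-replicate : ∀ k n → below n (replicate k n) ≡ []
below-replicate k n = filter-none (_<? n) (AllP.replicate⁺ k (<-irrefl refl))

below-largest : ∀ n v j w → All (_< n) v → below n ((v ++ replicate j n) ++ w) ≡ v ++ below n w
below-largest n v j w v<n = begin
  below n ((v ++ replicate j n) ++ w)                    ≡⟨ filter-++ (_<? n) (v ++ replicate j n) w ⟩
  below n (v ++ replicate j n) ++ below n w              ≡⟨ cong (_++ below n w) (filter-++ (_<? n) v (replicate j n)) ⟩
  (below n v ++ below n (replicate j n)) ++ below n w
    ≡⟨ cong₂ (λ x y → (x ++ y) ++ below n w) (filter-all (_<? n) v<n) (below-replicate j n) ⟩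
  (v ++ []) ++ below n w                                 ≡⟨ cong (_++ below n w) (++-identityʳ v) ⟩
  v ++ below n w                                         ∎
  where open ≡-Reasoning

occurrences-largest : ∀ n v j w → All (_< n) v → occurrences n ((v ++ replicate j n) ++ w) ≡ j + occurrences n w
occurrences-largest n v j w v<n = trans (occurrences-++ n (v ++ replicate j n) w) (cong (_+ occurrences n w)
  (trans (occurrences-++ n v (replicate j n))
         (cong₂ _+_ (occurrences-none n v (All.map <⇒≢ v<n)) (occurrences-replicate j n))))

-- Nothing can stand below the largest letter `n`. Hence the whole lower row, its own block of `n`
-- included, has to lie under the small letters `p`; this inequality of lengths is the interlacing
-- of horizontal strips. The assumption on lengths excludes a lower row that sticks out on the
-- right.
above-largest⁻ : ∀ n p k v j → All (_< n) p → All (_< n) v → length v + j ≤ length p + k →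
  Above (p ++ replicate k n) (v ++ replicate j n) → length v + j ≤ length p × Above p v
above-largest⁻ n []      k       []      zero    _         _         _       _       = z≤n , tt
above-largest⁻ n []      (suc k) []      (suc j) _         _         _       (n<n , _) = contradiction n<n (<-irrefl refl)
above-largest⁻ n []      (suc k) (y ∷ v) j       _         (y<n ∷ _) _       (n<y , _) = contradiction n<y (<-asym y<n)
above-largest⁻ n (x ∷ p) k       []      zero    _         _         _       _       = z≤n , tt
above-largest⁻ n (x ∷ p) k       []      (suc j) (_ ∷ p<n) _         (s≤s l) (_ , a) =
  s≤s (proj₁ (above-largest⁻ n p k [] j p<n [] l a)) , tt
above-largest⁻ n (x ∷ p) k       (y ∷ v) j       (_ ∷ p<n) (_ ∷ v<n) (s≤s l) (x<y , a) =
  let l′ , a′ = above-largest⁻ n p k v j p<n v<n l a in s≤s l′ , x<y , a′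

above-largest⁺ : ∀ n p k v j → All (_< n) p → length v + j ≤ length p → Above p v →
  Above (p ++ replicate k n) (v ++ replicate j n)
above-largest⁺ n []      k []      zero    _           _       _         = above-[] (replicate k n)
  where
  above-[] : ∀ p → Above p []
  above-[] []      = tt
  above-[] (x ∷ p) = tt
above-largest⁺ n (x ∷ p) k []      zero    _           _       _         = tt
above-largest⁺ n (x ∷ p) k []      (suc j) (x<n ∷ p<n) (s≤s l) _         =
  x<n , above-largest⁺ n p k [] j p<n l (above-[]ʳ p)
  where
  above-[]ʳ : ∀ p → Above p []
  above-[]ʳ []      = tt
  above-[]ʳ (x ∷ p) = tt
above-largest⁺ n (x ∷ p) k (y ∷ v) j       (_ ∷ p<n)   (s≤s l) (x<y , a) = x<y , above-largest⁺ n p k v j p<n l a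

module _ (n B : ℕ) where

  private
    -- `μ` is the shape occupied by the letters below `n`, and `deficit λs μ` the number of letters
    -- `n`. `B` limits the range of summation. The function `φ` receives the number of letters `n`
    -- and the word of the remaining letters separately.
    Removed : ℕ → List ℕ → List ℕ → (ℕ → List ℕ → ℕ) → ℕ
    Removed c p λs φ = sumW (length λs) B λ μ → strip c μ λs * sumSSYT p μ n (φ (deficit λs μ))

    Full : List ℕ → List ℕ → (ℕ → List ℕ → ℕ) → ℕ
    Full q λs φ = sumSSYT q λs (suc n) λ w → φ (occurrences n w) (below n w)

  sumSSYT-largest : ∀ p k λs φ → All (_< n) p → Linked _≥_ (length p + k ∷ λs) → All (_< B) λs →
    Full (p ++ replicate k n) λs φ ≡ Removed (length p) p λs φ

  -- The influence of the row `q` above is kept abstract, as the equation for `𝟙 (above? q _)`. This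
  -- covers both a row below another one, with `c` the number of its small letters, and the top row,
  -- with nothing above and `c` any upper bound.
  sumSSYT-largest-step : ∀ c q p l λs φ → Linked _≥_ (l ∷ λs) → All (_< B) (l ∷ λs) →
    (∀ v j → All (_< n) v → length v + j ≡ l → 𝟙 (above? q (v ++ replicate j n)) ≡ 𝟙 (l ≤? c) * 𝟙 (above? p v)) →
    Full q (l ∷ λs) φ ≡ Removed c p (l ∷ λs) φ

  sumSSYT-largest p k []       φ p<n link λ<B = sym (trans (sumW-zero B _) (*-identityˡ _))
  sumSSYT-largest p k (l ∷ λs) φ p<n link λ<B =
    sumSSYT-largest-step (length p) (p ++ replicate k n) p l λs φ (linked-tail link) λ<B
      λ v j v<n e → trans
        (𝟙-cong (above? (p ++ replicate k n) (v ++ replicate j n)) ((l ≤? length p) ×-dec above? p v)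
          (λ a → let l≤ , a′ = above-largest⁻ n p k v j p<n v<n (subst (_≤ length p + k) (sym e) (All.head (linked-≤ link))) a
                 in subst (_≤ length p) e l≤ , a′)
          (λ (l≤ , a) → above-largest⁺ n p k v j p<n (subst (_≤ length p) (sym e) l≤) a))
        (𝟙-× (l ≤? length p) (above? p v))

  sumSSYT-largest-step c q p l λs φ link (l<B ∷ λ<B) cut = begin
    Full q (l ∷ λs) φ
      ≡⟨ sumInc-snoc l n _ ⟩
    sumTo (suc l) (λ i → sumInc i n (λ v → left i (v ++ replicate (l ∸ i) n)))
      ≡⟨ (sumTo-congᵇ (suc l) λ i i≤l → sumInc-congᵇ i n λ v (lv , v<n) → pointwise i v (s≤s⁻¹ i≤l) lv v<n) ⟩
    sumTo (suc l) (λ i → sumInc i n (λ v → 𝟙 (l ≤? c) * (𝟙 (above? p v) * (sumW R B λ μ → strip i μ λs * right i v μ))))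
      ≡⟨ sumTo-cong (suc l) pull ⟩
    sumTo (suc l) (λ i → 𝟙 (l ≤? c) * (sumW R B λ μ → strip i μ λs * sumInc i n λ v → 𝟙 (above? p v) * right i v μ))
      ≡⟨ sumTo-exchange (suc l) B exchange ⟩
    sumTo B (λ i → sumW R B λ μ → strip c (i ∷ μ) (l ∷ λs) * sumInc i n λ v → 𝟙 (above? p v) * right i v μ)
      ≡⟨ sym (sumW-suc R B _) ⟩
    Removed c p (l ∷ λs) φ ∎
    where
    open ≡-Reasoning
    R : ℕ
    R = length λs
    left : ℕ → List ℕ → ℕ
    left i u = 𝟙 (above? q u) * sumSSYT u λs (suc n) λ w → φ (occurrences n (u ++ w)) (below n (u ++ w))
    right : ℕ → List ℕ → List ℕ → ℕ
    right i v μ = sumSSYT v μ n λ w → φ ((l ∸ i) + deficit λs μ) (v ++ w)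
    pointwise : ∀ i v → i ≤ l → length v ≡ i → All (_< n) v → left i (v ++ replicate (l ∸ i) n) ≡
      𝟙 (l ≤? c) * (𝟙 (above? p v) * (sumW R B λ μ → strip i μ λs * right i v μ))
    pointwise i v i≤l refl v<n = trans
      (cong₂ _*_ (cut v (l ∸ i) v<n (m+[n∸m]≡n i≤l)) (trans
        (sumSSYT-cong (v ++ replicate (l ∸ i) n) λs (suc n) λ w → cong₂ φ (occurrences-largest n v (l ∸ i) w v<n) (below-largest n v (l ∸ i) w v<n))
        (sumSSYT-largest v (l ∸ i) λs (λ o w → φ ((l ∸ i) + o) (v ++ w)) v<n
          (subst (λ k → Linked _≥_ (k ∷ λs)) (sym (m+[n∸m]≡n i≤l)) link) λ<B)))
      (*-assoc (𝟙 (l ≤? c)) _ _)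
    pull : ∀ i → sumInc i n (λ v → 𝟙 (l ≤? c) * (𝟙 (above? p v) * (sumW R B λ μ → strip i μ λs * right i v μ))) ≡
                 𝟙 (l ≤? c) * (sumW R B λ μ → strip i μ λs * sumInc i n λ v → 𝟙 (above? p v) * right i v μ)
    pull i = trans (sumInc-*ˡ i n (𝟙 (l ≤? c)) _) (cong (𝟙 (l ≤? c) *_) (trans
      (sumInc-cong i n λ v → trans (sym (sumW-*ˡ R B (𝟙 (above? p v)) _))
        (sumW-cong R B λ μ → *-swapˡ (𝟙 (above? p v)) (strip i μ λs) _))
      (trans (sumInc-sumW i n R B λ v μ → strip i μ λs * (𝟙 (above? p v) * right i v μ))
             (sumW-cong R B λ μ → sumInc-*ˡ i n (strip i μ λs) _))))
    exchange : ∀ i → 𝟙 (i <? suc l) * (𝟙 (l ≤? c) * (sumW R B λ μ → strip i μ λs * sumInc i n λ v → 𝟙 (above? p v) * right i v μ)) ≡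
      𝟙 (i <? B) * (sumW R B λ μ → strip c (i ∷ μ) (l ∷ λs) * sumInc i n λ v → 𝟙 (above? p v) * right i v μ)
    exchange i = begin
      𝟙 (i <? suc l) * (𝟙 (l ≤? c) * X)
        ≡⟨ cong (_* (𝟙 (l ≤? c) * X)) (trans
             (𝟙-cong (i <? suc l) ((i <? B) ×-dec (i ≤? l)) (λ i≤l → ≤-trans i≤l l<B , s≤s⁻¹ i≤l) (λ (_ , i≤l) → s≤s i≤l))
             (𝟙-× (i <? B) (i ≤? l))) ⟩
      𝟙 (i <? B) * 𝟙 (i ≤? l) * (𝟙 (l ≤? c) * X)
        ≡⟨ trans (*-assoc (𝟙 (i <? B)) _ _) (cong (𝟙 (i <? B) *_) (trans
             (sym (*-assoc (𝟙 (i ≤? l)) _ X))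
             (trans (sym (sumW-*ˡ R B (𝟙 (i ≤? l) * 𝟙 (l ≤? c)) _))
               (sumW-cong R B λ μ → regroup (𝟙 (i ≤? l)) (𝟙 (l ≤? c)) (strip i μ λs) _)))) ⟩
      𝟙 (i <? B) * (sumW R B λ μ → strip c (i ∷ μ) (l ∷ λs) * sumInc i n λ v → 𝟙 (above? p v) * right i v μ) ∎
      where
      X : ℕ
      X = sumW R B λ μ → strip i μ λs * sumInc i n λ v → 𝟙 (above? p v) * right i v μ
      regroup : ∀ a b s y → a * b * (s * y) ≡ a * (b * s) * y
      regroup = solve-∀

strip-deficit : ∀ c μ λs → strip c μ λs ≢ 0 → deficit λs μ + total μ ≡ total λs
strip-deficit c []      []       _  = refl
strip-deficit c []      (_ ∷ _)  nz = contradiction refl nz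
strip-deficit c (_ ∷ _) []       nz = contradiction refl nz
strip-deficit c (x ∷ μ) (y ∷ λs) nz with x ≤? y
... | no x≰y  = contradiction (𝟙-no* (x ≤? y) x≰y) nz
... | yes x≤y = begin
  (y ∸ x) + deficit λs μ + (x + total μ)    ≡⟨ +-interchange (y ∸ x) _ x _ ⟩
  (y ∸ x) + x + (deficit λs μ + total μ)
    ≡⟨ cong₂ _+_ (m∸n+n≡m x≤y) (strip-deficit x μ λs λ z → nz (trans
         (cong (λ s → 𝟙 (x ≤? y) * (𝟙 (y ≤? c) * s)) z)
         (trans (cong (𝟙 (x ≤? y) *_) (*-zeroʳ (𝟙 (y ≤? c)))) (*-zeroʳ (𝟙 (x ≤? y)))))) ⟩
  y + total λs ∎
  where open ≡-Reasoning

𝟙-content-below : ∀ n w β a → 𝟙 (content (suc n) w ≟ᴸ β ∷ʳ a) ≡ 𝟙 (occurrences n w ≟ a) * 𝟙 (content n (below n w) ≟ᴸ β)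
𝟙-content-below n w β a = trans
  (cong (λ c → 𝟙 (c ≟ᴸ β ∷ʳ a)) (trans (content-suc n w) (cong (_∷ʳ occurrences n w)
    (content-cong n w (below n w) λ i i<n → sym (occurrences-below i i<n w)))))
  (𝟙-∷ʳ (content n (below n w)) β (occurrences n w) a)
  where
  occurrences-below : ∀ i → i < n → ∀ w → occurrences i (below n w) ≡ occurrences i w
  occurrences-below i i<n []      = refl
  occurrences-below i i<n (x ∷ w) with x <? n
  ... | yes x<n = trans (cong (occurrences i) (filter-accept (_<? n) x<n))
                   (trans (occurrences-∷ i x (below n w)) (trans (cong (𝟙 (x ≟ i) +_) (occurrences-below i i<n w)) (sym (occurrences-∷ i x w))))
  ... | no x≮n  = trans (cong (occurrences i) (filter-reject (_<? n) x≮n))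
                   (trans (occurrences-below i i<n w) (sym (trans (occurrences-∷ i x w) (cong (_+ occurrences i w) (𝟙-no (x ≟ i) λ { refl → x≮n i<n })))))

nonzero-cong : ∀ s {m n : ℕ} → (s ≢ 0 → m ≡ n) → s * m ≡ s * n
nonzero-cong zero    e = refl
nonzero-cong (suc s) e = cong (suc s *_) (e λ ())

-- The cells with the largest letter form a horizontal strip of size `a`, and the others a tableau
-- of the smaller shape in one variable less.
kostka-branch : ∀ c B λs β a → Linked _≥_ λs → All (_< B) λs → All (_≤ c) λs →
  kostka λs (β ∷ʳ a) ≡ sumW (length λs) B λ μ → strip c μ λs * (𝟙 (a + total μ ≟ total λs) * kostka μ β)
kostka-branch c B λs β a link λ<B λ≤c = begin
  kostka λs (β ∷ʳ a)
    ≡⟨ cong (λ k → sumSSYT [] λs k λ w → 𝟙 (content k w ≟ᴸ β ∷ʳ a)) (length-∷ʳ β a) ⟩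
  sumSSYT [] λs (suc n) (λ w → 𝟙 (content (suc n) w ≟ᴸ β ∷ʳ a))
    ≡⟨ sumSSYT-cong [] λs (suc n) (λ w → 𝟙-content-below n w β a) ⟩
  sumSSYT [] λs (suc n) (λ w → φ (occurrences n w) (below n w))
    ≡⟨ top λs link λ<B λ≤c ⟩
  sumW (length λs) B (λ μ → strip c μ λs * sumSSYT [] μ n (φ (deficit λs μ)))
    ≡⟨ (sumW-cong (length λs) B λ μ → nonzero-cong (strip c μ λs) λ nz → trans
         (sumSSYT-*ˡ [] μ n (𝟙 (deficit λs μ ≟ a)) _)
         (cong (_* kostka μ β) (𝟙-cong (deficit λs μ ≟ a) (a + total μ ≟ total λs)
           (λ e → trans (cong (_+ total μ) (sym e)) (strip-deficit c μ λs nz))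
           (λ e → +-cancelʳ-≡ (total μ) _ _ (trans (strip-deficit c μ λs nz) (sym e)))))) ⟩
  sumW (length λs) B (λ μ → strip c μ λs * (𝟙 (a + total μ ≟ total λs) * kostka μ β)) ∎
  where
  open ≡-Reasoning
  n : ℕ
  n = length β
  φ : ℕ → List ℕ → ℕ
  φ o w = 𝟙 (o ≟ a) * 𝟙 (content n w ≟ᴸ β)
  top : ∀ λs → Linked _≥_ λs → All (_< B) λs → All (_≤ c) λs →
    sumSSYT [] λs (suc n) (λ w → φ (occurrences n w) (below n w)) ≡
    sumW (length λs) B (λ μ → strip c μ λs * sumSSYT [] μ n (φ (deficit λs μ)))
  top []       _    _   _          = sym (trans (sumW-zero B _) (*-identityˡ _))
  -- No row lies above the first one, so both sides of the required equation are 1; on the right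
  -- because `l ≤ c`.
  top (l ∷ λs) link λ<B (l≤c ∷ _) = sumSSYT-largest-step n B c [] [] l λs φ link λ<B
    λ v j _ _ → sym (trans (*-identityʳ _) (𝟙-yes (l ≤? c) l≤c))

kostka-[] : ∀ λs → kostka λs [] ≡ 𝟙 (total λs ≟ 0)
kostka-[] []             = refl
kostka-[] (zero ∷ λs)    = trans (sumInc-zero 0 _) (trans (*-identityˡ _) (kostka-[] λs))
kostka-[] (suc l ∷ λs) = trans (sumInc-def (suc l) 0 _) (trans (sumW-suc l 0 _) (sumTo-zero _))

-- Pieri's rule

*-nonzero : ∀ m n → m * n ≢ 0 → m ≢ 0 × n ≢ 0
*-nonzero m n nz = (λ { refl → nz refl }) , λ { refl → nz (*-zeroʳ m) }

𝟙-nonzero : ∀ {P : Set} (p : Dec P) → 𝟙 p ≢ 0 → P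
𝟙-nonzero (yes p) _  = p
𝟙-nonzero (no _)  nz = contradiction refl nz

strip-∷ : ∀ c x κ y μ → strip c (x ∷ κ) (y ∷ μ) ≢ 0 → x ≤ y × y ≤ c × strip x κ μ ≢ 0
strip-∷ c x κ y μ nz =
  let a , b  = *-nonzero (𝟙 (x ≤? y)) _ nz
      b , s  = *-nonzero (𝟙 (y ≤? c)) _ b
  in 𝟙-nonzero (x ≤? y) a , 𝟙-nonzero (y ≤? c) b , s

strip-linked-lower : ∀ c κ μ → strip c κ μ ≢ 0 → Linked _≥_ κ
strip-linked-lower c []           μ            nz = []
strip-linked-lower c (x ∷ [])     μ            nz = [-]
strip-linked-lower c (x ∷ x′ ∷ κ) []           nz = contradiction refl nz
strip-linked-lower c (x ∷ x′ ∷ κ) (y ∷ [])     nz =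
  contradiction refl (proj₂ (proj₂ (strip-∷ c x (x′ ∷ κ) y [] nz)))
strip-linked-lower c (x ∷ x′ ∷ κ) (y ∷ y′ ∷ μ) nz =
  let _ , _ , nz′    = strip-∷ c x (x′ ∷ κ) y (y′ ∷ μ) nz
      x′≤y′ , y′≤x , _ = strip-∷ x x′ κ y′ μ nz′
  in ≤-trans x′≤y′ y′≤x ∷ strip-linked-lower x (x′ ∷ κ) (y′ ∷ μ) nz′

strip-linked-upper : ∀ c κ μ → strip c κ μ ≢ 0 → Linked _≥_ μ
strip-linked-upper c κ            []           nz = []
strip-linked-upper c κ            (y ∷ [])     nz = [-]
strip-linked-upper c []           (y ∷ y′ ∷ μ) nz = contradiction refl nz
strip-linked-upper c (x ∷ [])     (y ∷ y′ ∷ μ) nz =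
  contradiction refl (proj₂ (proj₂ (strip-∷ c x [] y (y′ ∷ μ) nz)))
strip-linked-upper c (x ∷ x′ ∷ κ) (y ∷ y′ ∷ μ) nz =
  let x≤y , _ , nz′ = strip-∷ c x (x′ ∷ κ) y (y′ ∷ μ) nz
      _ , y′≤x , _  = strip-∷ x x′ κ y′ μ nz′
  in ≤-trans y′≤x x≤y ∷ strip-linked-upper x (x′ ∷ κ) (y′ ∷ μ) nz′

strip-total : ∀ c κ μ → strip c κ μ ≢ 0 → total κ ≤ total μ
strip-total c κ μ nz = subst (total κ ≤_) (strip-deficit c κ μ nz) (m≤n+m (total κ) _)

-- The number of rows is fixed, with zero rows at the end. A horizontal strip can start at most one
-- new row, so one zero row leaves enough room to add any strip.
LastZero : List ℕ → Set
LastZero []           = ⊥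
LastZero (x ∷ [])     = x ≡ 0
LastZero (x ∷ y ∷ xs) = LastZero (y ∷ xs)

strip-lastZero : ∀ c κ μ → strip c κ μ ≢ 0 → LastZero μ → LastZero κ
strip-lastZero c []           (y ∷ μ)       nz z = nz refl
strip-lastZero c (x ∷ [])     (y ∷ [])      nz z = n≤0⇒n≡0 (subst (x ≤_) z (proj₁ (strip-∷ c x [] y [] nz)))
strip-lastZero c (x ∷ x′ ∷ κ) (y ∷ [])      nz z =
  contradiction refl (proj₂ (proj₂ (strip-∷ c x (x′ ∷ κ) y [] nz)))
strip-lastZero c (x ∷ [])     (y ∷ y′ ∷ μ) nz z =
  contradiction refl (proj₂ (proj₂ (strip-∷ c x [] y (y′ ∷ μ) nz)))
strip-lastZero c (x ∷ x′ ∷ κ) (y ∷ y′ ∷ μ) nz z =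
  strip-lastZero x (x′ ∷ κ) (y′ ∷ μ) (proj₂ (proj₂ (strip-∷ c x (x′ ∷ κ) y (y′ ∷ μ) nz))) z

-- Commuting the addition and the removal of horizontal strips

sumTo-shift : ∀ m k f → sumTo (m + k) f ≡ sumTo m f + sumTo k (λ i → f (m + i))
sumTo-shift zero    k f = cong (_+ sumTo k f) (sym (sumTo-zero f))
sumTo-shift (suc m) k f = begin
  sumTo (suc (m + k)) f                                                 ≡⟨ sumTo-suc (m + k) f ⟩
  f 0 + sumTo (m + k) (f ∘ suc)                                         ≡⟨ cong (f 0 +_) (sumTo-shift m k (f ∘ suc)) ⟩
  f 0 + (sumTo m (f ∘ suc) + sumTo k (λ i → f (suc m + i)))             ≡⟨ sym (+-assoc (f 0) _ _) ⟩
  f 0 + sumTo m (f ∘ suc) + sumTo k (λ i → f (suc m + i))               ≡⟨ cong (_+ sumTo k (λ i → f (suc m + i))) (sym (sumTo-suc m f)) ⟩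
  sumTo (suc m) f + sumTo k (λ i → f (suc m + i))                       ∎
  where open ≡-Reasoning

within : ℕ → ℕ → ℕ → ℕ
within M m y = 𝟙 (M ≤? y) * 𝟙 (y ≤? m)

sumTo-within : ∀ B M d (g : ℕ → ℕ) → M + d < B → sumTo B (λ y → within M (M + d) y * g y) ≡ sumTo (suc d) (λ z → g (M + z))
sumTo-within B M d g M+d<B = begin
  sumTo B (λ y → within M (M + d) y * g y)
    ≡⟨ sumTo-exchange B (M + suc d) exchange ⟩
  sumTo (M + suc d) (λ y → 𝟙 (M ≤? y) * g y)
    ≡⟨ sumTo-shift M (suc d) _ ⟩
  sumTo M (λ y → 𝟙 (M ≤? y) * g y) + sumTo (suc d) (λ z → 𝟙 (M ≤? M + z) * g (M + z))
    ≡⟨ cong₂ _+_ (sumTo-zeroᵇ M λ y y<M → 𝟙-no* (M ≤? y) (<⇒≱ y<M))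
         (sumTo-cong (suc d) λ z → 𝟙-yes* (M ≤? M + z) (m≤m+n M z)) ⟩
  sumTo (suc d) (λ z → g (M + z)) ∎
  where
  open ≡-Reasoning
  exchange : ∀ y → 𝟙 (y <? B) * (within M (M + d) y * g y) ≡ 𝟙 (y <? M + suc d) * (𝟙 (M ≤? y) * g y)
  exchange y = begin
    𝟙 (y <? B) * (within M (M + d) y * g y)
      ≡⟨ regroup (𝟙 (y <? B)) (𝟙 (M ≤? y)) (𝟙 (y ≤? M + d)) (g y) ⟩
    𝟙 (y <? B) * 𝟙 (y ≤? M + d) * (𝟙 (M ≤? y) * g y)
      ≡⟨ cong (_* (𝟙 (M ≤? y) * g y)) (trans (sym (𝟙-× (y <? B) (y ≤? M + d)))
           (𝟙-cong ((y <? B) ×-dec (y ≤? M + d)) (y <? M + suc d)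
             (λ (_ , y≤) → subst (y <_) (sym (+-suc M d)) (s≤s y≤))
             (λ y< → let y≤ = s≤s⁻¹ (subst (y <_) (+-suc M d) y<) in ≤-<-trans y≤ M+d<B , y≤))) ⟩
    𝟙 (y <? M + suc d) * (𝟙 (M ≤? y) * g y) ∎
    where
    regroup : ∀ a b c d → a * (b * c * d) ≡ a * c * (b * d)
    regroup = solve-∀

sumTo-reflect : ∀ B M m (g : ℕ → ℕ) → m < B →
  sumTo B (λ y → within M m y * g y) ≡ sumTo B (λ x → within M m x * g (M + m ∸ x))
sumTo-reflect B M m g m<B with M ≤? m
... | no M≰m  = trans (vanish g) (sym (vanish (λ x → g (M + m ∸ x))))
  where
  vanish : ∀ f → sumTo B (λ y → within M m y * f y) ≡ 0
  vanish f = sumTo-zeroᵇ B λ y _ → cong (_* f y) (trans (sym (𝟙-× (M ≤? y) (y ≤? m)))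
    (𝟙-no ((M ≤? y) ×-dec (y ≤? m)) λ (M≤y , y≤m) → M≰m (≤-trans M≤y y≤m)))
... | yes M≤m = subst (λ m → m < B → sumTo B (λ y → within M m y * g y) ≡ sumTo B (λ x → within M m x * g (M + m ∸ x)))
                      (m+[n∸m]≡n M≤m) (nonempty (m ∸ M)) m<B
  where
  nonempty : ∀ d → M + d < B → sumTo B (λ y → within M (M + d) y * g y) ≡
                               sumTo B (λ x → within M (M + d) x * g (M + (M + d) ∸ x))
  nonempty d b = begin
    sumTo B (λ y → within M (M + d) y * g y)                       ≡⟨ sumTo-within B M d g b ⟩
    sumTo (suc d) (λ z → g (M + z))                                ≡⟨ sumTo-reverse d (λ z → g (M + z)) ⟩
    sumTo (suc d) (λ z → g (M + (d ∸ z)))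
      ≡⟨ (sumTo-congᵇ (suc d) λ z z≤d → cong g (trans (sym (+-∸-assoc M (s≤s⁻¹ z≤d))) (sym ([m+n]∸[m+o]≡n∸o M (M + d) z)))) ⟩
    sumTo (suc d) (λ z → g (M + (M + d) ∸ (M + z)))                ≡⟨ sym (sumTo-within B M d (λ x → g (M + (M + d) ∸ x)) b) ⟩
    sumTo B (λ x → within M (M + d) x * g (M + (M + d) ∸ x))       ∎
    where open ≡-Reasoning

⊔+⊓ : ∀ m n → (m ⊔ n) + (m ⊓ n) ≡ m + n
⊔+⊓ m n with ≤-total m n
... | inj₁ m≤n = trans (cong₂ _+_ (m≤n⇒m⊔n≡n m≤n) (m≤n⇒m⊓n≡m m≤n)) (+-comm n m)
... | inj₂ n≤m = cong₂ _+_ (m≥n⇒m⊔n≡m n≤m) (m≥n⇒m⊓n≡n n≤m)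

module _ (B : ℕ) where

  private
    -- Sums over the μ obtained from λs and ν, and over the κ from which λs and ν
    -- are obtained, by adding horizontal strips; the rows preceding those of λs and
    -- ν have lengths l and n.  Both μ and κ range over the same product of intervals,
    -- so that reflecting each interval exchanges the two sums.
    sumUpper : ℕ → ℕ → List ℕ → List ℕ → (ℕ → ℕ) → ℕ
    sumUpper l n λs ν f = sumW (length λs) B λ μ → strip l λs μ * strip n ν μ * f (total μ)

    sumLower : ℕ → ℕ → List ℕ → List ℕ → (ℕ → ℕ) → ℕ
    sumLower l n λs ν f = sumTo B λ x → sumW (length λs) B λ κ →
      𝟙 (x ≤? l) * 𝟙 (x ≤? n) * (strip x κ λs * strip x κ ν) * f (x + total κ)

  -- A row of μ and the preceding row of κ both range from `M` to `m`, and reflected values add up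
  -- to `M + m`. Over all rows the maxima and minima add up to `(l ⊓ n) + total λs + total ν`, which
  -- translates the condition on `total μ` into one on `total κ`. `LastZero` forces the last row of
  -- κ to be zero, so no interval is left over. `y` accumulates the rows of μ already fixed.
  reflection : ∀ l n λs ν y s → LastZero (l ∷ λs) → length λs ≡ length ν → l < B →
    sumUpper l n λs ν (λ t → 𝟙 (y + t ≟ s)) ≡
    sumLower l n λs ν (λ t → 𝟙 (y + ((l ⊓ n) + total λs + total ν) ≟ s + t))
  reflection l n [] [] y s refl _ l<B = begin
    sumW 0 B (λ μ → strip 0 [] μ * strip n [] μ * 𝟙 (y + total μ ≟ s))
      ≡⟨ trans (sumW-zero B _) (*-identityˡ _) ⟩
    𝟙 (y + 0 ≟ s)
      ≡⟨ 𝟙-cong (y + 0 ≟ s) (y + 0 ≟ s + 0) (λ e → trans e (sym (+-identityʳ s))) (λ e → trans e (+-identityʳ s)) ⟩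
    𝟙 (y + 0 ≟ s + 0)
      ≡⟨ sym (*-identityˡ _) ⟩
    1 * 𝟙 (y + 0 ≟ s + 0)
      ≡⟨ sym (trans (sumTo-single B _ 0 l<B (λ x _ x≢0 → trans (sumW-zero B _)
           (cong (λ z → z * 𝟙 (x ≤? n) * 1 * 𝟙 (y + 0 ≟ s + (x + 0))) (𝟙-no (x ≤? 0) λ x≤0 → x≢0 (n≤0⇒n≡0 x≤0)))))
           (sumW-zero B _)) ⟩
    sumLower 0 n [] [] (λ t → 𝟙 (y + 0 ≟ s + t)) ∎
    where open ≡-Reasoning
  reflection l n (l′ ∷ λs) (n′ ∷ ν) y s z e l<B = begin
    sumUpper l n (l′ ∷ λs) (n′ ∷ ν) (λ t → 𝟙 (y + t ≟ s))
      ≡⟨ sumW-suc R B _ ⟩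
    sumTo B (λ v → sumW R B λ μ → strip l (l′ ∷ λs) (v ∷ μ) * strip n (n′ ∷ ν) (v ∷ μ) * 𝟙 (y + (v + total μ) ≟ s))
      ≡⟨ sumTo-cong B upper ⟩
    sumTo B (λ v → within M m v * sumUpper l′ n′ λs ν (λ t → 𝟙 (y + v + t ≟ s)))
      ≡⟨ sumTo-congᵇ B lower ⟩
    sumTo B (λ v → within M m v * G v)
      ≡⟨ sumTo-reflect B M m G (≤-<-trans (m⊓n≤m l n) l<B) ⟩
    sumTo B (λ x → within M m x * G (M + m ∸ x))
      ≡⟨ sumTo-cong B final ⟩
    sumLower l n (l′ ∷ λs) (n′ ∷ ν) (λ t → 𝟙 (y + ((l ⊓ n) + total (l′ ∷ λs) + total (n′ ∷ ν)) ≟ s + t)) ∎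
    where
    open ≡-Reasoning
    R M m : ℕ
    R = length λs
    M = l′ ⊔ n′
    m = l ⊓ n
    G : ℕ → ℕ
    G v = sumLower l′ n′ λs ν (λ t → 𝟙 (y + v + ((l′ ⊓ n′) + total λs + total ν) ≟ s + t))
    𝟙-within : ∀ v → 𝟙 (l′ ≤? v) * 𝟙 (v ≤? l) * (𝟙 (n′ ≤? v) * 𝟙 (v ≤? n)) ≡ within M m v
    𝟙-within v = trans (cong₂ _*_ (sym (𝟙-× (l′ ≤? v) (v ≤? l))) (sym (𝟙-× (n′ ≤? v) (v ≤? n)))) (trans
      (sym (𝟙-× ((l′ ≤? v) ×-dec (v ≤? l)) ((n′ ≤? v) ×-dec (v ≤? n))))
      (trans (𝟙-cong (((l′ ≤? v) ×-dec (v ≤? l)) ×-dec ((n′ ≤? v) ×-dec (v ≤? n))) ((M ≤? v) ×-dec (v ≤? m))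
        (λ ((a , b) , (c , d)) → ⊔-lub a c , ⊓-glb b d)
        (λ (M≤v , v≤m) → (m⊔n≤o⇒m≤o l′ n′ M≤v , m≤n⊓o⇒m≤n l n v≤m) , (m⊔n≤o⇒n≤o l′ n′ M≤v , m≤n⊓o⇒m≤o l n v≤m)))
      (𝟙-× (M ≤? v) (v ≤? m))))
    upper : ∀ v → sumW R B (λ μ → strip l (l′ ∷ λs) (v ∷ μ) * strip n (n′ ∷ ν) (v ∷ μ) * 𝟙 (y + (v + total μ) ≟ s)) ≡
                  within M m v * sumUpper l′ n′ λs ν (λ t → 𝟙 (y + v + t ≟ s))
    upper v = trans
      (sumW-cong R B λ μ → trans
        (regroup (𝟙 (l′ ≤? v)) (𝟙 (v ≤? l)) (strip l′ λs μ) (𝟙 (n′ ≤? v)) (𝟙 (v ≤? n)) (strip n′ ν μ) _)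
        (cong₂ (λ a b → a * (strip l′ λs μ * strip n′ ν μ * 𝟙 (b ≟ s))) (𝟙-within v) (sym (+-assoc y v (total μ)))))
      (sumW-*ˡ R B (within M m v) _)
      where
      regroup : ∀ a b c d e f g → a * (b * c) * (d * (e * f)) * g ≡ a * b * (d * e) * (c * f * g)
      regroup = solve-∀
    lower : ∀ v → v < B → within M m v * sumUpper l′ n′ λs ν (λ t → 𝟙 (y + v + t ≟ s)) ≡ within M m v * G v
    lower v v<B = nonzero-cong (within M m v) λ nz →
      reflection l′ n′ λs ν (y + v) s z (suc-injective e)
        (≤-<-trans (≤-trans (m≤m⊔n l′ n′) (𝟙-nonzero (M ≤? v) (proj₁ (*-nonzero (𝟙 (M ≤? v)) _ nz)))) v<B)
    final : ∀ x → within M m x * G (M + m ∸ x) ≡ sumW (suc R) B λ κ →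
      𝟙 (x ≤? l) * 𝟙 (x ≤? n) * (strip x κ (l′ ∷ λs) * strip x κ (n′ ∷ ν)) *
      𝟙 (y + (m + total (l′ ∷ λs) + total (n′ ∷ ν)) ≟ s + (x + total κ))
    final x = sym (begin
      sumW (suc R) B (λ κ → 𝟙 (x ≤? l) * 𝟙 (x ≤? n) * (strip x κ (l′ ∷ λs) * strip x κ (n′ ∷ ν)) * 𝟙 (Y ≟ s + (x + total κ)))
        ≡⟨ sumW-suc R B _ ⟩
      sumTo B (λ x′ → sumW R B λ κ → 𝟙 (x ≤? l) * 𝟙 (x ≤? n) *
        (strip x (x′ ∷ κ) (l′ ∷ λs) * strip x (x′ ∷ κ) (n′ ∷ ν)) * 𝟙 (Y ≟ s + (x + (x′ + total κ))))
        ≡⟨ (sumTo-cong B λ x′ → trans (sumW-cong R B λ κ → pointwise x′ κ) (sumW-*ˡ R B (within M m x) _)) ⟩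
      sumTo B (λ x′ → within M m x * sumW R B λ κ → W x′ κ * 𝟙 (y + (M + m ∸ x) + X ≟ s + (x′ + total κ)))
        ≡⟨ sumTo-*ˡ B (within M m x) _ ⟩
      within M m x * G (M + m ∸ x) ∎)
      where
      X Y : ℕ
      X = (l′ ⊓ n′) + total λs + total ν
      Y = y + (m + total (l′ ∷ λs) + total (n′ ∷ ν))
      W : ℕ → List ℕ → ℕ
      W x′ κ = 𝟙 (x′ ≤? l′) * 𝟙 (x′ ≤? n′) * (strip x′ κ λs * strip x′ κ ν)
      regroup : ∀ a b c d e f g h i → a * b * (c * (d * e) * (f * (g * h))) * i ≡ d * a * (g * b) * (c * f * (e * h) * i)
      regroup = solve-∀
      assemble : ∀ y A x k t u → y + (A + x + k + t + u) ≡ y + A + (k + t + u) + x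
      assemble = solve-∀
      disassemble : ∀ m l t n u → m + (l + t) + (n + u) ≡ (n + l) + m + t + u
      disassemble = solve-∀
      reorder : ∀ M k m t u → (M + k) + m + t + u ≡ M + m + k + t + u
      reorder = solve-∀
      shift : x ≤ m → Y ≡ y + (M + m ∸ x) + X + x
      shift x≤m = trans (cong (y +_) (begin
        m + (l′ + total λs) + (n′ + total ν)       ≡⟨ disassemble m l′ (total λs) n′ (total ν) ⟩
        n′ + l′ + m + total λs + total ν           ≡⟨ cong (λ z → z + m + total λs + total ν) (trans (+-comm n′ l′) (sym (⊔+⊓ l′ n′))) ⟩
        M + (l′ ⊓ n′) + m + total λs + total ν     ≡⟨ reorder M (l′ ⊓ n′) m (total λs) (total ν) ⟩
        M + m + (l′ ⊓ n′) + total λs + total ν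
          ≡⟨ cong (λ z → z + (l′ ⊓ n′) + total λs + total ν) (sym (m∸n+n≡m (≤-trans x≤m (m≤n+m m M)))) ⟩
        (M + m ∸ x) + x + (l′ ⊓ n′) + total λs + total ν ∎))
        (assemble y (M + m ∸ x) x (l′ ⊓ n′) (total λs) (total ν))
      pointwise : ∀ x′ κ → 𝟙 (x ≤? l) * 𝟙 (x ≤? n) * (strip x (x′ ∷ κ) (l′ ∷ λs) * strip x (x′ ∷ κ) (n′ ∷ ν)) *
        𝟙 (Y ≟ s + (x + (x′ + total κ))) ≡ within M m x * (W x′ κ * 𝟙 (y + (M + m ∸ x) + X ≟ s + (x′ + total κ)))
      pointwise x′ κ = trans
        (trans (regroup (𝟙 (x ≤? l)) (𝟙 (x ≤? n)) (𝟙 (x′ ≤? l′)) (𝟙 (l′ ≤? x)) (strip x′ κ λs) (𝟙 (x′ ≤? n′)) (𝟙 (n′ ≤? x)) (strip x′ κ ν) _)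
               (cong (_* (W x′ κ * 𝟙 (Y ≟ s + (x + (x′ + total κ))))) (𝟙-within x)))
        (nonzero-cong (within M m x) λ nz → cong (W x′ κ *_) (
          let x≤m = 𝟙-nonzero (x ≤? m) (proj₂ (*-nonzero (𝟙 (M ≤? x)) _ nz))
              right = trans (cong (s +_) (+-comm x (x′ + total κ))) (sym (+-assoc s (x′ + total κ) x))
          in 𝟙-cong (Y ≟ s + (x + (x′ + total κ))) (y + (M + m ∸ x) + X ≟ s + (x′ + total κ))
            (λ e → +-cancelʳ-≡ x _ _ (trans (sym (shift x≤m)) (trans e right)))
            (λ e → trans (shift x≤m) (trans (cong (_+ x) e) (sym right)))))

⊔+⊓-total : ∀ l n t u → (l ⊔ n) + ((l ⊓ n) + t + u) ≡ (l + t) + (n + u)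
⊔+⊓-total l n t u = trans (assoc (l ⊔ n) (l ⊓ n) t u) (trans (cong (λ z → z + t + u) (⊔+⊓ l n)) (regroup l n t u))
  where
  assoc : ∀ a b t u → a + (b + t + u) ≡ a + b + t + u
  assoc = solve-∀
  regroup : ∀ l n t u → l + n + t + u ≡ (l + t) + (n + u)
  regroup = solve-∀

total-≥ : ∀ λs → All (_≤ total λs) λs
total-≥ []       = []
total-≥ (l ∷ λs) = m≤m+n l _ ∷ All.map (λ x≤ → ≤-trans x≤ (m≤n+m _ l)) (total-≥ λs)

module _ (c : ℕ) where

  private
    B : ℕ
    B = suc c

  -- The coefficient of ν in the identity D_a U_m = Σ_j U_(m-j) D_(a-j), applied to λs,
  -- where U_m adds and D_a removes a horizontal strip of the given size.
  commutation : ∀ λs ν m a → LastZero λs → length λs ≡ length ν → All (_≤ c) λs → All (_≤ c) ν →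
    total λs + m ≡ a + total ν → total λs + m + total λs ≤ c →
    sumW (length λs) B (λ μ → strip c λs μ * strip c ν μ * 𝟙 (total μ ≟ total λs + m)) ≡
    sumW (length λs) B (λ κ → strip c κ λs * strip c κ ν * 𝟙 (total λs ≤? total κ + a))
  commutation (l ∷ λs) (n ∷ ν) m a z e (l≤c ∷ λ≤c) (n≤c ∷ ν≤c) size bound = begin
    sumW (suc R) B (λ μ → strip c (l ∷ λs) μ * strip c (n ∷ ν) μ * 𝟙 (total μ ≟ S))
      ≡⟨ sumW-suc R B _ ⟩
    sumTo B (λ y → sumW R B λ μ → strip c (l ∷ λs) (y ∷ μ) * strip c (n ∷ ν) (y ∷ μ) * 𝟙 (y + total μ ≟ S))
      ≡⟨ (sumTo-congᵇ B λ y y≤c → trans (sumW-cong R B λ μ → upper y μ (s≤s⁻¹ y≤c)) (sumW-*ˡ R B (𝟙 (l ⊔ n ≤? y)) _)) ⟩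
    sumTo B (λ y → 𝟙 (l ⊔ n ≤? y) * sumW R B λ μ → strip l λs μ * strip n ν μ * 𝟙 (y + total μ ≟ S))
      ≡⟨ sumTo-cong B (λ y → cong (𝟙 (l ⊔ n ≤? y) *_) (reflection B l n λs ν y S z (suc-injective e) (s≤s l≤c))) ⟩
    sumTo B (λ y → 𝟙 (l ⊔ n ≤? y) * sumTo B λ x → sumW R B λ κ → W x κ * 𝟙 (y + N ≟ S + (x + total κ)))
      ≡⟨ (sumTo-cong B λ y → trans (sym (sumTo-*ˡ B (𝟙 (l ⊔ n ≤? y)) _)) (sumTo-cong B λ x →
           trans (sym (sumW-*ˡ R B (𝟙 (l ⊔ n ≤? y)) _)) (sumW-cong R B λ κ → *-swapˡ (𝟙 (l ⊔ n ≤? y)) (W x κ) _))) ⟩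
    sumTo B (λ y → sumTo B λ x → sumW R B λ κ → W x κ * (𝟙 (l ⊔ n ≤? y) * 𝟙 (y + N ≟ S + (x + total κ))))
      ≡⟨ trans (sumTo-swap B B _) (sumTo-cong B λ x → trans (sym (sumW-sumTo R B B _)) (sumW-cong R B λ κ → sumTo-*ˡ B (W x κ) _)) ⟩
    sumTo B (λ x → sumW R B λ κ → W x κ * sumTo B λ y → 𝟙 (l ⊔ n ≤? y) * 𝟙 (y + N ≟ S + (x + total κ)))
      ≡⟨ (sumTo-cong B λ x → sumW-cong R B λ κ → trans (nonzero-cong (W x κ) (first-row x κ)) (lower x κ)) ⟩
    sumTo B (λ x → sumW R B λ κ → strip c (x ∷ κ) (l ∷ λs) * strip c (x ∷ κ) (n ∷ ν) * 𝟙 (l + total λs ≤? (x + total κ) + a))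
      ≡⟨ sym (sumW-suc R B _) ⟩
    sumW (suc R) B (λ κ → strip c κ (l ∷ λs) * strip c κ (n ∷ ν) * 𝟙 (l + total λs ≤? total κ + a)) ∎
    where
    open ≡-Reasoning
    R S N : ℕ
    R = length λs
    S = l + total λs + m
    N = (l ⊓ n) + total λs + total ν
    W : ℕ → List ℕ → ℕ
    W x κ = 𝟙 (x ≤? l) * 𝟙 (x ≤? n) * (strip x κ λs * strip x κ ν)
    regroup : ∀ a b c d e → a * (1 * b) * (c * (1 * d)) * e ≡ a * c * (b * d * e)
    regroup = solve-∀
    regroup′ : ∀ a b c d e → a * (1 * b) * (c * (1 * d)) * e ≡ a * c * (b * d) * e
    regroup′ = solve-∀
    upper : ∀ y μ → y ≤ c → strip c (l ∷ λs) (y ∷ μ) * strip c (n ∷ ν) (y ∷ μ) * 𝟙 (y + total μ ≟ S) ≡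
      𝟙 (l ⊔ n ≤? y) * (strip l λs μ * strip n ν μ * 𝟙 (y + total μ ≟ S))
    upper y μ y≤c rewrite 𝟙-yes (y ≤? c) y≤c = trans
      (regroup (𝟙 (l ≤? y)) (strip l λs μ) (𝟙 (n ≤? y)) (strip n ν μ) _)
      (cong (_* (strip l λs μ * strip n ν μ * 𝟙 (y + total μ ≟ S))) (trans (sym (𝟙-× (l ≤? y) (n ≤? y)))
        (𝟙-cong ((l ≤? y) ×-dec (n ≤? y)) (l ⊔ n ≤? y) (uncurry ⊔-lub) (λ M≤y → m⊔n≤o⇒m≤o l n M≤y , m⊔n≤o⇒n≤o l n M≤y))))
    lower : ∀ x κ → W x κ * 𝟙 (l + total λs ≤? (x + total κ) + a) ≡
      strip c (x ∷ κ) (l ∷ λs) * strip c (x ∷ κ) (n ∷ ν) * 𝟙 (l + total λs ≤? (x + total κ) + a)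
    lower x κ rewrite 𝟙-yes (l ≤? c) l≤c | 𝟙-yes (n ≤? c) n≤c =
      sym (regroup′ (𝟙 (x ≤? l)) (strip x κ λs) (𝟙 (x ≤? n)) (strip x κ ν) _)
    -- The size of μ determines its first row as `y₀`. It satisfies `l ⊔ n ≤ y₀` exactly if κ lacks
    -- at most `a` cells of the partition `l ∷ λs`, because `(l ⊔ n) + N` is the sum of the sizes of
    -- the two given partitions. The hypothesis `bound` is what keeps `y₀` within the range of
    -- summation.
    first-row : ∀ x κ → W x κ ≢ 0 → sumTo B (λ y → 𝟙 (l ⊔ n ≤? y) * 𝟙 (y + N ≟ S + (x + total κ))) ≡
                                    𝟙 (l + total λs ≤? (x + total κ) + a)
    first-row x κ nz = decide (l + total λs ≤? T + a)
      where
      T : ℕ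
      T = x + total κ
      T≤ : T ≤ l + total λs
      T≤ = let nx , ns = *-nonzero (𝟙 (x ≤? l) * 𝟙 (x ≤? n)) _ nz in
        +-mono-≤ (𝟙-nonzero (x ≤? l) (proj₁ (*-nonzero (𝟙 (x ≤? l)) _ nx)))
                 (strip-total x κ λs (proj₁ (*-nonzero (strip x κ λs) _ ns)))
      sizes : (l ⊔ n) + N ≡ (l + total λs) + (n + total ν)
      sizes = ⊔+⊓-total l n (total λs) (total ν)
      S+T : S + T ≡ (T + a) + (n + total ν)
      S+T = trans (cong (_+ T) size) (trans (+-comm _ T) (sym (+-assoc T a (n + total ν))))
      decide : Dec (l + total λs ≤ T + a) → _
      decide (yes le) = trans (sumTo-single B _ y₀ (s≤s (≤-trans (m∸n≤m (S + T) N) (≤-trans (+-monoʳ-≤ S T≤) bound)))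
        λ y _ y≢ → trans (cong (𝟙 (l ⊔ n ≤? y) *_) (𝟙-no (y + N ≟ S + T) λ e → y≢ (trans (sym (m+n∸n≡m y N)) (cong (_∸ N) e))))
                         (*-zeroʳ (𝟙 (l ⊔ n ≤? y))))
        (trans (cong₂ _*_ (𝟙-yes (l ⊔ n ≤? y₀) (m+n≤o⇒m≤o∸n (l ⊔ n) big))
                          (𝟙-yes (y₀ + N ≟ S + T) (m∸n+n≡m (m+n≤o⇒n≤o (l ⊔ n) big))))
               (sym (𝟙-yes (l + total λs ≤? T + a) le)))
        where
        y₀ : ℕ
        y₀ = S + T ∸ N
        big : (l ⊔ n) + N ≤ S + T
        big = subst₂ _≤_ (sym sizes) (sym S+T) (+-monoˡ-≤ (n + total ν) le)
      decide (no nle) = trans (sumTo-zeroᵇ B λ y _ → trans (sym (𝟙-× (l ⊔ n ≤? y) (y + N ≟ S + T)))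
        (𝟙-no ((l ⊔ n ≤? y) ×-dec (y + N ≟ S + T)) λ (M≤y , e) → nle (+-cancelʳ-≤ (n + total ν) _ _
          (subst₂ _≤_ sizes (trans e S+T) (+-monoˡ-≤ N M≤y)))))
        (sym (𝟙-no (l + total λs ≤? T + a) nle))

  private
    -- Here `κ`, `l` and `n` are the sizes of three partitions, and `i` is the index j in the
    -- commutation identity. The sizes determine it as `κ + a ∸ l`, and it exists exactly under the
    -- two conditions on the right.
    splits : ∀ κ l n m a → κ ≤ l → κ ≤ n →
      sumTo (suc a) (λ i → 𝟙 (i ≤? m) * (𝟙 (a ∸ i + κ ≟ l) * 𝟙 (n ≟ κ + (m ∸ i)))) ≡
      𝟙 (l + m ≟ a + n) * 𝟙 (l ≤? κ + a)
    splits κ l n m a κ≤l κ≤n = trans (decide ((l + m ≟ a + n) ×-dec (l ≤? κ + a))) (𝟙-× (l + m ≟ a + n) (l ≤? κ + a))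
      where
      f : ℕ → ℕ
      f i = 𝟙 (i ≤? m) * (𝟙 (a ∸ i + κ ≟ l) * 𝟙 (n ≟ κ + (m ∸ i)))
      a-part : ∀ i → i ≤ a → a ∸ i + κ ≡ l → κ + a ≡ l + i
      a-part i i≤a e = begin
        κ + a                ≡⟨ cong (κ +_) (sym (m∸n+n≡m i≤a)) ⟩
        κ + (a ∸ i + i)      ≡⟨ regroup κ (a ∸ i) i ⟩
        a ∸ i + κ + i        ≡⟨ cong (_+ i) e ⟩
        l + i                ∎
        where
        open ≡-Reasoning
        regroup : ∀ x y z → x + (y + z) ≡ y + x + z
        regroup = solve-∀
      decide : (d : Dec (l + m ≡ a + n × l ≤ κ + a)) → sumTo (suc a) f ≡ 𝟙 d
      decide (yes (size , l≤)) = trans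
        (sumTo-single (suc a) f i₀ (s≤s i₀≤a) λ i i≤a i≢ → trans
          (cong (𝟙 (i ≤? m) *_) (cong (_* 𝟙 (n ≟ κ + (m ∸ i))) (𝟙-no (a ∸ i + κ ≟ l) λ e →
            i≢ (sym (trans (cong (_∸ l) (a-part i (s≤s⁻¹ i≤a) e)) (m+n∸m≡n l i))))))
          (*-zeroʳ (𝟙 (i ≤? m))))
        (cong₂ _*_ (𝟙-yes (i₀ ≤? m) i₀≤m) (cong₂ _*_
          (𝟙-yes (a ∸ i₀ + κ ≟ l) (+-cancelʳ-≡ i₀ _ _ (trans (sym (regroup κ (a ∸ i₀) i₀)) (trans (cong (κ +_) (m∸n+n≡m i₀≤a)) (sym l+i₀)))))
          (𝟙-yes (n ≟ κ + (m ∸ i₀)) (+-cancelˡ-≡ a _ _ (begin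
            a + n                      ≡⟨ sym size ⟩
            l + m                      ≡⟨ cong (l +_) (sym (m+[n∸m]≡n i₀≤m)) ⟩
            l + (i₀ + (m ∸ i₀))        ≡⟨ sym (+-assoc l i₀ _) ⟩
            l + i₀ + (m ∸ i₀)          ≡⟨ cong (_+ (m ∸ i₀)) l+i₀ ⟩
            κ + a + (m ∸ i₀)           ≡⟨ trans (cong (_+ (m ∸ i₀)) (+-comm κ a)) (+-assoc a κ _) ⟩
            a + (κ + (m ∸ i₀))         ∎)))))
        where
        open ≡-Reasoning
        regroup : ∀ x y z → x + (y + z) ≡ y + x + z
        regroup = solve-∀
        i₀ : ℕ
        i₀ = κ + a ∸ l
        l+i₀ : l + i₀ ≡ κ + a
        l+i₀ = m+[n∸m]≡n l≤
        i₀≤a : i₀ ≤ a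
        i₀≤a = m≤n+o⇒m∸n≤o (κ + a) l (+-monoˡ-≤ a κ≤l)
        i₀≤m : i₀ ≤ m
        i₀≤m = m≤n+o⇒m∸n≤o (κ + a) l (≤-trans (≤-trans (+-monoˡ-≤ a κ≤n) (≤-reflexive (+-comm n a))) (≤-reflexive (sym size)))
      decide (no ¬both) = sumTo-zeroᵇ (suc a) λ i i≤a → trans
        (trans (cong (𝟙 (i ≤? m) *_) (sym (𝟙-× (a ∸ i + κ ≟ l) (n ≟ κ + (m ∸ i)))))
               (sym (𝟙-× (i ≤? m) ((a ∸ i + κ ≟ l) ×-dec (n ≟ κ + (m ∸ i))))))
        (𝟙-no ((i ≤? m) ×-dec ((a ∸ i + κ ≟ l) ×-dec (n ≟ κ + (m ∸ i)))) λ (i≤m , e , e′) →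
          let κ+a = a-part i (s≤s⁻¹ i≤a) e in ¬both
            ( (begin
                l + m                  ≡⟨ cong (l +_) (sym (m+[n∸m]≡n i≤m)) ⟩
                l + (i + (m ∸ i))      ≡⟨ sym (+-assoc l i _) ⟩
                l + i + (m ∸ i)        ≡⟨ cong (_+ (m ∸ i)) (sym κ+a) ⟩
                κ + a + (m ∸ i)        ≡⟨ trans (cong (_+ (m ∸ i)) (+-comm κ a)) (+-assoc a κ _) ⟩
                a + (κ + (m ∸ i))      ≡⟨ cong (a +_) (sym e′) ⟩
                a + n                  ∎)
            , subst (l ≤_) (sym κ+a) (m≤m+n l i)))
        where open ≡-Reasoning

  sumStrips : List ℕ → ℕ → (List ℕ → ℕ) → ℕ
  sumStrips λs m f = sumW (length λs) B λ μ → strip c λs μ * (𝟙 (total μ ≟ total λs + m) * f μ)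

  strips-empty : ∀ b λs → total λs ≡ 0 → sumW (length λs) B (λ μ → strip b λs μ * 𝟙 (total μ ≟ 0)) ≡ 1
  strips-empty b []          _ = trans (sumW-zero B _) refl
  strips-empty b (zero ∷ λs) e = begin
    sumW (suc (length λs)) B (λ μ → strip b (0 ∷ λs) μ * 𝟙 (total μ ≟ 0))
      ≡⟨ sumW-suc (length λs) B _ ⟩
    sumTo B (λ y → sumW (length λs) B λ μ → strip b (0 ∷ λs) (y ∷ μ) * 𝟙 (y + total μ ≟ 0))
      ≡⟨ sumTo-single B _ 0 z<s (λ y _ y≢0 → sumW-zeroᵇ (length λs) B λ μ _ → trans
           (cong (strip b (0 ∷ λs) (y ∷ μ) *_) (𝟙-no (y + total μ ≟ 0) λ e → y≢0 (m+n≡0⇒m≡0 y e)))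
           (*-zeroʳ (strip b (0 ∷ λs) (y ∷ μ)))) ⟩
    sumW (length λs) B (λ μ → strip b (0 ∷ λs) (0 ∷ μ) * 𝟙 (total μ ≟ 0))
      ≡⟨ sumW-cong (length λs) B (λ μ → cong (_* 𝟙 (total μ ≟ 0)) (trans (*-identityˡ (1 * strip 0 λs μ)) (*-identityˡ (strip 0 λs μ)))) ⟩
    sumW (length λs) B (λ μ → strip 0 λs μ * 𝟙 (total μ ≟ 0))
      ≡⟨ strips-empty 0 λs e ⟩
    1 ∎
    where open ≡-Reasoning

  -- Removing the last variable on the left leads from `λs` up to `μ` and down to `ν`; on the right
  -- it leads down to `κ`, and the induction hypothesis for `κ` leads up to `ν`. `commutation`
  -- identifies the two families of paths. The bound is inherited because neither `total κ` nor
  -- `m ∸ i` exceeds the original value.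
  pieri : ∀ n α → length α ≡ n → ∀ λs m → Linked _≥_ λs → LastZero λs → total λs + m + total λs ≤ c →
    sumStrips λs m (λ μ → kostka μ α) ≡ H m (kostka λs) α
  pieri n α lα λs m link z bound with initLast α
  pieri n .[] lα λs m link z bound | [] = begin
    sumStrips λs m (λ μ → kostka μ [])
      ≡⟨ (sumW-cong (length λs) B λ μ → cong (λ k → strip c λs μ * (𝟙 (total μ ≟ total λs + m) * k)) (kostka-[] μ)) ⟩
    sumW (length λs) B (λ μ → strip c λs μ * (𝟙 (total μ ≟ total λs + m) * 𝟙 (total μ ≟ 0)))
      ≡⟨ decide (total λs + m ≟ 0) ⟩
    𝟙 (total λs + m ≟ 0)
      ≡⟨ trans (𝟙-cong (total λs + m ≟ 0) ((m ≟ 0) ×-dec (total λs ≟ 0))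
           (λ e → m+n≡0⇒n≡0 (total λs) e , m+n≡0⇒m≡0 (total λs) e) (λ (e , e′) → cong₂ _+_ e′ e))
           (𝟙-× (m ≟ 0) (total λs ≟ 0)) ⟩
    𝟙 (m ≟ 0) * 𝟙 (total λs ≟ 0)
      ≡⟨ cong (𝟙 (m ≟ 0) *_) (sym (kostka-[] λs)) ⟩
    𝟙 (m ≟ 0) * kostka λs [] ∎
    where
    open ≡-Reasoning
    decide : (d : Dec (total λs + m ≡ 0)) →
      sumW (length λs) B (λ μ → strip c λs μ * (𝟙 (total μ ≟ total λs + m) * 𝟙 (total μ ≟ 0))) ≡ 𝟙 d
    decide (yes e) = trans (sumW-cong (length λs) B λ μ → cong (strip c λs μ *_) (trans
        (sym (𝟙-× (total μ ≟ total λs + m) (total μ ≟ 0)))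
        (𝟙-cong ((total μ ≟ total λs + m) ×-dec (total μ ≟ 0)) (total μ ≟ 0) proj₂ λ e′ → trans e′ (sym e) , e′)))
      (strips-empty c λs (m+n≡0⇒m≡0 (total λs) e))
    decide (no ne) = sumW-zeroᵇ (length λs) B λ μ _ → trans (cong (strip c λs μ *_) (trans
        (sym (𝟙-× (total μ ≟ total λs + m) (total μ ≟ 0)))
        (𝟙-no ((total μ ≟ total λs + m) ×-dec (total μ ≟ 0)) λ (e , e′) → ne (trans (sym e) e′))))
      (*-zeroʳ (strip c λs μ))
  pieri zero .(β ∷ʳ a) lα λs m link z bound | β ∷ʳ′ a with () ← trans (sym lα) (length-∷ʳ β a)
  pieri (suc n) .(β ∷ʳ a) lα λs m link z bound | β ∷ʳ′ a = begin
    sumStrips λs m (λ μ → kostka μ (β ∷ʳ a))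
      ≡⟨ (sumW-congᵇ R B λ μ w → nonzero-cong (strip c λs μ) λ nz → cong (𝟙 (total μ ≟ S) *_) (branch μ w nz)) ⟩
    sumW R B (λ μ → strip c λs μ * (𝟙 (total μ ≟ S) * sumW R B λ ν → strip c ν μ * (𝟙 (a + total ν ≟ total μ) * kostka ν β)))
      ≡⟨ (sumW-cong R B λ μ → trans (cong (strip c λs μ *_) (sym (sumW-*ˡ R B (𝟙 (total μ ≟ S)) _)))
           (trans (sym (sumW-*ˡ R B (strip c λs μ) _)) (sumW-cong R B λ ν → left μ ν))) ⟩
    sumW R B (λ μ → sumW R B λ ν → 𝟙 (S ≟ a + total ν) * kostka ν β * (strip c λs μ * strip c ν μ * 𝟙 (total μ ≟ S)))
      ≡⟨ trans (sumW-swap R B R B _) (sumW-cong R B λ ν → sumW-*ˡ R B (𝟙 (S ≟ a + total ν) * kostka ν β) _) ⟩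
    sumW R B (λ ν → 𝟙 (S ≟ a + total ν) * kostka ν β * sumW R B λ μ → strip c λs μ * strip c ν μ * 𝟙 (total μ ≟ S))
      ≡⟨ (sumW-congᵇ R B λ ν (lν , ν<B) → nonzero-cong (𝟙 (S ≟ a + total ν) * kostka ν β) λ nz →
           commutation λs ν m a z (sym lν) λ≤c (All.map s≤s⁻¹ ν<B)
             (𝟙-nonzero (S ≟ a + total ν) (proj₁ (*-nonzero (𝟙 (S ≟ a + total ν)) _ nz))) bound) ⟩
    sumW R B (λ ν → 𝟙 (S ≟ a + total ν) * kostka ν β * sumW R B λ κ → strip c κ λs * strip c κ ν * 𝟙 (total λs ≤? total κ + a))
      ≡⟨ trans (sumW-cong R B λ ν → sym (sumW-*ˡ R B (𝟙 (S ≟ a + total ν) * kostka ν β) _)) (sumW-swap R B R B _) ⟩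
    sumW R B (λ κ → sumW R B λ ν → 𝟙 (S ≟ a + total ν) * kostka ν β * (strip c κ λs * strip c κ ν * 𝟙 (total λs ≤? total κ + a)))
      ≡⟨ (sumW-cong R B λ κ → trans (sumW-cong R B λ ν → right κ ν) (trans (sumW-*ˡ R B (strip c κ λs) _)
           (cong (strip c κ λs *_) (sumW-sumTo R B (suc a) _)))) ⟩
    sumW R B (λ κ → strip c κ λs * sumTo (suc a) λ i → sumW R B λ ν →
      𝟙 (i ≤? m) * (𝟙 (a ∸ i + total κ ≟ total λs) * (strip c κ ν * (𝟙 (total ν ≟ total κ + (m ∸ i)) * kostka ν β))))
      ≡⟨ (sumW-congᵇ R B λ κ (lκ , _) → nonzero-cong (strip c κ λs) λ nz → sumTo-cong (suc a) λ i → trans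
           (sumW-*ˡ R B (𝟙 (i ≤? m)) _) (cong (𝟙 (i ≤? m) *_) (trans (sumW-*ˡ R B (𝟙 (a ∸ i + total κ ≟ total λs)) _)
             (cong (𝟙 (a ∸ i + total κ ≟ total λs) *_) (induction κ lκ nz i))))) ⟩
    sumW R B (λ κ → strip c κ λs * sumTo (suc a) λ i → 𝟙 (i ≤? m) * (𝟙 (a ∸ i + total κ ≟ total λs) * H (m ∸ i) (kostka κ) β))
      ≡⟨ trans (sumW-cong R B λ κ → sym (sumTo-*ˡ (suc a) (strip c κ λs) _)) (trans (sumW-sumTo R B (suc a) _)
           (sumTo-cong (suc a) λ i → trans (sumW-cong R B λ κ → *-swapˡ (strip c κ λs) (𝟙 (i ≤? m)) _)
             (sumW-*ˡ R B (𝟙 (i ≤? m)) _))) ⟩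
    sumTo (suc a) (λ i → 𝟙 (i ≤? m) * sumW R B λ κ → strip c κ λs * (𝟙 (a ∸ i + total κ ≟ total λs) * H (m ∸ i) (kostka κ) β))
      ≡⟨ sym (sumTo-cong (suc a) λ i → cong (𝟙 (i ≤? m) *_) (expand i)) ⟩
    sumTo (suc a) (λ i → 𝟙 (i ≤? m) * H (m ∸ i) (λ γ → kostka λs (γ ∷ʳ (a ∸ i))) β)
      ≡⟨ sym (H-snoc m (kostka λs) β a) ⟩
    H m (kostka λs) (β ∷ʳ a) ∎
    where
    open ≡-Reasoning
    R S : ℕ
    R = length λs
    S = total λs + m
    λ≤c : All (_≤ c) λs
    λ≤c = All.map (λ x≤ → ≤-trans x≤ (≤-trans (m≤n+m _ S) bound)) (total-≥ λs)
    branch : ∀ μ → IsWord R B μ → strip c λs μ ≢ 0 → kostka μ (β ∷ʳ a) ≡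
      sumW R B λ ν → strip c ν μ * (𝟙 (a + total ν ≟ total μ) * kostka ν β)
    branch μ (lμ , μ<B) nz = subst
      (λ r → kostka μ (β ∷ʳ a) ≡ sumW r B λ ν → strip c ν μ * (𝟙 (a + total ν ≟ total μ) * kostka ν β)) lμ
      (kostka-branch c B μ β a (strip-linked-upper c λs μ nz) μ<B (All.map s≤s⁻¹ μ<B))
    left : ∀ μ ν → strip c λs μ * (𝟙 (total μ ≟ S) * (strip c ν μ * (𝟙 (a + total ν ≟ total μ) * kostka ν β))) ≡
      𝟙 (S ≟ a + total ν) * kostka ν β * (strip c λs μ * strip c ν μ * 𝟙 (total μ ≟ S))
    left μ ν = trans (regroup (strip c λs μ) (𝟙 (total μ ≟ S)) (strip c ν μ) (𝟙 (a + total ν ≟ total μ)) (kostka ν β))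
      (trans (𝟙*-cong (total μ ≟ S) (total μ ≟ S) id id λ e → cong (λ x → x * kostka ν β * (strip c λs μ * strip c ν μ))
               (𝟙-cong (a + total ν ≟ total μ) (S ≟ a + total ν) (λ e′ → trans (sym e) (sym e′)) (λ e′ → trans (sym e′) (sym e))))
             (regroup′ (𝟙 (total μ ≟ S)) (𝟙 (S ≟ a + total ν) * kostka ν β) (strip c λs μ * strip c ν μ)))
      where
      regroup : ∀ s t s′ b k → s * (t * (s′ * (b * k))) ≡ t * (b * k * (s * s′))
      regroup = solve-∀
      regroup′ : ∀ t x y → t * (x * y) ≡ x * (y * t)
      regroup′ = solve-∀
    right : ∀ κ ν → 𝟙 (S ≟ a + total ν) * kostka ν β * (strip c κ λs * strip c κ ν * 𝟙 (total λs ≤? total κ + a)) ≡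
      strip c κ λs * sumTo (suc a) λ i → 𝟙 (i ≤? m) * (𝟙 (a ∸ i + total κ ≟ total λs) * (strip c κ ν * (𝟙 (total ν ≟ total κ + (m ∸ i)) * kostka ν β)))
    right κ ν = begin
      𝟙 (S ≟ a + total ν) * kostka ν β * (strip c κ λs * strip c κ ν * 𝟙 (total λs ≤? total κ + a))
        ≡⟨ regroup (𝟙 (S ≟ a + total ν)) (kostka ν β) (strip c κ λs) (strip c κ ν) _ ⟩
      strip c κ λs * (strip c κ ν * (𝟙 (S ≟ a + total ν) * 𝟙 (total λs ≤? total κ + a) * kostka ν β))
        ≡⟨ (nonzero-cong (strip c κ λs) λ nz → nonzero-cong (strip c κ ν) λ nz′ → cong (_* kostka ν β)
             (sym (splits (total κ) (total λs) (total ν) m a (strip-total c κ λs nz) (strip-total c κ ν nz′)))) ⟩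
      strip c κ λs * (strip c κ ν * (sumTo (suc a) (λ i → 𝟙 (i ≤? m) * (𝟙 (a ∸ i + total κ ≟ total λs) * 𝟙 (total ν ≟ total κ + (m ∸ i)))) * kostka ν β))
        ≡⟨ cong (strip c κ λs *_) (trans (cong (strip c κ ν *_) (sym (sumTo-*ʳ (suc a) (kostka ν β) _))) (trans (sym (sumTo-*ˡ (suc a) (strip c κ ν) _))
             (sumTo-cong (suc a) λ i → regroup′ (strip c κ ν) (𝟙 (i ≤? m)) (𝟙 (a ∸ i + total κ ≟ total λs)) _ _))) ⟩
      strip c κ λs * sumTo (suc a) (λ i → 𝟙 (i ≤? m) * (𝟙 (a ∸ i + total κ ≟ total λs) * (strip c κ ν * (𝟙 (total ν ≟ total κ + (m ∸ i)) * kostka ν β)))) ∎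
      where
      regroup : ∀ x k s s′ y → x * k * (s * s′ * y) ≡ s * (s′ * (x * y * k))
      regroup = solve-∀
      regroup′ : ∀ s i x y k → s * (i * (x * y) * k) ≡ i * (x * (s * (y * k)))
      regroup′ = solve-∀
    induction : ∀ κ → length κ ≡ R → strip c κ λs ≢ 0 → ∀ i →
      sumW R B (λ ν → strip c κ ν * (𝟙 (total ν ≟ total κ + (m ∸ i)) * kostka ν β)) ≡ H (m ∸ i) (kostka κ) β
    induction κ lκ nz i = subst
      (λ r → sumW r B (λ ν → strip c κ ν * (𝟙 (total ν ≟ total κ + (m ∸ i)) * kostka ν β)) ≡ H (m ∸ i) (kostka κ) β) lκ
      (pieri n β (suc-injective (trans (sym (length-∷ʳ β a)) lα)) κ (m ∸ i) (strip-linked-lower c κ λs nz)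
        (strip-lastZero c κ λs nz z) (≤-trans (+-mono-≤ (+-mono-≤ κ≤λ (m∸n≤m m i)) κ≤λ) bound))
      where
      κ≤λ : total κ ≤ total λs
      κ≤λ = strip-total c κ λs nz
    expand : ∀ i → H (m ∸ i) (λ γ → kostka λs (γ ∷ʳ (a ∸ i))) β ≡
      sumW R B λ κ → strip c κ λs * (𝟙 (a ∸ i + total κ ≟ total λs) * H (m ∸ i) (kostka κ) β)
    expand i = trans
      (H-cong (m ∸ i) β λ γ _ → kostka-branch c B λs γ (a ∸ i) link (All.map s≤s λ≤c) λ≤c)
      (trans (H-sumW (m ∸ i) β R B _) (sumW-cong R B λ κ → trans (H-*ˡ (m ∸ i) β (strip c κ λs) _)
        (cong (strip c κ λs *_) (H-*ˡ (m ∸ i) β (𝟙 (a ∸ i + total κ ≟ total λs)) (kostka κ)))))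

-- Expansion of ribbons in Schur functions

maybeTo : (List ℕ → ℕ) → Maybe (List ℕ) → ℕ
maybeTo f (just μ) = f μ
maybeTo f nothing  = 0

-- Adds a box to row r of a shape whose first row must stay within c columns.
addBox : ℕ → ℕ → List ℕ → Maybe (List ℕ)
addBox c r       []       = nothing
addBox c zero    (l ∷ λs) = if does (l <? c) then just (suc l ∷ λs) else nothing
addBox c (suc r) (l ∷ λs) = Maybe.map (l ∷_) (addBox l r λs)

addBoxes : ℕ → List ℕ → Maybe (List ℕ) → Maybe (List ℕ)
addBoxes c u s = foldr (λ r s → s >>= addBox c r) s u

addBoxes-nothing : ∀ c u → addBoxes c u nothing ≡ nothing
addBoxes-nothing c []      = refl
addBoxes-nothing c (r ∷ u) = cong (_>>= addBox c r) (addBoxes-nothing c u)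

addBoxes-lower-rows : ∀ c l v λs → addBoxes c (map suc v) (just (l ∷ λs)) ≡ Maybe.map (l ∷_) (addBoxes l v (just λs))
addBoxes-lower-rows c l []      λs = refl
addBoxes-lower-rows c l (r ∷ v) λs rewrite addBoxes-lower-rows c l v λs with addBoxes l v (just λs)
... | nothing = refl
... | just μ  = refl

addBoxes-first-row : ∀ c l k μ f → l ≤ c →
  maybeTo f (addBoxes c (replicate k 0) (just (l ∷ μ))) ≡ 𝟙 (l + k ≤? c) * f (l + k ∷ μ)
addBoxes-first-row c l k μ f l≤c = trans (cong (maybeTo f) (boxes k)) (evaluate (l + k ≤? c))
  where
  result : ∀ {k} → Dec (l + k ≤ c) → Maybe (List ℕ)
  result {k} d = if does d then just (l + k ∷ μ) else nothing
  evaluate : ∀ (d : Dec (l + k ≤ c)) → maybeTo f (result d) ≡ 𝟙 d * f (l + k ∷ μ)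
  evaluate (yes _) = sym (*-identityˡ _)
  evaluate (no _)  = refl
  step : ∀ k (d : Dec (l + k ≤ c)) (d′ : Dec (l + suc k ≤ c)) → (result d >>= addBox c 0) ≡ result d′
  step k (no nle) (yes le) = contradiction (≤-trans (+-monoʳ-≤ l (n≤1+n k)) le) nle
  step k (no _)   (no _)   = refl
  step k (yes _)  (yes le) rewrite dec-true (l + k <? c) (subst (_≤ c) (+-suc l k) le) = cong (λ z → just (z ∷ μ)) (sym (+-suc l k))
  step k (yes _)  (no nle) rewrite dec-false (l + k <? c) (λ lt → nle (subst (_≤ c) (sym (+-suc l k)) lt)) = refl
  boxes : ∀ k → addBoxes c (replicate k 0) (just (l ∷ μ)) ≡ result (l + k ≤? c)
  boxes zero rewrite dec-true (l + 0 ≤? c) (subst (_≤ c) (sym (+-identityʳ l)) l≤c) = cong (λ z → just (z ∷ μ)) (sym (+-identityʳ l))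
  boxes (suc k) = trans (cong (_>>= addBox c 0) (boxes k)) (step k (l + k ≤? c) (l + suc k ≤? c))

-- The last letter acts first, so an increasing word fills the lower rows before the upper ones. A
-- row being filled still has the old row above it; remaining a partition at each box is therefore
-- the condition for a horizontal strip, and each strip arises from exactly one increasing word.
sumInc-strips : ∀ B c λs m f → c < B → Linked _≥_ (c ∷ λs) →
  sumInc m (length λs) (λ u → maybeTo f (addBoxes c u (just λs))) ≡
  sumW (length λs) B (λ μ → strip c λs μ * (𝟙 (total μ ≟ total λs + m) * f μ))
sumInc-strips B c []       zero    f _ _ = trans (sumInc-zero 0 _) (sym (trans (sumW-zero B _) (trans (*-identityˡ _) (*-identityˡ _))))
sumInc-strips B c []       (suc m) f _ _ = trans (sumInc-def (suc m) 0 _) (trans (sumW-suc m 0 _) (trans (sumTo-zero _) (sym (sumW-zero B _))))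
sumInc-strips B c (l ∷ λs) m       f c<B (l≤c ∷ link) = begin
  sumInc m (suc R) (λ u → maybeTo f (addBoxes c u (just (l ∷ λs))))
    ≡⟨ sumInc-cons m R _ ⟩
  sumTo (suc m) (λ i → sumInc i R λ v → maybeTo f (addBoxes c (replicate (m ∸ i) 0 ++ map suc v) (just (l ∷ λs))))
    ≡⟨ (sumTo-cong (suc m) λ i → trans (sumInc-cong i R λ v → split i v) (trans (sumInc-*ˡ i R (𝟙 (l + (m ∸ i) ≤? c)) _)
         (cong (𝟙 (l + (m ∸ i) ≤? c) *_) (sumInc-strips B l λs i (f ∘ (l + (m ∸ i) ∷_)) (≤-<-trans l≤c c<B) link)))) ⟩
  sumTo (suc m) (λ i → 𝟙 (l + (m ∸ i) ≤? c) * sumW R B λ μ → strip l λs μ * (𝟙 (total μ ≟ total λs + i) * f (l + (m ∸ i) ∷ μ)))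
    ≡⟨ trans (sumTo-reverse m _) (sumTo-congᵇ (suc m) λ k k≤m → cong
         (λ z → 𝟙 (l + z ≤? c) * sumW R B λ μ → strip l λs μ * (𝟙 (total μ ≟ total λs + (m ∸ k)) * f (l + z ∷ μ)))
         (m∸[m∸n]≡n (s≤s⁻¹ k≤m))) ⟩
  sumTo (suc m) (λ k → 𝟙 (l + k ≤? c) * sumW R B λ μ → strip l λs μ * (𝟙 (total μ ≟ total λs + (m ∸ k)) * f (l + k ∷ μ)))
    ≡⟨ sumTo-exchange (suc m) (suc d) exchange ⟩
  sumTo (suc d) (λ k → G (l + k))
    ≡⟨ sym (sumTo-within B l d G (subst (_< B) (sym l+d) c<B)) ⟩
  sumTo B (λ y → within l (l + d) y * G y)
    ≡⟨ (sumTo-cong B λ y → trans (sym (sumW-*ˡ R B (within l (l + d) y) _)) (sumW-cong R B λ μ →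
         trans (cong (λ z → within l z y * _) l+d) (regroup (𝟙 (l ≤? y)) (𝟙 (y ≤? c)) (strip l λs μ) _))) ⟩
  sumTo B (λ y → sumW R B λ μ → strip c (l ∷ λs) (y ∷ μ) * (𝟙 (y + total μ ≟ l + total λs + m) * f (y ∷ μ)))
    ≡⟨ sym (sumW-suc R B _) ⟩
  sumW (suc R) B (λ μ → strip c (l ∷ λs) μ * (𝟙 (total μ ≟ l + total λs + m) * f μ)) ∎
  where
  open ≡-Reasoning
  R d : ℕ
  R = length λs
  d = c ∸ l
  l+d : l + d ≡ c
  l+d = m+[n∸m]≡n l≤c
  G : ℕ → ℕ
  G y = sumW R B λ μ → strip l λs μ * (𝟙 (y + total μ ≟ l + total λs + m) * f (y ∷ μ))
  regroup : ∀ a b s x → a * b * (s * x) ≡ a * (b * s) * x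
  regroup = solve-∀
  split : ∀ i v → maybeTo f (addBoxes c (replicate (m ∸ i) 0 ++ map suc v) (just (l ∷ λs))) ≡
    𝟙 (l + (m ∸ i) ≤? c) * maybeTo (f ∘ (l + (m ∸ i) ∷_)) (addBoxes l v (just λs))
  split i v rewrite foldr-++ (λ r s → s >>= addBox c r) (just (l ∷ λs)) (replicate (m ∸ i) 0) (map suc v)
                  | addBoxes-lower-rows c l v λs with addBoxes l v (just λs)
  ... | just μ  = addBoxes-first-row c l (m ∸ i) μ f l≤c
  ... | nothing = trans (cong (maybeTo f) (addBoxes-nothing c (replicate (m ∸ i) 0))) (sym (*-zeroʳ (𝟙 (l + (m ∸ i) ≤? c))))
  sizes : ∀ k μ → strip l λs μ ≢ 0 → 𝟙 (k <? suc m) * 𝟙 (total μ ≟ total λs + (m ∸ k)) ≡ 𝟙 (l + k + total μ ≟ l + total λs + m)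
  sizes k μ nz = trans (sym (𝟙-× (k <? suc m) (total μ ≟ total λs + (m ∸ k))))
    (𝟙-cong ((k <? suc m) ×-dec (total μ ≟ total λs + (m ∸ k))) (l + k + total μ ≟ l + total λs + m)
      (λ (k≤m , e) → begin
        l + k + total μ                   ≡⟨ cong (l + k +_) e ⟩
        l + k + (total λs + (m ∸ k))      ≡⟨ rearrange l k (total λs) (m ∸ k) ⟩
        l + total λs + (k + (m ∸ k))      ≡⟨ cong (l + total λs +_) (m+[n∸m]≡n (s≤s⁻¹ k≤m)) ⟩
        l + total λs + m                  ∎)
      (λ e → let e′ = +-cancelˡ-≡ l _ _ (trans (sym (+-assoc l k (total μ))) (trans e (+-assoc l (total λs) m)))
                 k≤m = +-cancelʳ-≤ (total λs) k m (≤-trans (+-monoʳ-≤ k (strip-total l λs μ nz)) (≤-reflexive (trans e′ (+-comm (total λs) m))))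
             in s≤s k≤m , +-cancelˡ-≡ k _ _ (trans e′ (trans (cong (total λs +_) (sym (m+[n∸m]≡n k≤m))) (rearrange′ (total λs) k (m ∸ k))))))
    where
    rearrange : ∀ l k t x → l + k + (t + x) ≡ l + t + (k + x)
    rearrange = solve-∀
    rearrange′ : ∀ t k x → t + (k + x) ≡ k + (t + x)
    rearrange′ = solve-∀
  exchange : ∀ k → 𝟙 (k <? suc m) * (𝟙 (l + k ≤? c) * sumW R B λ μ → strip l λs μ * (𝟙 (total μ ≟ total λs + (m ∸ k)) * f (l + k ∷ μ))) ≡
                   𝟙 (k <? suc d) * G (l + k)
  exchange k = trans (*-swapˡ (𝟙 (k <? suc m)) (𝟙 (l + k ≤? c)) _) (cong₂ _*_
    (𝟙-cong (l + k ≤? c) (k <? suc d) (λ le → s≤s (+-cancelˡ-≤ l k d (subst (l + k ≤_) (sym l+d) le)))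
      (λ le → subst (l + k ≤_) l+d (+-monoʳ-≤ l (s≤s⁻¹ le))))
    (trans (sym (sumW-*ˡ R B (𝟙 (k <? suc m)) _)) (sumW-cong R B λ μ →
      trans (*-swapˡ (𝟙 (k <? suc m)) (strip l λs μ) _) (nonzero-cong (strip l λs μ) λ nz →
        trans (sym (*-assoc (𝟙 (k <? suc m)) _ (f (l + k ∷ μ)))) (cong (_* f (l + k ∷ μ)) (sizes k μ nz))))))

record Grown (c : ℕ) (λs : List ℕ) (k : ℕ) (μ : List ℕ) : Set where
  field
    linked : Linked _≥_ (c ∷ μ)
    rows   : length μ ≡ length λs
    boxes  : total μ ≡ k + total λs

addBox-grown : ∀ c r λs μ → Linked _≥_ (c ∷ λs) → addBox c r λs ≡ just μ → Grown c λs 1 μ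
addBox-grown c zero    (l ∷ λs) μ link e = first-row (l <? c) λs link e
  where
  first-row : (d : Dec (l < c)) → ∀ λs → Linked _≥_ (c ∷ l ∷ λs) →
              (if does d then just (suc l ∷ λs) else nothing) ≡ just μ → Grown c (l ∷ λs) 1 μ
  first-row (yes l<c) []       link               refl = record { linked = l<c ∷ [-] ; rows = refl ; boxes = refl }
  first-row (yes l<c) (x ∷ λs) (_ ∷ (x≤l ∷ link)) refl =
    record { linked = l<c ∷ (≤-trans x≤l (n≤1+n l) ∷ link) ; rows = refl ; boxes = refl }
addBox-grown c (suc r) (l ∷ λs) μ (l≤c ∷ link) e with addBox l r λs in eq
addBox-grown c (suc r) (l ∷ λs) .(l ∷ μ) (l≤c ∷ link) refl | just μ =
  record { linked = l≤c ∷ Grown.linked g ; rows = cong suc (Grown.rows g)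
         ; boxes = trans (cong (l +_) (Grown.boxes g)) (+-suc l (total λs)) }
  where
  g : Grown l λs 1 μ
  g = addBox-grown l r λs μ link eq

addBoxes-grown : ∀ c u λs μ → Linked _≥_ (c ∷ λs) → addBoxes c u (just λs) ≡ just μ → Grown c λs (length u) μ
addBoxes-grown c []      λs .λs link refl = record { linked = link ; rows = refl ; boxes = refl }
addBoxes-grown c (r ∷ u) λs μ link e with addBoxes c u (just λs) in eq
... | just κ = record { linked = Grown.linked g′ ; rows = trans (Grown.rows g′) (Grown.rows g)
                      ; boxes = trans (Grown.boxes g′) (cong suc (Grown.boxes g)) }
  where
  g : Grown c λs (length u) κ
  g = addBoxes-grown c u λs κ link eq
  g′ : Grown c κ 1 μ
  g′ = addBox-grown c r κ μ (Grown.linked g) e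

linked-zeros : ∀ c n → Linked _≥_ (c ∷ replicate n 0)
linked-zeros c zero    = [-]
linked-zeros c (suc n) = z≤n ∷ linked-zeros 0 n

total-zeros : ∀ n → total (replicate n 0) ≡ 0
total-zeros zero    = refl
total-zeros (suc n) = total-zeros n

-- A partition with fewer boxes than rows has an empty row, and empty rows come last.
lastZero-small : ∀ μ → Linked _≥_ μ → total μ < length μ → LastZero μ
lastZero-small (zero ∷ [])          link          small = refl
lastZero-small (suc x ∷ [])         link          (s≤s ())
lastZero-small (zero ∷ y ∷ μ)       (y≤0 ∷ link) small = zeros y μ link (n≤0⇒n≡0 y≤0)
  where
  zeros : ∀ y μ → Linked _≥_ (y ∷ μ) → y ≡ 0 → LastZero (y ∷ μ)
  zeros y []      link         e    = e
  zeros y (x ∷ μ) (x≤y ∷ link) refl = zeros x μ link (n≤0⇒n≡0 x≤y)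
lastZero-small (suc x ∷ y ∷ μ)      (y≤x ∷ link) small =
  lastZero-small (y ∷ μ) link (s≤s⁻¹ (≤-trans (s≤s (s≤s (m≤n+m _ x))) small))

module _ (R : ℕ) .{{_ : NonZero R}} where

  private
    c : ℕ
    -- Pieri's rule will be applied to strips of size `m` on `μ` with `m + total μ ≤ R` and
    -- `total μ < R`. It asks for `total μ + m + total μ ≤ c`.
    c = R + R + R

  -- The letters of w are the rows of the boxes, added from the last to the first.
  shapeOf : List ℕ → Maybe (List ℕ)
  shapeOf w = addBoxes c w (just (replicate R 0))

  shapeOf-grown : ∀ w μ → shapeOf w ≡ just μ → Linked _≥_ (c ∷ μ) × length μ ≡ R × total μ ≡ length w
  shapeOf-grown w μ e = Grown.linked g , trans (Grown.rows g) (length-replicate R) ,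
    trans (Grown.boxes g) (trans (cong (length w +_) (total-zeros R)) (+-identityʳ _))
    where
    g : Grown c (replicate R 0) (length w) μ
    g = addBoxes-grown c w (replicate R 0) μ (linked-zeros c R) e

  grown : List ℕ → List ℕ → ℕ
  grown α w = maybeTo (λ μ → kostka μ α) (shapeOf w)

  grown-row : ∀ m μ α → Linked _≥_ (c ∷ μ) → length μ ≡ R → total μ < R → m + total μ ≤ R →
    sumInc m R (λ u → maybeTo (λ ν → kostka ν α) (addBoxes c u (just μ))) ≡ H m (kostka μ) α
  grown-row m μ α link refl small fits = trans
    (sumInc-strips (suc c) c μ m (λ ν → kostka ν α) ≤-refl link)
    (pieri c (length α) α refl μ m (linked-tail link) (lastZero-small μ (linked-tail link) small)
      (≤-trans (+-mono-≤ (≤-trans (≤-reflexive (+-comm (total μ) m)) fits) (<⇒≤ small)) (m≤m+n (R + R) R)))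

  -- The prefix `u` adds its boxes after `v` has grown its shape. By Pieri's rule, summing over
  -- increasing `u` multiplies the Schur function of that shape by h of degree a + 1. Words that
  -- cannot be grown contribute zero on both sides.
  grown-split : ∀ a p α → suc a + suc (length p) ≤ R →
    (∀ γ → sumMatch p R (grown γ) ≡ ribbon p γ) →
    sumMatch (replicate a false ++ true ∷ p) R (grown α) + sumMatch (replicate a false ++ false ∷ p) R (grown α) ≡
    H (suc a) (ribbon p) α
  grown-split a p α fits IH = begin
    sumMatch (replicate a false ++ true ∷ p) R (grown α) + sumMatch (replicate a false ++ false ∷ p) R (grown α)
      ≡⟨ sym (sumMatch-split a p R (grown α)) ⟩
    sumInc (suc a) R (λ u → sumMatch p R λ v → grown α (u ++ v))
      ≡⟨ sym (sumMatch-sumInc-swap p (suc a) R (λ u v → grown α (u ++ v))) ⟩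
    sumMatch p R (λ v → sumInc (suc a) R λ u → grown α (u ++ v))
      ≡⟨ (sumW-congᵇ (suc (length p)) R λ v (lv , _) → cong (matches p v *_) (prefixed v lv)) ⟩
    sumMatch p R (λ v → H (suc a) (λ γ → grown γ v) α)
      ≡⟨ sym (trans (H-sumW (suc a) α (suc (length p)) R _) (sumW-cong (suc (length p)) R λ v → H-*ˡ (suc a) α (matches p v) _)) ⟩
    H (suc a) (λ γ → sumMatch p R (grown γ)) α
      ≡⟨ H-cong (suc a) α (λ γ _ → IH γ) ⟩
    H (suc a) (ribbon p) α ∎
    where
    open ≡-Reasoning
    prefixed : ∀ v → length v ≡ suc (length p) → sumInc (suc a) R (λ u → grown α (u ++ v)) ≡ H (suc a) (λ γ → grown γ v) α
    prefixed v lv = trans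
      (sumInc-cong (suc a) R λ u → cong (maybeTo (λ μ → kostka μ α)) (foldr-++ (λ r s → s >>= addBox c r) (just (replicate R 0)) u v))
      (case (shapeOf v) refl)
      where
      case : ∀ s → shapeOf v ≡ s → sumInc (suc a) R (λ u → maybeTo (λ μ → kostka μ α) (addBoxes c u s)) ≡
             H (suc a) (λ γ → maybeTo (λ μ → kostka μ γ) s) α
      case nothing  e = trans (sumInc-zeroᵇ (suc a) R λ u _ → cong (maybeTo (λ μ → kostka μ α)) (addBoxes-nothing c u)) (sym (H-0 (suc a) α))
      case (just μ) e with link , rows , size ← shapeOf-grown v μ e = grown-row (suc a) μ α link rows
        (≤-trans (s≤s (≤-trans (≤-reflexive (trans size lv)) (m≤n+m _ a))) fits)
        (subst (λ t → suc a + t ≤ R) (sym (trans size lv)) fits)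

  kostka-zeros : ∀ k α → kostka (replicate k 0) α ≡ 𝟙 (replicate (length α) 0 ≟ᴸ α)
  kostka-zeros zero    α = cong (λ z → 𝟙 (z ≟ᴸ α)) (content-[] (length α))
  kostka-zeros (suc k) α = trans (sumInc-zero (length α) _) (trans (*-identityˡ _) (kostka-zeros k α))

  -- A shadow of the Robinson–Schensted–Knuth correspondence, with w in the role of the
  -- recording tableau.  For a pattern without descents this is Pieri's rule; a descent is
  -- removed by the identities grown-split and ribbon-split, which have the same shape.
  ribbon-shapes : ∀ p α → suc (length p) ≤ R → sumMatch p R (grown α) ≡ ribbon p α
  ribbon-shapes p α = induct (descents p) p α refl
    where
    open ≡-Reasoning
    descents : List Bool → ℕ
    descents []          = 0
    descents (true ∷ p)  = suc (descents p)
    descents (false ∷ p) = descents p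
    descents-++ : ∀ a p → descents (replicate a false ++ p) ≡ descents p
    descents-++ zero    p = refl
    descents-++ (suc a) p = descents-++ a p
    data FirstRow : List Bool → Set where
      single : ∀ a → FirstRow (replicate a false)
      first  : ∀ a p → FirstRow (replicate a false ++ true ∷ p)
    firstRow : ∀ p → FirstRow p
    firstRow []          = single 0
    firstRow (true ∷ p)  = first 0 p
    firstRow (false ∷ p) with firstRow p
    ... | single a  = single (suc a)
    ... | first a p = first (suc a) p
    induct : ∀ d p α → descents p ≡ d → suc (length p) ≤ R → sumMatch p R (grown α) ≡ ribbon p α
    induct d p α e fits with firstRow p
    induct d .(replicate a false) α e fits | single a = begin
      sumMatch (replicate a false) R (grown α)
        ≡⟨ sumMatch-inc a R (grown α) ⟩
      sumInc (suc a) R (grown α)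
        ≡⟨ grown-row (suc a) (replicate R 0) α (linked-zeros c R) (length-replicate R)
             (subst (_< R) (sym (total-zeros R)) (>-nonZero⁻¹ R))
             (subst₂ (λ x y → suc x + y ≤ R) (length-replicate a) (sym (total-zeros R)) (subst (_≤ R) (sym (+-identityʳ _)) fits)) ⟩
      H (suc a) (kostka (replicate R 0)) α
        ≡⟨ H-cong (suc a) α (λ γ l → trans (kostka-zeros R γ) (cong (λ k → 𝟙 (replicate k 0 ≟ᴸ γ)) l)) ⟩
      H (suc a) (λ γ → 𝟙 (replicate (length α) 0 ≟ᴸ γ)) α
        ≡⟨ H-one (suc a) α ⟩
      𝟙 (total α ≟ suc a)
        ≡⟨ sym (ribbon-row a α) ⟩
      ribbon (replicate a false) α ∎
    induct zero .(replicate a false ++ true ∷ p) α e fits | first a p with () ← trans (sym (descents-++ a (true ∷ p))) e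
    -- Turning the first descent into an ascent, or cutting the pattern there, leaves one descent
    -- less. Both cases are known by induction, and the remaining summand is obtained by
    -- cancellation.
    induct (suc d) .(replicate a false ++ true ∷ p) α e fits | first a p = +-cancelʳ-≡ (ribbon (replicate a false ++ false ∷ p) α) _ _ (begin
      sumMatch (replicate a false ++ true ∷ p) R (grown α) + ribbon (replicate a false ++ false ∷ p) α
        ≡⟨ cong (sumMatch (replicate a false ++ true ∷ p) R (grown α) +_) (sym (induct d (replicate a false ++ false ∷ p) α
             (trans (descents-++ a (false ∷ p)) fewer) (subst (λ k → suc k ≤ R) (trans (extent true) (sym (extent false))) fits))) ⟩
      sumMatch (replicate a false ++ true ∷ p) R (grown α) + sumMatch (replicate a false ++ false ∷ p) R (grown α)
        ≡⟨ grown-split a p α fits′ (λ γ → induct d p γ fewer (m+n≤o⇒n≤o (suc a) fits′)) ⟩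
      H (suc a) (ribbon p) α
        ≡⟨ ribbon-split a p α ⟩
      ribbon (replicate a false ++ true ∷ p) α + ribbon (replicate a false ++ false ∷ p) α ∎)
      where
      extent : ∀ b → length (replicate a false ++ b ∷ p) ≡ a + suc (length p)
      extent b = trans (length-++ (replicate a false)) (cong (_+ suc (length p)) (length-replicate a))
      fewer : descents p ≡ d
      fewer = suc-injective (trans (sym (descents-++ a (true ∷ p))) e)
      fits′ : suc a + suc (length p) ≤ R
      fits′ = subst (λ k → suc k ≤ R) (extent true) fits

-- Ribbons as words

firstLetter lastLetter : List ℕ → ℕ
firstLetter []      = 0
firstLetter (x ∷ u) = x
lastLetter []          = 0
lastLetter (x ∷ [])    = x
lastLetter (x ∷ y ∷ u) = lastLetter (y ∷ u)

lastLetter-++ : ∀ u x v → lastLetter (u ++ x ∷ v) ≡ lastLetter (x ∷ v)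
lastLetter-++ []          x v = refl
lastLetter-++ (y ∷ [])    x v = refl
lastLetter-++ (y ∷ z ∷ u) x v = lastLetter-++ (z ∷ u) x v

matches-++ : ∀ p b q v u → length v ≡ suc (length p) → length u ≡ suc (length q) →
  matches (p ++ b ∷ q) (v ++ u) ≡ matches p v * (related b (lastLetter v) (firstLetter u) * matches q u)
matches-++ []      b q (x ∷ [])    (y ∷ u) _ _  = sym (*-identityˡ _)
matches-++ (c ∷ p) b q (x ∷ y ∷ v) u       l l′ =
  trans (cong (related c x y *_) (matches-++ p b q (y ∷ v) u (suc-injective l) l′)) (sym (*-assoc (related c x y) _ _))

sumMatch-suffix : ∀ p b a n f → sumMatch (p ++ b ∷ replicate a false) n f ≡
  sumInc (suc a) n λ u → sumMatch p n λ v → related b (lastLetter v) (firstLetter u) * f (v ++ u)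
sumMatch-suffix p b a n f = begin
  sumMatch (p ++ b ∷ replicate a false) n f
    ≡⟨ cong (λ k → sumW k n λ w → matches (p ++ b ∷ replicate a false) w * f w)
         (cong suc (trans (length-++ p) (cong (λ z → length p + suc z) (length-replicate a)))) ⟩
  sumW (suc (length p) + suc a) n (λ w → matches (p ++ b ∷ replicate a false) w * f w)
    ≡⟨ sumW-++ (suc (length p)) (suc a) n _ ⟩
  sumW (suc (length p)) n (λ v → sumW (suc a) n λ u → matches (p ++ b ∷ replicate a false) (v ++ u) * f (v ++ u))
    ≡⟨ (sumW-congᵇ (suc (length p)) n λ v (lv , _) → sumW-congᵇ (suc a) n λ u (lu , _) → trans
         (cong (_* f (v ++ u)) (trans
           (matches-++ p b (replicate a false) v u lv (trans lu (cong suc (sym (length-replicate a)))))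
           (cong (λ z → matches p v * (related b (lastLetter v) (firstLetter u) * z)) (matches-inc a u lu))))
         (regroup (matches p v) (related b (lastLetter v) (firstLetter u)) (𝟙 (inc? u)) (f (v ++ u)))) ⟩
  sumW (suc (length p)) n (λ v → sumW (suc a) n λ u → 𝟙 (inc? u) * (matches p v * (related b (lastLetter v) (firstLetter u) * f (v ++ u))))
    ≡⟨ trans (sumW-swap (suc (length p)) n (suc a) n _) (sumW-cong (suc a) n λ u → sumW-*ˡ (suc (length p)) n (𝟙 (inc? u)) _) ⟩
  sumW (suc a) n (λ u → 𝟙 (inc? u) * sumMatch p n λ v → related b (lastLetter v) (firstLetter u) * f (v ++ u))
    ≡⟨ sym (sumInc-def (suc a) n _) ⟩
  sumInc (suc a) n (λ u → sumMatch p n λ v → related b (lastLetter v) (firstLetter u) * f (v ++ u)) ∎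
  where
  open ≡-Reasoning
  regroup : ∀ m r i f → m * (r * i) * f ≡ i * (m * (r * f))
  regroup = solve-∀

content-++-comm : ∀ n u v → content n (u ++ v) ≡ content n (v ++ u)
content-++-comm n u v = content-cong n (u ++ v) (v ++ u) λ i _ →
  trans (occurrences-++ i u v) (trans (+-comm (occurrences i u) _) (sym (occurrences-++ i v u)))

-- `ribbon-split` attaches the new row in front of the word, that is, at the bottom of the ribbon,
-- while the recurrence needs it on top. Contents do not depend on the order of the letters, so both
-- ways of attaching it give the same product.
ribbon-suffix : ∀ p a α → H (suc a) (ribbon p) α ≡
  ribbon (p ++ true ∷ replicate a false) α + ribbon (p ++ false ∷ replicate a false) α
ribbon-suffix p a α = begin
  H (suc a) (ribbon p) α
    ≡⟨ trans (ribbon-split a p α) (sym (sumMatch-split a p n _)) ⟩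
  sumInc (suc a) n (λ u → sumMatch p n λ v → 𝟙 (content n (u ++ v) ≟ᴸ α))
    ≡⟨ (sumInc-cong (suc a) n λ u → trans
         (sumW-cong (suc (length p)) n λ v → trans
           (cong (λ c → matches p v * 𝟙 (c ≟ᴸ α)) (content-++-comm n u v))
           (trans (cong (matches p v *_) (trans (sym (*-identityˡ _)) (trans
             (cong (_* f (v ++ u)) (sym (related-total (lastLetter v) (firstLetter u)))) (*-distribʳ-+ (f (v ++ u)) (related true (lastLetter v) (firstLetter u)) _))))
             (*-distribˡ-+ (matches p v) (related true (lastLetter v) (firstLetter u) * f (v ++ u)) _)))
         (sumW-+ (suc (length p)) n _ _)) ⟩
  sumInc (suc a) n (λ u → sumMatch p n (λ v → related true (lastLetter v) (firstLetter u) * f (v ++ u)) +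
                          sumMatch p n (λ v → related false (lastLetter v) (firstLetter u) * f (v ++ u)))
    ≡⟨ sumInc-+ (suc a) n _ _ ⟩
  _ ≡⟨ sym (cong₂ _+_ (sumMatch-suffix p true a n f) (sumMatch-suffix p false a n f)) ⟩
  ribbon (p ++ true ∷ replicate a false) α + ribbon (p ++ false ∷ replicate a false) α ∎
  where
  open ≡-Reasoning
  n : ℕ
  n = length α
  f : List ℕ → ℕ
  f w = 𝟙 (content n w ≟ᴸ α)

-- A ribbon is given by the lengths of its rows minus one, from the top.  As
-- consecutive rows share one column, a row starts at the sum of the numbers below.
ribbonRows : List ℕ → Rows
ribbonRows []       = []
ribbonRows (s ∷ ss) = (total ss , suc s) ∷ ribbonRows ss

ribbonPattern : List ℕ → List Bool
ribbonPattern []            = []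
ribbonPattern (s ∷ [])      = replicate s false
ribbonPattern (s ∷ s′ ∷ ss) = ribbonPattern (s′ ∷ ss) ++ true ∷ replicate s false

-- Every row except the lowest has at least two cells. Then no column has three cells, even after
-- any further row is put on top.
Interior : List ℕ → Set
Interior []            = ⊤
Interior (s ∷ [])      = ⊤
Interior (s ∷ s′ ∷ ss) = 1 ≤ s × Interior (s′ ∷ ss)

-- The rows of a filling from bottom to top.
reading : List ℕ → List ℕ → List ℕ
reading []       w = w
reading (s ∷ ss) w = reading ss (drop (suc s) w) ++ take (suc s) w

fill-last : ∀ {P : Entry → Set} i m y u → All P (fill i m (y ∷ u)) → P ((i , length u + m) , lastLetter (y ∷ u))
fill-last i m y []      (p ∷ _)  = p
fill-last {P} i m y (z ∷ u) (_ ∷ ps) = subst (λ k → P ((i , k) , lastLetter (z ∷ u))) (+-suc (length u) m) (fill-last {P} i (suc m) z u ps)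

fill-end : ∀ i m y u → All (λ e → col e ≤ length u + m × (col e ≡ length u + m → val e ≡ lastLetter (y ∷ u))) (fill i m (y ∷ u))
fill-end i m y []      = (≤-refl , λ _ → refl) ∷ []
fill-end i m y (z ∷ u) = (m≤n+m m _ , λ e → contradiction e (<⇒≢ (m<n+m m z<s))) ∷
  subst (λ k → All (λ e → col e ≤ k × (col e ≡ k → val e ≡ lastLetter (z ∷ u))) (fill i (suc m) (z ∷ u))) (+-suc (length u) m)
    (fill-end i (suc m) z u)

ribbon-cols : ∀ i ss w b → total ss < b → All (λ e → col e < b) (fillRows i (ribbonRows ss) w)
ribbon-cols i ss w b t<b = zip-All (rowsCells i (ribbonRows ss)) w (go i ss t<b)
  where
  go : ∀ i ss → total ss < b → All (λ c → proj₂ c < b) (rowsCells i (ribbonRows ss))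
  go i []       _   = []
  go i (s ∷ ss) t<b = AllP.++⁺
    (AllP.map⁺ (All.map (λ c< → ≤-trans c< (≤-trans (≤-reflexive (trans (+-suc (total ss) s) (cong suc (+-comm (total ss) s)))) t<b)) (interval-< (total ss) (suc s))))
    (go (suc i) ss (≤-<-trans (m≤n+m (total ss) s) t<b))

-- The first cell of the upper row lies above the last cell of the next one, and this is the only
-- common column. The rows further down stay strictly to the left because, by `wide`, the next row
-- has at least two cells whenever there are such rows.
colLess-ribbon : ∀ i x u y u′ ss w → (ss ≢ [] → 1 ≤ length u′) →
  let m = length u′ + total ss ; T = fill (suc i) (total ss) (y ∷ u′) ++ fillRows (suc (suc i)) (ribbonRows ss) w in
  𝟙 (colLess? (fill i m (x ∷ u)) T) ≡ related true (lastLetter (y ∷ u′)) x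
colLess-ribbon i x u y u′ ss w wide = 𝟙-cong (colLess? (fill i m (x ∷ u)) (T₁ ++ T₂)) (x <? lastLetter (y ∷ u′))
  (λ { (first ∷ _) → fill-last {λ e → m ≡ col e → x < val e} (suc i) (total ss) y u′ (AllP.++⁻ˡ T₁ first) refl })
  (λ x<y → AllP.++⁺ (All.map (λ (_ , end) e → subst (x <_) (sym (end (sym e))) x<y) (fill-end (suc i) (total ss) y u′))
             (All.map (λ c<m e → contradiction (sym e) (<⇒≢ c<m)) (right ss wide)) ∷
           All.map (λ m<c → AllP.++⁺ (All.map (λ (c≤m , _) e → contradiction (sym e) (<⇒≢ (≤-<-trans c≤m m<c))) (fill-end (suc i) (total ss) y u′))
             (All.map (λ c<m e → contradiction (sym e) (<⇒≢ (<-trans c<m m<c))) (right ss wide))) (fill-col≥ i (suc m) u))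
  where
  m : ℕ
  m = length u′ + total ss
  T₁ T₂ : List Entry
  T₁ = fill (suc i) (total ss) (y ∷ u′)
  T₂ = fillRows (suc (suc i)) (ribbonRows ss) w
  right : ∀ ss → (ss ≢ [] → 1 ≤ length u′) → All (λ e → col e < length u′ + total ss) (fillRows (suc (suc i)) (ribbonRows ss) w)
  right []       _    = []
  right (s ∷ ss) wide = ribbon-cols (suc (suc i)) (s ∷ ss) w (length u′ + total (s ∷ ss)) (+-monoˡ-≤ (total (s ∷ ss)) (wide λ ()))

take-length : ∀ k (u w : List ℕ) → length u ≡ k → take k (u ++ w) ≡ u × drop k (u ++ w) ≡ w
take-length zero    []      w e = refl , refl
take-length (suc k) (x ∷ u) w e with t , d ← take-length k u w (suc-injective e) = cong (x ∷_) t , d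

split-word : ∀ k m (w : List ℕ) → length w ≡ k + m → ∃[ u ] ∃[ v ] w ≡ u ++ v × length u ≡ k × length v ≡ m
split-word zero    m w       e = [] , w , refl , refl , e
split-word (suc k) m (x ∷ w) e with u , v , refl , lu , lv ← split-word k m w (suc-injective e) = x ∷ u , v , refl , cong suc lu , lv

reading-++ : ∀ s ss u w → length u ≡ suc s → reading (s ∷ ss) (u ++ w) ≡ reading ss w ++ u
reading-++ s ss u w e with t , d ← take-length (suc s) u w e = cong₂ (λ a b → reading ss a ++ b) d t

-- Induction from the top row downwards. As the reading puts upper rows last, the letters of the top
-- row and the descent at the junction can be absorbed into the summand `ψ` for the remaining rows;
-- this is why `ψ` is arbitrary.
ribbon-fillings : ∀ i s ss n ψ → Interior ss →
  sumW (rowsSize (ribbonRows (s ∷ ss))) n (λ w → 𝟙 (good? (fillRows i (ribbonRows (s ∷ ss)) w)) * ψ (reading (s ∷ ss) w)) ≡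
  sumMatch (ribbonPattern (s ∷ ss)) n ψ
ribbon-fillings i s [] n ψ ok = begin
  sumW (suc s + 0) n (λ w → 𝟙 (good? (fillRows i (ribbonRows (s ∷ [])) w)) * ψ (reading (s ∷ []) w))
    ≡⟨ trans (sumW-++ (suc s) 0 n _) (sumW-cong (suc s) n λ u → sumW-zero n _) ⟩
  sumW (suc s) n (λ u → 𝟙 (good? (fillRows i (ribbonRows (s ∷ [])) (u ++ []))) * ψ (reading (s ∷ []) (u ++ [])))
    ≡⟨ (sumW-congᵇ (suc s) n λ u (lu , _) → cong₂ _*_
         (trans (𝟙-good-++ i 0 (suc s) [] u [] lu) (trans (cong (𝟙 (inc? u) *_) (trans (*-identityˡ (𝟙 (colLess? (fill i 0 u) [])))
           (𝟙-yes (colLess? (fill i 0 u) []) (All.universal (λ _ → []) _)))) (*-identityʳ (𝟙 (inc? u)))))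
         (cong ψ (reading-++ s [] u [] lu))) ⟩
  sumW (suc s) n (λ u → 𝟙 (inc? u) * ψ u)
    ≡⟨ sym (trans (sumMatch-inc s n ψ) (sumInc-def (suc s) n ψ)) ⟩
  sumMatch (replicate s false) n ψ ∎
  where open ≡-Reasoning
ribbon-fillings i s (s′ ∷ ss) n ψ ok = begin
  sumW (suc s + k) n (λ w → 𝟙 (good? (fillRows i (ribbonRows (s ∷ s′ ∷ ss)) w)) * ψ (reading (s ∷ s′ ∷ ss) w))
    ≡⟨ sumW-++ (suc s) k n _ ⟩
  sumW (suc s) n (λ u → sumW k n λ w → 𝟙 (good? (fillRows i (ribbonRows (s ∷ s′ ∷ ss)) (u ++ w))) * ψ (reading (s ∷ s′ ∷ ss) (u ++ w)))
    ≡⟨ (sumW-congᵇ (suc s) n λ u (lu , _) → trans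
         (trans (sumW-congᵇ k n λ w (lw , _) → top-row u w lu lw) (sumW-*ˡ k n (𝟙 (inc? u)) _))
         (cong (𝟙 (inc? u) *_) (ribbon-fillings (suc i) s′ ss n (λ v → related true (lastLetter v) (firstLetter u) * ψ (v ++ u)) (tail-interior ss ok)))) ⟩
  sumW (suc s) n (λ u → 𝟙 (inc? u) * sumMatch p n λ v → related true (lastLetter v) (firstLetter u) * ψ (v ++ u))
    ≡⟨ trans (sym (sumInc-def (suc s) n _)) (sym (sumMatch-suffix p true s n ψ)) ⟩
  sumMatch (p ++ true ∷ replicate s false) n ψ ∎
  where
  open ≡-Reasoning
  k : ℕ
  k = rowsSize (ribbonRows (s′ ∷ ss))
  p : List Bool
  p = ribbonPattern (s′ ∷ ss)
  tail-interior : ∀ ss → Interior (s′ ∷ ss) → Interior ss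
  tail-interior []       _        = tt
  tail-interior (_ ∷ _) (_ , ok) = ok
  wide : ∀ ss → Interior (s′ ∷ ss) → ss ≢ [] → 1 ≤ s′
  wide []       _       ne = contradiction refl ne
  wide (_ ∷ _) (s≥ , _) _  = s≥
  top-row : ∀ u w → length u ≡ suc s → length w ≡ k →
    𝟙 (good? (fillRows i (ribbonRows (s ∷ s′ ∷ ss)) (u ++ w))) * ψ (reading (s ∷ s′ ∷ ss) (u ++ w)) ≡
    𝟙 (inc? u) * (𝟙 (good? (fillRows (suc i) (ribbonRows (s′ ∷ ss)) w)) *
      (related true (lastLetter (reading (s′ ∷ ss) w)) (firstLetter u) * ψ (reading (s′ ∷ ss) w ++ u)))
  top-row u w lu lw = trans
    (cong₂ _*_ (𝟙-good-++ i (s′ + total ss) (suc s) (ribbonRows (s′ ∷ ss)) u w lu) (cong ψ (reading-++ s (s′ ∷ ss) u w lu)))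
    (trans (regroup (𝟙 (inc? u)) (𝟙 (good? T)) _ _)
           (cong (λ z → 𝟙 (inc? u) * (𝟙 (good? T) * (z * ψ (reading (s′ ∷ ss) w ++ u)))) (junction u lu)))
    where
    T : List Entry
    T = fillRows (suc i) (ribbonRows (s′ ∷ ss)) w
    regroup : ∀ a b c d → a * (b * c) * d ≡ a * (b * (c * d))
    regroup = solve-∀
    junction : ∀ u → length u ≡ suc s →
      𝟙 (colLess? (fill i (s′ + total ss) u) T) ≡ related true (lastLetter (reading (s′ ∷ ss) w)) (firstLetter u)
    junction (x ∷ u) lu with split-word (suc s′) (rowsSize (ribbonRows ss)) w lw
    ... | y ∷ u′ , w′ , refl , lu′ , lw′ = begin
      𝟙 (colLess? (fill i (s′ + total ss) (x ∷ u)) (fillRows (suc i) (ribbonRows (s′ ∷ ss)) (y ∷ u′ ++ w′)))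
        ≡⟨ cong₂ (λ a b → 𝟙 (colLess? (fill i (a + total ss) (x ∷ u)) b)) (sym (suc-injective lu′))
             (fillRows-++ (suc i) (total ss) (suc s′) (ribbonRows ss) (y ∷ u′) w′ lu′) ⟩
      _ ≡⟨ colLess-ribbon i x u y u′ ss w′ (λ ne → subst (1 ≤_) (sym (suc-injective lu′)) (wide ss ok ne)) ⟩
      related true (lastLetter (y ∷ u′)) x
        ≡⟨ cong (λ l → related true l x) (sym (trans (cong lastLetter (reading-++ s′ ss (y ∷ u′) w′ lu′)) (lastLetter-++ (reading ss w′) y u′))) ⟩
      related true (lastLetter (reading (s′ ∷ ss) (y ∷ u′ ++ w′))) x ∎

content-reading : ∀ n ss w → content n (reading ss w) ≡ content n w
content-reading n ss w = content-cong n (reading ss w) w λ i _ → go i ss w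
  where
  go : ∀ i ss w → occurrences i (reading ss w) ≡ occurrences i w
  go i []       w = refl
  go i (s ∷ ss) w = begin
    occurrences i (reading ss (drop (suc s) w) ++ take (suc s) w)               ≡⟨ occurrences-++ i (reading ss (drop (suc s) w)) _ ⟩
    occurrences i (reading ss (drop (suc s) w)) + occurrences i (take (suc s) w) ≡⟨ cong (_+ occurrences i (take (suc s) w)) (go i ss (drop (suc s) w)) ⟩
    occurrences i (drop (suc s) w) + occurrences i (take (suc s) w)             ≡⟨ +-comm (occurrences i (drop (suc s) w)) _ ⟩
    occurrences i (take (suc s) w) + occurrences i (drop (suc s) w)             ≡⟨ sym (occurrences-++ i (take (suc s) w) _) ⟩
    occurrences i (take (suc s) w ++ drop (suc s) w)                            ≡⟨ cong (occurrences i) (take++drop≡id (suc s) w) ⟩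
    occurrences i w ∎
    where open ≡-Reasoning

positive : List ℕ → List ℕ
positive = filter (0 <?_)

positive-suc : ∀ x xs → positive (suc x ∷ xs) ≡ suc x ∷ positive xs
positive-suc x xs = refl

positive-zero : ∀ xs → Linked _≥_ (0 ∷ xs) → positive (0 ∷ xs) ≡ []
positive-zero xs link = filter-none (0 <?_) (All.map ≤⇒≯ (linked-≤ link))

ribbonOuter ribbonStarts : List ℕ → List ℕ
ribbonOuter []       = []
ribbonOuter (s ∷ ss) = suc (total (s ∷ ss)) ∷ ribbonOuter ss
ribbonStarts []       = []
ribbonStarts (s ∷ ss) = total ss ∷ ribbonStarts ss

-- The lowest row starts in column 0, and zeros are not parts of a partition. The starting columns
-- decrease weakly, so `positive` removes only a tail of the list.
ribbonShape : List ℕ → Skew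
ribbonShape ss = ribbonOuter ss , positive (ribbonStarts ss)

starts-linked : ∀ ss → Linked _≥_ (total ss ∷ ribbonStarts ss)
starts-linked []       = [-]
starts-linked (s ∷ ss) = m≤n+m (total ss) s ∷ starts-linked ss

ribbon-prefix : ∀ ss → Prefix _≤_ (positive (ribbonStarts ss)) (ribbonOuter ss)
ribbon-prefix []       = []
ribbon-prefix (s ∷ ss) with total ss in eq | starts-linked ss
... | zero  | link rewrite positive-zero (ribbonStarts ss) link = []
... | suc t | link rewrite positive-suc t (ribbonStarts ss) = m≤n⇒m≤1+n (m≤n+m (suc t) s) ∷ ribbon-prefix ss

rowsOf-ribbon : ∀ ss → rowsOf (ribbonOuter ss) (positive (ribbonStarts ss)) ≡ ribbonRows ss
rowsOf-ribbon []       = refl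
rowsOf-ribbon (s ∷ ss) with total ss in eq | starts-linked ss
... | zero  | link rewrite positive-zero (ribbonStarts ss) link = cong₂ _∷_ (cong (λ z → 0 , suc z) (+-identityʳ s))
        (trans (cong (rowsOf (ribbonOuter ss)) (sym (filter-none (0 <?_) (All.map ≤⇒≯ (linked-≤ link))))) (rowsOf-ribbon ss))
... | suc t | link rewrite positive-suc t (ribbonStarts ss) = cong₂ _∷_ (cong (suc t ,_) (m+n∸n≡m (suc s) (suc t))) (rowsOf-ribbon ss)

ribbon-tableaux : ∀ s ss α → Interior ss → length (tableaux (ribbonShape (s ∷ ss)) α) ≡ ribbon (ribbonPattern (s ∷ ss)) α
ribbon-tableaux s ss α ok = begin
  length (tableaux (ribbonShape (s ∷ ss)) α)
    ≡⟨ tableaux-rows (ribbonOuter (s ∷ ss)) (positive (ribbonStarts (s ∷ ss))) α (ribbon-prefix (s ∷ ss)) ⟩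
  sumW (rowsSize (rowsOf (ribbonOuter (s ∷ ss)) (positive (ribbonStarts (s ∷ ss))))) n (F (rowsOf (ribbonOuter (s ∷ ss)) (positive (ribbonStarts (s ∷ ss)))))
    ≡⟨ cong (λ ρ → sumW (rowsSize ρ) n (F ρ)) (rowsOf-ribbon (s ∷ ss)) ⟩
  sumW (rowsSize (ribbonRows (s ∷ ss))) n (F (ribbonRows (s ∷ ss)))
    ≡⟨ (sumW-cong (rowsSize (ribbonRows (s ∷ ss))) n λ w → cong (λ c → 𝟙 (good? (fillRows 0 (ribbonRows (s ∷ ss)) w)) * 𝟙 (c ≟ᴸ α))
         (sym (content-reading n (s ∷ ss) w))) ⟩
  sumW (rowsSize (ribbonRows (s ∷ ss))) n (λ w → 𝟙 (good? (fillRows 0 (ribbonRows (s ∷ ss)) w)) * 𝟙 (content n (reading (s ∷ ss) w) ≟ᴸ α))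
    ≡⟨ ribbon-fillings 0 s ss n (λ v → 𝟙 (content n v ≟ᴸ α)) ok ⟩
  ribbon (ribbonPattern (s ∷ ss)) α ∎
  where
  open ≡-Reasoning
  n : ℕ
  n = length α
  F : Rows → List ℕ → ℕ
  F ρ w = 𝟙 (good? (fillRows 0 ρ w)) * 𝟙 (content n w ≟ᴸ α)

-- Skew hooks

part-beyond : ∀ λs i → length λs ≤ i → part λs i ≡ 0
part-beyond []       i       _       = refl
part-beyond (l ∷ λs) (suc i) (s≤s b) = part-beyond λs i b

part-within : ∀ λs i → 0 < part λs i → i < length λs
part-within λs i pos = ≰⇒> λ b → <⇒≢ pos (sym (part-beyond λs i b))

part-antitone : ∀ {λs} → Linked _≥_ λs → ∀ {i j} → i ≤ j → part λs j ≤ part λs i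
part-antitone {[]}     link {i}     {j}     _         = z≤n
part-antitone {l ∷ λs} link {zero}  {zero}  _         = ≤-refl
part-antitone {l ∷ λs} link {zero}  {suc j} _         = bound λs (linked-≤ link) j
  where
  bound : ∀ λs → All (_≤ l) λs → ∀ j → part λs j ≤ l
  bound []       []       j       = z≤n
  bound (x ∷ λs) (b ∷ bs) zero    = b
  bound (x ∷ λs) (b ∷ bs) (suc j) = bound λs bs j
part-antitone {l ∷ λs} link {suc i} {suc j} (s≤s i≤j) = part-antitone (linked-tail link) i≤j

part-positive : ∀ λs → All (0 <_) λs → ∀ i → i < length λs → 0 < part λs i
part-positive (l ∷ λs) (p ∷ ps) zero    _         = p
part-positive (l ∷ λs) (p ∷ ps) (suc i) (s≤s i<) = part-positive λs ps i i<

positive-part : ∀ μ → Linked _≥_ μ → ∀ i → part (positive μ) i ≡ part μ i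
positive-part []          link i = refl
positive-part (zero ∷ μ)  link i = trans (cong (λ z → part z i) (positive-zero μ link)) (sym (zeros i))
  where
  zeros : ∀ i → part (0 ∷ μ) i ≡ 0
  zeros i = n≤0⇒n≡0 (part-antitone link {0} {i} z≤n)
positive-part (suc x ∷ μ) link zero    = refl
positive-part (suc x ∷ μ) link (suc i) = positive-part μ (linked-tail link) i

∈-cells⁻ : ∀ λs μs {i j} → (i , j) ∈ cells (λs , μs) → part μs i ≤ j × j < part λs i
∈-cells⁻ λs μs {i} {j} c∈ with i′ , _ , c∈row ← find (∈-concatMap⁻ (λ i → map (i ,_) (filter (part μs i ≤?_) (upTo (part λs i)))) {xs = upTo (length λs)} c∈)
  with j′ , j∈ , refl ← ∈-map⁻ (i′ ,_) c∈row
  with j∈upTo , μ≤j ← ∈-filter⁻ (part μs i ≤?_) {xs = upTo (part λs i)} j∈ = μ≤j , ∈-upTo⁻ j∈upTo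

∈-cells⁺ : ∀ λs μs {i j} → part μs i ≤ j → j < part λs i → (i , j) ∈ cells (λs , μs)
∈-cells⁺ λs μs {i} {j} μ≤j j<λ = ∈-concatMap⁺ (λ i → map (i ,_) (filter (part μs i ≤?_) (upTo (part λs i))))
  (lose (∈-upTo⁺ (part-within λs i (≤-<-trans z≤n j<λ)))
        (∈-map⁺ (i ,_) (∈-filter⁺ (part μs i ≤?_) (∈-upTo⁺ j<λ) μ≤j)))

length-outer : ∀ ss → length (ribbonOuter ss) ≡ length ss
length-outer []       = refl
length-outer (s ∷ ss) = cong suc (length-outer ss)

outer-starts : ∀ ss i → suc i < length ss → part (ribbonOuter ss) (suc i) ≡ suc (part (ribbonStarts ss) i)
outer-starts (s ∷ s′ ∷ ss) zero    _        = refl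
outer-starts (s ∷ ss)      (suc i) (s≤s b) = outer-starts ss i b

starts<outer : ∀ ss i → i < length ss → part (ribbonStarts ss) i < part (ribbonOuter ss) i
starts<outer (s ∷ ss) zero    _        = s≤s (m≤n+m (total ss) s)
starts<outer (s ∷ ss) (suc i) (s≤s b) = starts<outer ss i b

outer-partition : ∀ ss → Partition (ribbonOuter ss)
outer-partition ss = linked ss , pos ss
  where
  linked : ∀ ss → Linked _≥_ (ribbonOuter ss)
  linked []            = []
  linked (s ∷ [])      = [-]
  linked (s ∷ s′ ∷ ss) = s≤s (m≤n+m _ s) ∷ linked (s′ ∷ ss)
  pos : ∀ ss → All (0 <_) (ribbonOuter ss)
  pos []       = []
  pos (s ∷ ss) = z<s ∷ pos ss

positive-partition : ∀ μ → Linked _≥_ μ → Partition (positive μ)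
positive-partition μ link = LinkedP.filter⁺ (0 <?_) (λ a b → ≤-trans b a) link , AllP.all-filter (0 <?_) μ

module RibbonCells (s : ℕ) (ss : List ℕ) where

  private
    S : List ℕ
    S = s ∷ ss
    D : Skew
    D = ribbonShape S
    L M : ℕ → ℕ
    L = part (ribbonOuter S)
    M = part (ribbonStarts S)
    ℓ : ℕ
    ℓ = length ss
    link : Linked _≥_ (ribbonStarts S)
    link = linked-tail (starts-linked S)

  cell⁻ : ∀ {i j} → (i , j) ∈ cells D → M i ≤ j × j < L i
  cell⁻ {i} {j} c∈ with m≤ , <l ← ∈-cells⁻ (ribbonOuter S) (positive (ribbonStarts S)) c∈ =
    subst (_≤ j) (positive-part (ribbonStarts S) link i) m≤ , <l

  cell⁺ : ∀ {i j} → M i ≤ j → j < L i → (i , j) ∈ cells D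
  cell⁺ {i} {j} m≤ <l = ∈-cells⁺ (ribbonOuter S) (positive (ribbonStarts S)) (subst (_≤ j) (sym (positive-part (ribbonStarts S) link i)) m≤) <l

  cell-row : ∀ {i j} → (i , j) ∈ cells D → i ≤ ℓ
  cell-row {i} c∈ = s≤s⁻¹ (subst (i <_) (length-outer S) (part-within (ribbonOuter S) i (≤-<-trans z≤n (proj₂ (cell⁻ c∈)))))

  no2×2 : No2×2 D
  no2×2 = All.tabulate λ { {i , j} c∈ (_ , _ , d∈) →
    let M≤j , _ = cell⁻ c∈ ; _ , j<L = cell⁻ d∈
    in <⇒≱ (s≤s⁻¹ (subst (suc j <_) (outer-starts S i (s≤s (cell-row d∈))) j<L)) M≤j }

  M-last : M ℓ ≡ 0
  M-last = last s ss
    where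
    last : ∀ s ss → part (ribbonStarts (s ∷ ss)) (length ss) ≡ 0
    last s []        = refl
    last s (s′ ∷ ss) = last s′ ss

  private
    adjacent-left : ∀ i j → Adjacent (i , suc j) (i , j)
    adjacent-left i j = cong₂ _+_ (∣n-n∣≡0 i) (trans (∣-∣-comm (suc j) j) (trans (m≤n⇒∣m-n∣≡n∸m (n≤1+n j)) (m+n∸n≡m 1 j)))

    adjacent-down : ∀ i j → Adjacent (i , j) (suc i , j)
    adjacent-down i j = cong₂ _+_ (trans (m≤n⇒∣m-n∣≡n∸m (n≤1+n i)) (m+n∸n≡m 1 i)) (∣n-n∣≡0 j)

    step-sym : ∀ {x y} → Step D x y → Step D y x
    step-sym {i , j} {i′ , j′} (x∈ , y∈ , a) = y∈ , x∈ , trans (cong₂ _+_ (∣-∣-comm i′ i) (∣-∣-comm j′ j)) a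

    -- The path goes left to the first cell of the row and from there down to the last cell of the
    -- next row, until it ends in the lower left corner. `d` counts the rows below and `e` the cells
    -- to the left.
    to-root : ∀ d i e → i + d ≡ ℓ → M i + e < L i → Star (Step D) (i , M i + e) (ℓ , 0)
    to-root d i (suc e) i+d b = (cell⁺ (m≤m+n _ _) b , cell⁺ (m≤m+n _ _) b′ ,
        subst (λ k → Adjacent (i , k) (i , M i + e)) (sym (+-suc (M i) e)) (adjacent-left i (M i + e))) ◅ to-root d i e i+d b′
      where
      b′ : M i + e < L i
      b′ = <-trans (subst (M i + e <_) (sym (+-suc (M i) e)) ≤-refl) b
    to-root zero i zero i+d b rewrite trans (sym (+-identityʳ i)) i+d = subst (λ k → Star (Step D) (ℓ , k) (ℓ , 0)) (sym (trans (+-identityʳ (M ℓ)) M-last)) ε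
    to-root (suc d) i zero i+d b = subst (λ k → Star (Step D) (i , k) (ℓ , 0)) (sym (+-identityʳ (M i)))
        ((cell⁺ ≤-refl (subst (_< L i) (+-identityʳ (M i)) b) , cell⁺ M′≤M M<L′ , adjacent-down i (M i)) ◅
         subst (λ k → Star (Step D) (suc i , k) (ℓ , 0)) (m+[n∸m]≡n M′≤M)
           (to-root d (suc i) (M i ∸ M (suc i)) (trans (sym (+-suc i d)) i+d) (subst (_< L (suc i)) (sym (m+[n∸m]≡n M′≤M)) M<L′)))
      where
      M′≤M : M (suc i) ≤ M i
      M′≤M = part-antitone link (n≤1+n i)
      M<L′ : M i < L (suc i)
      M<L′ = ≤-reflexive (sym (outer-starts S i (s≤s (≤-trans (m≤m+n (suc i) d) (≤-reflexive (trans (sym (+-suc i d)) i+d))))))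

    root : ∀ {x} → x ∈ cells D → Star (Step D) x (ℓ , 0)
    root {i , j} c∈ with M≤j , j<L ← cell⁻ c∈ = subst (λ k → Star (Step D) (i , k) (ℓ , 0)) (m+[n∸m]≡n M≤j)
      (to-root (ℓ ∸ i) i (j ∸ M i) (m+[n∸m]≡n (cell-row c∈)) (subst (_< L i) (sym (m+[n∸m]≡n M≤j)) j<L))

  connected : Connected D
  connected = All.tabulate λ x∈ → All.tabulate λ y∈ → root x∈ ◅◅ reverse (λ {x} {y} → step-sym {x} {y}) (root y∈)

  normalized : Normalized D
  normalized = lose (cell⁺ {0} ≤-refl (starts<outer S 0 z<s)) refl ,
               lose (cell⁺ {ℓ} (≤-reflexive M-last) (subst (_< L ℓ) M-last (starts<outer S ℓ ≤-refl))) refl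

  skewHook : SkewHook D
  skewHook = (outer-partition S , positive-partition (ribbonStarts S) link , ribbon-prefix S) , normalized , connected , no2×2

-- A step changes the row by at most one, so the first step that leaves the rows up to `i` goes
-- straight down from row `i`.
crossing : ∀ D {x y i} → Star (Step D) x y → proj₁ x ≤ i → i < proj₁ y → ∃[ j ] (i , j) ∈ cells D × (suc i , j) ∈ cells D
crossing D ε x≤i i<x = contradiction x≤i (<⇒≱ i<x)
crossing D {x = a , b} {i = i} (_◅_ {j = a′ , b′} (x∈ , z∈ , adj) path) a≤i i<y with a′ ≤? i
... | yes a′≤i = crossing D path a′≤i i<y
... | no a′≰i  = b , subst (λ k → (k , b) ∈ cells D) (sym i≡a) x∈ , subst₂ (λ k l → (k , l) ∈ cells D) (trans a′≡ (cong suc (sym i≡a))) (sym b≡b′) z∈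
  where
  i<a′ : i < a′
  i<a′ = ≰⇒> a′≰i
  a<a′ : a < a′
  a<a′ = ≤-<-trans a≤i i<a′
  diff : ∣ a - a′ ∣ ≡ a′ ∸ a
  diff = m≤n⇒∣m-n∣≡n∸m (<⇒≤ a<a′)
  one : a′ ∸ a ≡ 1
  one = ≤-antisym (≤-trans (≤-reflexive (sym diff)) (≤-trans (m≤m+n _ _) (≤-reflexive adj))) (m<n⇒0<n∸m a<a′)
  a′≡ : a′ ≡ suc a
  a′≡ = trans (sym (m∸n+n≡m (<⇒≤ a<a′))) (cong (_+ a) one)
  i≡a : i ≡ a
  i≡a = ≤-antisym (s≤s⁻¹ (subst (i <_) a′≡ i<a′)) a≤i
  b≡b′ : b ≡ b′
  b≡b′ = ∣m-n∣≡0⇒m≡n (+-cancelˡ-≡ 1 _ _ (trans (cong (_+ ∣ b - b′ ∣) (sym (trans diff one))) adj))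

-- A path from the top row to the lowest one crosses from row i to row i + 1 in a column common to
-- both, so the rows overlap. Two common columns would produce a square of four cells, so they
-- overlap in exactly one. The lowest row starts in column 0 because some row does and the starts
-- decrease weakly.
consecutive-rows : ∀ λs μs → SkewHook (λs , μs) → ∃[ ℓ ] length λs ≡ suc ℓ × part μs ℓ ≡ 0 ×
  (∀ i → suc i < length λs → part λs (suc i) ≡ suc (part μs i))
consecutive-rows λs μs (((linkλ , posλ) , (linkμ , posμ) , pre) , (row0 , col0) , conn , none)
  with (i₁ , j₁) , x∈ , refl ← find row0 | (i₀ , j₀) , y∈ , refl ← find col0 = go (length λs) refl
  where
  go : ∀ n → length λs ≡ n → ∃[ ℓ ] length λs ≡ suc ℓ × part μs ℓ ≡ 0 ×
       (∀ i → suc i < length λs → part λs (suc i) ≡ suc (part μs i))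
  go zero    e = contradiction (part-within λs i₀ (≤-<-trans z≤n (proj₂ (∈-cells⁻ λs μs y∈)))) λ b → n≮0 (subst (i₀ <_) e b)
  go (suc ℓ) e = ℓ , e , μℓ , λ i b → ≤-antisym (upper i b) (lower i b)
    where
    μℓ : part μs ℓ ≡ 0
    μℓ = n≤0⇒n≡0 (≤-trans (part-antitone linkμ (s≤s⁻¹ (subst (i₀ <_) e (part-within λs i₀ (≤-<-trans z≤n (proj₂ (∈-cells⁻ λs μs y∈)))))))
                          (proj₁ (∈-cells⁻ λs μs y∈)))
    corner : (ℓ , 0) ∈ cells (λs , μs)
    corner = ∈-cells⁺ λs μs (≤-reflexive μℓ) (part-positive λs posλ ℓ (≤-reflexive (sym e)))
    lower : ∀ i → suc i < length λs → suc (part μs i) ≤ part λs (suc i)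
    lower i b with j , c∈ , d∈ ← crossing (λs , μs) (All.lookup (All.lookup conn x∈) corner) z≤n (s≤s⁻¹ (subst (suc i <_) e b)) =
      ≤-<-trans (proj₁ (∈-cells⁻ λs μs c∈)) (proj₂ (∈-cells⁻ λs μs d∈))
    upper : ∀ i → suc i < length λs → part λs (suc i) ≤ suc (part μs i)
    upper i b = ≮⇒≥ λ wide → All.lookup none
      (∈-cells⁺ λs μs ≤-refl (<-trans (n<1+n _) (<-≤-trans wide down)))
      ( ∈-cells⁺ λs μs (n≤1+n _) (<-≤-trans wide down)
      , ∈-cells⁺ λs μs (part-antitone linkμ (n≤1+n i)) (<-trans (n<1+n _) wide)
      , ∈-cells⁺ λs μs (≤-trans (part-antitone linkμ (n≤1+n i)) (n≤1+n _)) wide)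
      where
      down : part λs (suc i) ≤ part λs i
      down = part-antitone linkλ (n≤1+n i)

skewHook-ribbon : ∀ λs μs → SkewHook (λs , μs) → ∃[ s ] ∃[ ss ] (λs , μs) ≡ ribbonShape (s ∷ ss)
skewHook-ribbon λs μs hook@(((linkλ , posλ) , (linkμ , posμ) , _) , _) with ℓ , e , μℓ , steps ← consecutive-rows λs μs hook =
  rebuild ℓ λs μs e linkλ posλ posμ μℓ steps
  where
  tailOf : List ℕ → List ℕ
  tailOf = drop 1
  part-tail : ∀ μs i → part (tailOf μs) i ≡ part μs (suc i)
  part-tail []       i = refl
  part-tail (m ∷ μs) i = refl
  all-tail : ∀ μs → All (0 <_) μs → All (0 <_) (tailOf μs)
  all-tail []       ps       = []
  all-tail (m ∷ μs) (_ ∷ ps) = ps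
  none : ∀ μs → All (0 <_) μs → part μs 0 ≡ 0 → μs ≡ []
  none []       ps      e = refl
  none (m ∷ μs) (p ∷ _) e = contradiction (sym e) (<⇒≢ p)
  cons : ∀ t rest μs → All (0 <_) μs → part μs 0 ≡ t → tailOf μs ≡ positive rest → positive (t ∷ rest) ≡ μs
  cons zero    rest μs       ps       e e′ with refl ← none μs ps e = sym e′
  cons (suc t) rest (m ∷ μs) (_ ∷ ps) refl e′ = cong (suc t ∷_) (sym e′)
  rebuild : ∀ ℓ λs μs → length λs ≡ suc ℓ → Linked _≥_ λs → All (0 <_) λs → All (0 <_) μs → part μs ℓ ≡ 0 →
    (∀ i → suc i < length λs → part λs (suc i) ≡ suc (part μs i)) → ∃[ s ] ∃[ ss ] (λs , μs) ≡ ribbonShape (s ∷ ss)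
  rebuild zero (zero ∷ []) μs e link (() ∷ _) posμ μℓ steps
  rebuild zero (suc l ∷ []) μs e link _ posμ μℓ steps =
    l , [] , cong₂ _,_ (cong (λ z → suc z ∷ []) (sym (+-identityʳ l))) (none μs posμ μℓ)
  rebuild (suc ℓ) (suc l ∷ l′ ∷ λs) μs e (l′≤l ∷ link) (_ ∷ posλ) posμ μℓ steps
    with s′ , ss , eq ← rebuild ℓ (l′ ∷ λs) (tailOf μs) (suc-injective e) link posλ (all-tail μs posμ) (trans (part-tail μs ℓ) μℓ)
                         (λ i b → trans (steps (suc i) (s≤s b)) (cong suc (sym (part-tail μs i))))
    -- The top row ends in column `l` and starts in column `t`, the last column of the next row; its
    -- length minus one is the difference.
    = l ∸ t , s′ ∷ ss , cong₂ _,_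
        (cong₂ _∷_ (cong suc (sym (m∸n+n≡m t≤l))) (cong proj₁ eq))
        (sym (cons t (ribbonStarts (s′ ∷ ss)) μs posμ μ0 (cong proj₂ eq)))
    where
    t : ℕ
    t = total (s′ ∷ ss)
    l′≡ : l′ ≡ suc t
    l′≡ = cong (λ D → part (proj₁ D) 0) eq
    μ0 : part μs 0 ≡ t
    μ0 = suc-injective (trans (sym (steps 0 (s≤s (s≤s z≤n)))) l′≡)
    t≤l : t ≤ l
    t≤l = s≤s⁻¹ (subst (_≤ suc l) l′≡ l′≤l)

-- Column sizes of ribbons

ribbonColumn : List ℕ → ℕ → ℕ
ribbonColumn []       j = 0
ribbonColumn (s ∷ ss) j = within (total ss) (s + total ss) j + ribbonColumn ss j

private
  interval-count : ∀ m r j → sumOver (interval m r) (λ k → 𝟙 (k ≟ j)) ≡ 𝟙 (m ≤? j) * 𝟙 (j <? m + r)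
  interval-count m zero    j = sym (trans (sym (𝟙-× (m ≤? j) (j <? m + 0)))
    (𝟙-no ((m ≤? j) ×-dec (j <? m + 0)) λ (m≤j , j<m) → <⇒≱ (subst (j <_) (+-identityʳ m) j<m) m≤j))
  interval-count m (suc r) j = trans (cong (𝟙 (m ≟ j) +_) (interval-count (suc m) r j)) (cases (m ≟ j))
    where
    cases : Dec (m ≡ j) → 𝟙 (m ≟ j) + 𝟙 (suc m ≤? j) * 𝟙 (j <? suc m + r) ≡ 𝟙 (m ≤? j) * 𝟙 (j <? m + suc r)
    cases (yes refl) = trans (cong₂ (λ a b → a + b * 𝟙 (m <? suc m + r)) (𝟙-yes (m ≟ m) refl) (𝟙-no (suc m ≤? m) (<-irrefl refl)))
      (sym (cong₂ _*_ (𝟙-yes (m ≤? m) ≤-refl) (𝟙-yes (m <? m + suc r) (m<m+n m z<s))))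
    cases (no m≢j) = cong₂ _+_ (𝟙-no (m ≟ j) m≢j) (cong₂ _*_
      (𝟙-cong (suc m ≤? j) (m ≤? j) <⇒≤ (λ m≤j → ≤∧≢⇒< m≤j m≢j))
      (𝟙-cong (j <? suc m + r) (j <? m + suc r) (subst (j <_) (sym (+-suc m r))) (subst (j <_) (+-suc m r))))

  rowsCells-column : ∀ i ss j → sumOver (rowsCells i (ribbonRows ss)) (λ x → 𝟙 (proj₂ x ≟ j)) ≡ ribbonColumn ss j
  rowsCells-column i []       j = refl
  rowsCells-column i (s ∷ ss) j = trans (sumOver-++ (rowCells i (total ss) (suc s)) _) (cong₂ _+_
    (trans (sumOver-map (i ,_) (interval (total ss) (suc s)) _) (trans (interval-count (total ss) (suc s) j)
      (cong (𝟙 (total ss ≤? j) *_) (𝟙-cong (j <? total ss + suc s) (j ≤? s + total ss)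
        (λ b → s≤s⁻¹ (subst (j <_) bound b)) (λ b → subst (j <_) (sym bound) (s≤s b))))))
    (rowsCells-column (suc i) ss j))
    where
    bound : total ss + suc s ≡ suc (s + total ss)
    bound = +-comm (total ss) (suc s)

cells-ribbon : ∀ ss → cells (ribbonShape ss) ≡ rowsCells 0 (ribbonRows ss)
cells-ribbon ss = trans (cells-rows (ribbonOuter ss) (positive (ribbonStarts ss)) (ribbon-prefix ss)) (cong (rowsCells 0) (rowsOf-ribbon ss))

columnSize-ribbon : ∀ ss j → columnSize (ribbonShape ss) j ≡ ribbonColumn ss j
columnSize-ribbon ss j = trans (count-sumOver (λ x → proj₂ x ≟ j) (cells (ribbonShape ss)))
  (trans (cong (λ cs → sumOver cs λ x → 𝟙 (proj₂ x ≟ j)) (cells-ribbon ss)) (rowsCells-column 0 ss j))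

ribbonSize : List ℕ → ℕ
ribbonSize ss = rowsSize (ribbonRows ss)

size-ribbon : ∀ ss → size (ribbonShape ss) ≡ ribbonSize ss
size-ribbon ss = trans (cong length (cells-ribbon ss)) (length-rowsCells 0 (ribbonRows ss))

columnsOfSize-ribbon : ∀ t s ss → columnsOfSize t (ribbonShape (s ∷ ss)) ≡
  sumTo (suc (total (s ∷ ss))) λ j → 𝟙 (ribbonColumn (s ∷ ss) j ≟ t)
columnsOfSize-ribbon t s ss = trans (count-sumOver (λ j → columnSize (ribbonShape (s ∷ ss)) j ≟ t) (upTo (suc (total (s ∷ ss)))))
  (trans (sumOver-upTo (suc (total (s ∷ ss))) _)
    (sumTo-cong (suc (total (s ∷ ss))) λ j → cong (λ c → 𝟙 (c ≟ t)) (columnSize-ribbon (s ∷ ss) j)))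

within-yes : ∀ {M m j} → M ≤ j → j ≤ m → within M m j ≡ 1
within-yes {M} {m} {j} a b = cong₂ _*_ (𝟙-yes (M ≤? j) a) (𝟙-yes (j ≤? m) b)

within-≤1 : ∀ M m j → within M m j ≤ 1
within-≤1 M m j = *-mono-≤ (bound (M ≤? j)) (bound (j ≤? m))
  where
  bound : ∀ {P : Set} (p : Dec P) → 𝟙 p ≤ 1
  bound (yes _) = ≤-refl
  bound (no _)  = z≤n

column-beyond : ∀ ss j → total ss < j → ribbonColumn ss j ≡ 0
column-beyond []       j _ = refl
column-beyond (s ∷ ss) j b = cong₂ _+_
  (trans (cong (𝟙 (total ss ≤? j) *_) (𝟙-no (j ≤? s + total ss) (<⇒≱ b))) (*-zeroʳ (𝟙 (total ss ≤? j))))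
  (column-beyond ss j (≤-<-trans (m≤n+m (total ss) s) b))

sumTo-1 : ∀ n → sumTo n (λ _ → 1) ≡ n
sumTo-1 zero    = sumTo-zero _
sumTo-1 (suc n) = trans (sumTo-suc n _) (cong suc (sumTo-1 n))

sum-columns : ∀ ss b → total ss < b → sumTo b (ribbonColumn ss) ≡ ribbonSize ss
sum-columns []       b _ = sumTo-0 b
sum-columns (s ∷ ss) b t<b = trans (sumTo-+ b _ (ribbonColumn ss)) (cong₂ _+_
  (trans (sumTo-cong b λ j → sym (trans (cong (λ m → within (total ss) m j * 1) (+-comm (total ss) s)) (*-identityʳ _)))
    (trans (sumTo-within b (total ss) s (λ _ → 1) (subst (_< b) (+-comm s (total ss)) t<b)) (sumTo-1 (suc s))))
  (sum-columns ss b (≤-<-trans (m≤n+m (total ss) s) t<b)))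

interior-tail : ∀ s ss → Interior (s ∷ ss) → Interior ss
interior-tail s []       _        = tt
interior-tail s (_ ∷ _) (_ , ok) = ok

column-last : ∀ s ss → Interior (s ∷ ss) → ribbonColumn (s ∷ ss) (s + total ss) ≡ 1
column-last s ss ok = cong₂ _+_ (within-yes (m≤n+m (total ss) s) ≤-refl) (rest ss ok)
  where
  rest : ∀ ss → Interior (s ∷ ss) → ribbonColumn ss (s + total ss) ≡ 0
  rest []        _         = refl
  rest (s′ ∷ ss) (1≤s , _) = column-beyond (s′ ∷ ss) (s + total (s′ ∷ ss)) (+-monoˡ-≤ (total (s′ ∷ ss)) 1≤s)

column-≥1 : ∀ s ss j → j ≤ total (s ∷ ss) → 1 ≤ ribbonColumn (s ∷ ss) j
column-≥1 s ss j j≤ with total ss ≤? j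
... | yes t≤j = ≤-trans (≤-reflexive (sym (within-yes t≤j j≤))) (m≤m+n _ _)
column-≥1 s []        j j≤ | no t≰j = contradiction z≤n t≰j
column-≥1 s (s′ ∷ ss) j j≤ | no t≰j = ≤-trans (column-≥1 s′ ss j (≰⇒≥ t≰j)) (m≤n+m _ (within (total (s′ ∷ ss)) (s + total (s′ ∷ ss)) j))

-- To the left of the top row, induction applies. In the column shared with the next row, that row
-- contributes one cell and everything below it none. Further to the right only the top row is
-- present.
column-≤2 : ∀ s ss j → Interior ss → ribbonColumn (s ∷ ss) j ≤ 2
column-≤2 s []        j ok = ≤-trans (≤-reflexive (+-identityʳ _)) (≤-trans (within-≤1 0 (s + 0) j) (n≤1+n 1))
column-≤2 s (s′ ∷ ss) j ok with <-cmp j (total (s′ ∷ ss))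
... | tri< j<M _ _ = ≤-trans (≤-reflexive (cong (λ z → z * 𝟙 (j ≤? s + M) + ribbonColumn (s′ ∷ ss) j) (𝟙-no (M ≤? j) (<⇒≱ j<M))))
                             (column-≤2 s′ ss j (interior-tail s′ ss ok))
  where
  M : ℕ
  M = total (s′ ∷ ss)
... | tri≈ _ refl _ = +-mono-≤ (within-≤1 M (s + M) M) (≤-reflexive (column-last s′ ss ok))
  where
  M : ℕ
  M = total (s′ ∷ ss)
... | tri> _ _ M<j = +-mono-≤ (≤-trans (within-≤1 M (s + M) j) (≤-refl)) (≤-trans (≤-reflexive (column-beyond (s′ ∷ ss) j M<j)) z≤n)
  where
  M : ℕ
  M = total (s′ ∷ ss)

-- A row with a single cell between two others would share its column with both of them, which makes
-- three cells.
interior-columns : ∀ s ss → (∀ j → j ≤ total (s ∷ ss) → ribbonColumn (s ∷ ss) j ≤ 2) → Interior ss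
interior-columns s []             _     = tt
interior-columns s (s′ ∷ [])      _     = tt
interior-columns s (s′ ∷ s″ ∷ ss) small = wide s′ refl ,
  interior-columns s′ (s″ ∷ ss) λ j j≤ → ≤-trans (m≤n+m _ (within (total (s′ ∷ s″ ∷ ss)) (s + total (s′ ∷ s″ ∷ ss)) j)) (small j (≤-trans j≤ (m≤n+m _ s)))
  where
  M : ℕ
  M = total (s″ ∷ ss)
  wide : ∀ z → z ≡ s′ → 1 ≤ z
  wide (suc _) _    = z<s
  wide zero    refl = contradiction
    (≤-trans (+-mono-≤ (≤-reflexive (sym (within-yes {M} {s + M} ≤-refl (m≤n+m M s))))
               (+-mono-≤ (≤-reflexive (sym (within-yes {M} {M} ≤-refl ≤-refl))) (column-≥1 s″ ss M ≤-refl)))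
      (small M (m≤n+m M s)))
    λ { (s≤s (s≤s ())) }

-- The contribution of a column with `c` cells to the number of columns of size 1 plus twice the
-- number of columns of size 2. It never exceeds `c`, with equality exactly for `c ≤ 2`; so if the
-- contributions add up to the number of cells, no column has more than two.
columnWeight : ℕ → ℕ
columnWeight c = 𝟙 (c ≟ 1) + 2 * 𝟙 (c ≟ 2)

columnWeight-≤ : ∀ c → columnWeight c ≤ c
columnWeight-≤ 0                   = z≤n
columnWeight-≤ 1                   = ≤-refl
columnWeight-≤ 2                   = ≤-refl
columnWeight-≤ (suc (suc (suc c))) = z≤n

columnWeight-small : ∀ c → c ≤ 2 → columnWeight c ≡ c
columnWeight-small 0 _ = refl
columnWeight-small 1 _ = refl
columnWeight-small 2 _ = refl
columnWeight-small (suc (suc (suc c))) (s≤s (s≤s ()))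

columnWeight-tight : ∀ c → columnWeight c ≡ c → c ≤ 2
columnWeight-tight 0 _ = z≤n
columnWeight-tight 1 _ = s≤s z≤n
columnWeight-tight 2 _ = ≤-refl

sumTo-mono : ∀ n {f g : ℕ → ℕ} → (∀ i → f i ≤ g i) → sumTo n f ≤ sumTo n g
sumTo-mono zero    {f} {g} le = subst₂ _≤_ (sym (sumTo-zero f)) (sym (sumTo-zero g)) z≤n
sumTo-mono (suc n) {f} {g} le = subst₂ _≤_ (sym (sumTo-suc n f)) (sym (sumTo-suc n g)) (+-mono-≤ (le 0) (sumTo-mono n (le ∘ suc)))

sumTo-tight : ∀ n {f g : ℕ → ℕ} → (∀ i → f i ≤ g i) → sumTo n f ≡ sumTo n g → ∀ i → i < n → f i ≡ g i
sumTo-tight (suc n) {f} {g} le e i i<n = pick i i<n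
  where
  e′ : f 0 + sumTo n (f ∘ suc) ≡ g 0 + sumTo n (g ∘ suc)
  e′ = trans (sym (sumTo-suc n f)) (trans e (sumTo-suc n g))
  tails : sumTo n (f ∘ suc) ≤ sumTo n (g ∘ suc)
  tails = sumTo-mono n (le ∘ suc)
  head≡ : f 0 ≡ g 0
  head≡ = ≤-antisym (le 0) (+-cancelʳ-≤ (sumTo n (g ∘ suc)) _ _ (≤-trans (≤-reflexive (sym e′)) (+-monoʳ-≤ (f 0) tails)))
  pick : ∀ i → i < suc n → f i ≡ g i
  pick zero    _         = head≡
  pick (suc i) (s≤s i<n) = sumTo-tight n (le ∘ suc) (+-cancelˡ-≡ (g 0) _ _ (trans (cong (_+ _) (sym head≡)) e′)) i i<n

columns-weight : ∀ s ss → columnsOfSize 1 (ribbonShape (s ∷ ss)) + 2 * columnsOfSize 2 (ribbonShape (s ∷ ss)) ≡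
  sumTo (suc (total (s ∷ ss))) (columnWeight ∘ ribbonColumn (s ∷ ss))
columns-weight s ss = trans
  (cong₂ (λ a b → a + 2 * b) (columnsOfSize-ribbon 1 s ss) (columnsOfSize-ribbon 2 s ss))
  (sym (trans (sumTo-+ b _ _) (cong (sumTo b (λ j → 𝟙 (ribbonColumn (s ∷ ss) j ≟ 1)) +_) (sumTo-*ˡ b 2 _))))
  where
  b : ℕ
  b = suc (total (s ∷ ss))

ribbonSize-total : ∀ ss → ribbonSize ss ≡ total ss + length ss
ribbonSize-total []       = refl
ribbonSize-total (s ∷ ss) = trans (cong (suc s +_) (ribbonSize-total ss)) (regroup s (total ss) (length ss))
  where
  regroup : ∀ s t l → suc s + (t + l) ≡ s + t + suc l
  regroup = solve-∀

-- All columns have one or two cells, so the columns of size 2 account for the excess of cells over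
-- columns, which is the number of rows minus one.
columns-two : ∀ s ss → Interior ss → columnsOfSize 2 (ribbonShape (s ∷ ss)) ≡ length ss
columns-two s ss ok = trans (columnsOfSize-ribbon 2 s ss) (+-cancelˡ-≡ b _ _ (begin
  b + sumTo b two                          ≡⟨ cong (_+ sumTo b two) (sym (sumTo-1 b)) ⟩
  sumTo b (λ _ → 1) + sumTo b two          ≡⟨ sym (sumTo-+ b _ _) ⟩
  sumTo b (λ j → 1 + two j)                ≡⟨ (sumTo-congᵇ b λ j j< → one-two (ribbonColumn (s ∷ ss) j) (column-≥1 s ss j (s≤s⁻¹ j<)) (column-≤2 s ss j ok)) ⟩
  sumTo b (ribbonColumn (s ∷ ss))          ≡⟨ sum-columns (s ∷ ss) b ≤-refl ⟩
  ribbonSize (s ∷ ss)                      ≡⟨ trans (ribbonSize-total (s ∷ ss)) (+-suc (total (s ∷ ss)) (length ss)) ⟩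
  b + length ss                            ∎))
  where
  open ≡-Reasoning
  b : ℕ
  b = suc (total (s ∷ ss))
  two : ℕ → ℕ
  two j = 𝟙 (ribbonColumn (s ∷ ss) j ≟ 2)
  one-two : ∀ c → 1 ≤ c → c ≤ 2 → 1 + 𝟙 (c ≟ 2) ≡ c
  one-two 1 _ _ = refl
  one-two 2 _ _ = refl
  one-two (suc (suc (suc c))) _ (s≤s (s≤s ()))

inH̃-ribbon⁺ : ∀ n s ss → Interior ss → ribbonSize (s ∷ ss) ≡ n → InH̃ n (length ss) (ribbonShape (s ∷ ss))
inH̃-ribbon⁺ n s ss ok e = RibbonCells.skewHook s ss , trans (size-ribbon (s ∷ ss)) e , columns-two s ss ok ,
  trans (cong (λ z → columnsOfSize 1 (ribbonShape (s ∷ ss)) + 2 * z) (sym (columns-two s ss ok)))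
  (trans (columns-weight s ss) (trans
    (sumTo-cong (suc (total (s ∷ ss))) λ j → columnWeight-small (ribbonColumn (s ∷ ss) j) (column-≤2 s ss j ok))
    (trans (sum-columns (s ∷ ss) _ ≤-refl) e)))

inH̃-ribbon⁻ : ∀ n k D → InH̃ n k D → ∃[ s ] ∃[ ss ] D ≡ ribbonShape (s ∷ ss) × Interior ss × ribbonSize (s ∷ ss) ≡ n × length ss ≡ k
inH̃-ribbon⁻ n k (λs , μs) (hook , e , two , weight) with s , ss , refl ← skewHook-ribbon λs μs hook =
  s , ss , refl , ok , e′ , trans (sym (columns-two s ss ok)) two
  where
  e′ : ribbonSize (s ∷ ss) ≡ n
  e′ = trans (sym (size-ribbon (s ∷ ss))) e
  b : ℕ
  b = suc (total (s ∷ ss))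
  ok : Interior ss
  -- The last equation of `InH̃` says that the weights of the columns add up to `n`, the sum of the
  -- column sizes; hence each weight equals the size of its column.
  ok = interior-columns s ss λ j j≤ → columnWeight-tight (ribbonColumn (s ∷ ss) j)
    (sumTo-tight b (λ j → columnWeight-≤ (ribbonColumn (s ∷ ss) j))
      (trans (sym (columns-weight s ss)) (trans (cong (λ z → columnsOfSize 1 (ribbonShape (s ∷ ss)) + 2 * z) two)
        (trans weight (sym (trans (sum-columns (s ∷ ss) b ≤-refl) e′))))) j (s≤s j≤))

-- The list of all hooks of a given size

-- The ribbons with suc j cells whose rows, except possibly the last, have at
-- least two cells.
interiorRibbons doubledRibbons : ℕ → List (List ℕ)
interiorRibbons zero    = (0 ∷ []) ∷ []
interiorRibbons (suc j) = map widen (interiorRibbons j) ++ doubledRibbons j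
doubledRibbons zero    = []
doubledRibbons (suc j) = map (1 ∷_) (interiorRibbons j)

shortTopRibbons : ℕ → List (List ℕ)
shortTopRibbons zero    = []
shortTopRibbons (suc n) = map (0 ∷_) (interiorRibbons n)

-- The ribbons with suc n cells whose columns have at most two cells.
hookRibbons : ℕ → List (List ℕ)
hookRibbons n = interiorRibbons n ++ shortTopRibbons n

interiorRibbons-sound : ∀ j {ss} → ss ∈ interiorRibbons j → ss ≢ [] × Interior ss × ribbonSize ss ≡ suc j
interiorRibbons-sound zero    (here refl) = (λ ()) , tt , refl
interiorRibbons-sound (suc j) ss∈ with ∈-++⁻ (map widen (interiorRibbons j)) ss∈
... | inj₁ in-widened with t , t∈ , refl ← ∈-map⁻ widen in-widened = widened t (interiorRibbons-sound j t∈)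
  where
  widened : ∀ t → t ≢ [] × Interior t × ribbonSize t ≡ suc j → widen t ≢ [] × Interior (widen t) × ribbonSize (widen t) ≡ suc (suc j)
  widened []            (ne , _)            = contradiction refl ne
  widened (s ∷ [])      (_ , _ , e)         = (λ ()) , tt , cong suc e
  widened (s ∷ s′ ∷ ss) (_ , (_ , ok) , e) = (λ ()) , (z<s , ok) , cong suc e
interiorRibbons-sound (suc (suc j)) ss∈ | inj₂ in-doubled with t , t∈ , refl ← ∈-map⁻ (1 ∷_) in-doubled =
  (λ ()) , doubled t (proj₁ (proj₂ (interiorRibbons-sound j t∈))) , cong (2 +_) (proj₂ (proj₂ (interiorRibbons-sound j t∈)))
  where
  doubled : ∀ t → Interior t → Interior (1 ∷ t)
  doubled []      _  = tt
  doubled (_ ∷ _) ok = ≤-refl , ok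

ribbonSize-pos : ∀ s ss → ribbonSize (s ∷ ss) ≢ 0
ribbonSize-pos s ss ()

interiorRibbons-complete : ∀ j s ss → Interior (s ∷ ss) → ribbonSize (s ∷ ss) ≡ suc j → s ∷ ss ∈ interiorRibbons j
interiorRibbons-complete zero    zero          []        _          refl = here refl
interiorRibbons-complete (suc j) (suc s)       []        _          e    =
  ∈-++⁺ˡ (∈-map⁺ widen (interiorRibbons-complete j s [] tt (suc-injective e)))
interiorRibbons-complete (suc (suc j)) 1       (s′ ∷ ss) (_ , ok)   e    =
  ∈-++⁺ʳ (map widen (interiorRibbons (suc j))) (∈-map⁺ (1 ∷_) (interiorRibbons-complete j s′ ss ok (suc-injective (suc-injective e))))
interiorRibbons-complete (suc j) (suc (suc s)) (s′ ∷ ss) (_ , ok)   e    =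
  ∈-++⁺ˡ (∈-map⁺ widen (interiorRibbons-complete j (suc s) (s′ ∷ ss) (z<s , ok) (suc-injective e)))

hookRibbons-sound : ∀ n {ss} → ss ∈ hookRibbons n → ∃[ s ] ∃[ t ] ss ≡ s ∷ t × Interior t × ribbonSize ss ≡ suc n
hookRibbons-sound n ss∈ with ∈-++⁻ (interiorRibbons n) ss∈
hookRibbons-sound n {[]}     ss∈ | inj₁ a = contradiction refl (proj₁ (interiorRibbons-sound n a))
hookRibbons-sound n {s ∷ t} ss∈ | inj₁ a with _ , ok , e ← interiorRibbons-sound n a = s , t , refl , interior-tail s t ok , e
hookRibbons-sound (suc n) ss∈ | inj₂ b with t , t∈ , refl ← ∈-map⁻ (0 ∷_) b with _ , ok , e ← interiorRibbons-sound n t∈ =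
  0 , t , refl , ok , cong suc e

hookRibbons-complete : ∀ n s t → Interior t → ribbonSize (s ∷ t) ≡ suc n → s ∷ t ∈ hookRibbons n
hookRibbons-complete n       s       []       _  e = ∈-++⁺ˡ (interiorRibbons-complete n s [] tt e)
hookRibbons-complete n       (suc s) (x ∷ t) ok e = ∈-++⁺ˡ (interiorRibbons-complete n (suc s) (x ∷ t) (z<s , ok) e)
hookRibbons-complete (suc n) zero    (x ∷ t) ok e =
  ∈-++⁺ʳ (interiorRibbons (suc n)) (∈-map⁺ (0 ∷_) (interiorRibbons-complete n x t ok (suc-injective e)))

widen-injective : ∀ {ss ts} → widen ss ≡ widen ts → ss ≡ ts
widen-injective {[]}     {[]}     e = refl
widen-injective {s ∷ ss} {t ∷ ts} e = cong₂ _∷_ (suc-injective (proj₁ (∷-injective e))) (proj₂ (∷-injective e))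

interiorRibbons-unique : ∀ j → Unique (interiorRibbons j)
interiorRibbons-unique zero          = [] ∷ []
interiorRibbons-unique (suc zero)    = UniqueP.++⁺ (UniqueP.map⁺ widen-injective (interiorRibbons-unique 0)) [] λ ()
interiorRibbons-unique (suc (suc j)) = UniqueP.++⁺
  (UniqueP.map⁺ widen-injective (interiorRibbons-unique (suc j)))
  (UniqueP.map⁺ (λ e → proj₂ (∷-injective e)) (interiorRibbons-unique j))
  λ (a , b) → let t , t∈ , e = ∈-map⁻ widen a ; u , u∈ , e′ = ∈-map⁻ (1 ∷_) b
              in disjoint t u (trans (sym e) e′) (proj₁ (proj₂ (interiorRibbons-sound (suc j) t∈))) (proj₁ (interiorRibbons-sound j u∈))
  where
  disjoint : ∀ t u → widen t ≡ 1 ∷ u → Interior t → u ≢ [] → ⊥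
  disjoint (zero ∷ [])    .[]      refl _        ne = ne refl
  disjoint (zero ∷ x ∷ t) .(x ∷ t) refl (() , _) ne

hookRibbons-unique : ∀ n → Unique (hookRibbons n)
hookRibbons-unique zero    = UniqueP.++⁺ (interiorRibbons-unique 0) [] λ ()
hookRibbons-unique (suc n) = UniqueP.++⁺ (interiorRibbons-unique (suc n))
  (UniqueP.map⁺ (λ e → proj₂ (∷-injective e)) (interiorRibbons-unique n))
  λ (a , b) → let u , u∈ , e = ∈-map⁻ (0 ∷_) b
              in disjoint u (subst Interior e (proj₁ (proj₂ (interiorRibbons-sound (suc n) a)))) (proj₁ (interiorRibbons-sound n u∈))
  where
  disjoint : ∀ u → Interior (0 ∷ u) → u ≢ [] → ⊥
  disjoint []      _        ne = ne refl
  disjoint (x ∷ u) (() , _) ne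

words-unique : ∀ m {xs : List ℕ} → Unique xs → Unique (words m xs)
words-unique zero    u = [] ∷ []
words-unique (suc m) u = UniqueP.cartesianProductWith⁺ _∷_ ∷-injective u (words-unique m u)

∈-words⁺ : ∀ {xs : List ℕ} w → All (_∈ xs) w → w ∈ words (length w) xs
∈-words⁺ []      []         = here refl
∈-words⁺ (x ∷ w) (x∈ ∷ w∈) = ∈-cartesianProductWith⁺ _∷_ x∈ (∈-words⁺ w w∈)

∈-words⁻ : ∀ m {xs : List ℕ} {w} → w ∈ words m xs → length w ≡ m
∈-words⁻ zero    (here refl) = refl
∈-words⁻ (suc m) {xs} w∈ with x , v , _ , v∈ , refl ← ∈-cartesianProductWith⁻ _∷_ xs (words m xs) w∈ = cong suc (∈-words⁻ m v∈)

partitionsInSquare-unique : ∀ n → Unique (partitionsInSquare n)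
partitionsInSquare-unique n = UniqueP.filter⁺ partition? (UniqueP.concat⁺
  (AllP.map⁺ (All.universal (λ m → words-unique m (UniqueP.upTo⁺ (suc n))) (upTo (suc n))))
  (AllPairsP.map⁺ (AllPairs.map (λ {a} {b} a≢b {_} (w∈a , w∈b) → a≢b (trans (sym (∈-words⁻ a w∈a)) (∈-words⁻ b w∈b))) (UniqueP.upTo⁺ (suc n)))))

∈-partitionsInSquare : ∀ n λs → Partition λs → length λs ≤ n → All (_≤ n) λs → λs ∈ partitionsInSquare n
∈-partitionsInSquare n λs p l b = ∈-filter⁺ partition?
  (∈-concatMap⁺ (λ r → words r (upTo (suc n))) (lose (∈-upTo⁺ (s≤s l)) (∈-words⁺ λs (All.map (∈-upTo⁺ ∘ s≤s) b)))) p

H̃-unique : ∀ n k → Unique (H̃ n k)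
H̃-unique n k = UniqueP.filter⁺ (inH̃? n k) (UniqueP.cartesianProduct⁺ (partitionsInSquare-unique n) (partitionsInSquare-unique n))

length-≤-ribbonSize : ∀ ss → length ss ≤ ribbonSize ss
length-≤-ribbonSize ss = ≤-trans (m≤n+m (length ss) (total ss)) (≤-reflexive (sym (ribbonSize-total ss)))

total-≤-ribbonSize : ∀ ss → total ss ≤ ribbonSize ss
total-≤-ribbonSize ss = ≤-trans (m≤m+n (total ss) (length ss)) (≤-reflexive (sym (ribbonSize-total ss)))

ribbonShape-square : ∀ n ss → ribbonSize ss ≡ n → ribbonShape ss ∈ cartesianProduct (partitionsInSquare n) (partitionsInSquare n)
ribbonShape-square n ss refl = ∈-cartesianProduct⁺
  (∈-partitionsInSquare n (ribbonOuter ss) (outer-partition ss) (≤-trans (≤-reflexive (length-outer ss)) (length-≤-ribbonSize ss)) (outer ss))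
  (∈-partitionsInSquare n (positive (ribbonStarts ss)) (positive-partition (ribbonStarts ss) (linked-tail (starts-linked ss)))
    (≤-trans (length-filter (0 <?_) (ribbonStarts ss)) (≤-trans (≤-reflexive (length-starts ss)) (length-≤-ribbonSize ss)))
    (AllP.filter⁺ (0 <?_) (starts ss)))
  where
  length-starts : ∀ ss → length (ribbonStarts ss) ≡ length ss
  length-starts []       = refl
  length-starts (s ∷ ss) = cong suc (length-starts ss)
  outer : ∀ ss → All (_≤ ribbonSize ss) (ribbonOuter ss)
  outer []       = []
  outer (s ∷ ss) = s≤s (+-monoʳ-≤ s (total-≤-ribbonSize ss)) ∷ All.map (λ b → ≤-trans b (m≤n+m _ (suc s))) (outer ss)
  starts : ∀ ss → All (_≤ ribbonSize ss) (ribbonStarts ss)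
  starts []       = []
  starts (s ∷ ss) = ≤-trans (total-≤-ribbonSize ss) (m≤n+m _ (suc s)) ∷ All.map (λ b → ≤-trans b (m≤n+m _ (suc s))) (starts ss)

outer-injective : ∀ ss ts → ribbonOuter ss ≡ ribbonOuter ts → ss ≡ ts
outer-injective []       []       e = refl
outer-injective (s ∷ ss) (t ∷ ts) e with h , e′ ← ∷-injective e with refl ← outer-injective ss ts e′ =
  cong (_∷ ss) (+-cancelʳ-≡ (total ss) s t (suc-injective h))

-- Neither list has repetitions, and they have the same members: `k` columns of size 2 amount to
-- `suc k` rows.
H̃-↭ : ∀ n k → H̃ (suc n) k ↭ map ribbonShape (filter (λ ss → length ss ≟ suc k) (hookRibbons n))
H̃-↭ n k = ∼bag⇒↭ (unique∧set⇒bag (H̃-unique (suc n) k)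
  (UniqueP.map⁺ (λ {ss} {ts} e → outer-injective ss ts (cong proj₁ e)) (UniqueP.filter⁺ (λ ss → length ss ≟ suc k) (hookRibbons-unique n)))
  (mk⇔ to from))
  where
  square : List Skew
  square = cartesianProduct (partitionsInSquare (suc n)) (partitionsInSquare (suc n))
  to : ∀ {D} → D ∈ H̃ (suc n) k → D ∈ map ribbonShape (filter (λ ss → length ss ≟ suc k) (hookRibbons n))
  to {D} D∈ with s , ss , refl , ok , e , e′ ← inH̃-ribbon⁻ (suc n) k D (proj₂ (∈-filter⁻ (inH̃? (suc n) k) {xs = square} D∈)) =
    ∈-map⁺ ribbonShape (∈-filter⁺ (λ ss → length ss ≟ suc k) (hookRibbons-complete n s ss ok e) (cong suc e′))
  from : ∀ {D} → D ∈ map ribbonShape (filter (λ ss → length ss ≟ suc k) (hookRibbons n)) → D ∈ H̃ (suc n) k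
  from D∈ with t , t∈ , refl ← ∈-map⁻ ribbonShape D∈ with t∈′ , l ← ∈-filter⁻ (λ ss → length ss ≟ suc k) {xs = hookRibbons n} t∈
    with s , ss , refl , ok , e ← hookRibbons-sound n t∈′ =
    ∈-filter⁺ (inH̃? (suc n) k) (ribbonShape-square (suc n) (s ∷ ss) e)
      (subst (λ k → InH̃ (suc n) k (ribbonShape (s ∷ ss))) (suc-injective l) (inH̃-ribbon⁺ (suc n) s ss ok e))

sumOver-↭ : ∀ {A : Set} {xs ys : List A} f → xs ↭ ys → sumOver xs f ≡ sumOver ys f
sumOver-↭ f ↭-refl         = refl
sumOver-↭ f (prep x p)     = cong (f x +_) (sumOver-↭ f p)
sumOver-↭ f (swap x y p)   = trans (+-swapˡ (f x) (f y) _) (cong (λ z → f y + (f x + z)) (sumOver-↭ f p))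
  where
  +-swapˡ : ∀ a b c → a + (b + c) ≡ b + (a + c)
  +-swapˡ = solve-∀
sumOver-↭ f (↭-trans p q) = trans (sumOver-↭ f p) (sumOver-↭ f q)

ribbonOf : List ℕ → List ℕ → ℕ
ribbonOf ss = ribbon (ribbonPattern ss)

sum-H̃ : ∀ n k α → sumOver (H̃ (suc n) k) (λ D → length (tableaux D α)) ≡
  sumOver (hookRibbons n) (λ ss → 𝟙 (length ss ≟ suc k) * ribbonOf ss α)
sum-H̃ n k α = begin
  sumOver (H̃ (suc n) k) (λ D → length (tableaux D α))
    ≡⟨ sumOver-↭ _ (H̃-↭ n k) ⟩
  sumOver (map ribbonShape (filter (λ ss → length ss ≟ suc k) (hookRibbons n))) (λ D → length (tableaux D α))
    ≡⟨ sumOver-map ribbonShape (filter (λ ss → length ss ≟ suc k) (hookRibbons n)) _ ⟩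
  sumOver (filter (λ ss → length ss ≟ suc k) (hookRibbons n)) (λ ss → length (tableaux (ribbonShape ss) α))
    ≡⟨ sumOver-filter (λ ss → length ss ≟ suc k) (hookRibbons n) _ ⟩
  sumOver (hookRibbons n) (λ ss → 𝟙 (length ss ≟ suc k) * length (tableaux (ribbonShape ss) α))
    ≡⟨ sumOver-congAll (All.tabulate λ {ss} ss∈ → cong (𝟙 (length ss ≟ suc k) *_) (evaluate ss ss∈)) ⟩
  sumOver (hookRibbons n) (λ ss → 𝟙 (length ss ≟ suc k) * ribbonOf ss α) ∎
  where
  open ≡-Reasoning
  evaluate : ∀ ss → ss ∈ hookRibbons n → length (tableaux (ribbonShape ss) α) ≡ ribbonOf ss α
  evaluate ss ss∈ with s , t , refl , ok , _ ← hookRibbons-sound n ss∈ = ribbon-tableaux s t α ok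

-- The theorem

straight-positive : ∀ i μ → Linked _≥_ μ → rowsCells i (straight (positive μ)) ≡ rowsCells i (straight μ)
straight-positive i []          link = refl
straight-positive i (zero ∷ μ)  link = trans (cong (λ z → rowsCells i (straight z)) (positive-zero μ link)) (sym (zeros (suc i) μ (linked-≤ link)))
  where
  zeros : ∀ i μ → All (_≤ 0) μ → rowsCells i (straight μ) ≡ []
  zeros i []         []       = refl
  zeros i (zero ∷ μ) (_ ∷ bs) = zeros (suc i) μ bs
straight-positive i (suc x ∷ μ) link = cong (rowCells i 0 (suc x) ++_) (straight-positive (suc i) μ (linked-tail link))

tableaux-positive : ∀ μ α → Linked _≥_ μ → length (tableaux (positive μ , []) α) ≡ kostka μ α
tableaux-positive μ α link = begin
  length (tableaux (positive μ , []) α)   ≡⟨ tableaux-sumW (positive μ , []) α ⟩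
  F (cells (positive μ , []))             ≡⟨ cong F (trans (cells-rows (positive μ) [] []) (trans (straight-positive 0 μ link) (sym (cells-rows μ [] [])))) ⟩
  F (cells (μ , []))                      ≡⟨ sym (tableaux-sumW (μ , []) α) ⟩
  length (tableaux (μ , []) α)            ≡⟨ kostka-tableaux μ α link ⟩
  kostka μ α                              ∎
  where
  open ≡-Reasoning
  F : List Cell → ℕ
  F cs = sumW (length cs) (length α) λ w → 𝟙 (good? (zip cs w)) * 𝟙 (content (length α) w ≟ᴸ α)

sumOver-0 : ∀ {A : Set} (xs : List A) → sumOver xs (λ _ → 0) ≡ 0
sumOver-0 []       = refl
sumOver-0 (x ∷ xs) = sumOver-0 xs

sumOver-*ˡ : ∀ {A : Set} (xs : List A) c f → sumOver xs (λ x → c * f x) ≡ c * sumOver xs f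
sumOver-*ˡ []       c f = sym (*-zeroʳ c)
sumOver-*ˡ (x ∷ xs) c f = trans (cong (c * f x +_) (sumOver-*ˡ xs c f)) (sym (*-distribˡ-+ c (f x) _))

sumOver-*ʳ : ∀ {A : Set} (xs : List A) c f → sumOver xs (λ x → f x * c) ≡ sumOver xs f * c
sumOver-*ʳ xs c f = trans (sumOver-cong xs λ x → *-comm (f x) c) (trans (sumOver-*ˡ xs c f) (*-comm c _))

sumOver-swap : ∀ {A B : Set} (xs : List A) (ys : List B) (f : A → B → ℕ) →
  sumOver xs (λ x → sumOver ys (f x)) ≡ sumOver ys (λ y → sumOver xs (λ x → f x y))
sumOver-swap []       ys f = sym (sumOver-0 ys)
sumOver-swap (x ∷ xs) ys f = trans (cong (sumOver ys (f x) +_) (sumOver-swap xs ys f)) (sym (sumOver-+ ys (f x) _))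

sumOver-sumW : ∀ {A : Set} (xs : List A) m n (f : A → List ℕ → ℕ) →
  sumOver xs (λ x → sumW m n (f x)) ≡ sumW m n (λ w → sumOver xs (λ x → f x w))
sumOver-sumW []       m n f = sym (sumW-0 m n)
sumOver-sumW (x ∷ xs) m n f = trans (cong (sumW m n (f x) +_) (sumOver-sumW xs m n f)) (sym (sumW-+ m n (f x) _))

sumOver-unique : ∀ {xs x} (f : List ℕ → ℕ) → Unique xs → x ∈ xs → sumOver xs (λ y → 𝟙 (x ≟ᴸ y) * f y) ≡ f x
sumOver-unique {x ∷ xs} f (x∉ ∷ u) (here refl) = trans (cong₂ _+_ (𝟙-yes* (x ≟ᴸ x) refl)
  (trans (sumOver-congAll (All.map (λ {y} x≢y → 𝟙-no* (x ≟ᴸ y) x≢y) x∉)) (sumOver-0 xs))) (+-identityʳ (f x))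
sumOver-unique {y ∷ xs} {x} f (y∉ ∷ u) (there x∈) =
  cong₂ _+_ (𝟙-no* (x ≟ᴸ y) λ e → All.lookup y∉ x∈ (sym e)) (sumOver-unique f u x∈)

module _ (R : ℕ) .{{_ : NonZero R}} where

  -- The words counted here correspond to standard tableaux, since they build up the shape box by
  -- box. The shapes are padded with zero rows, which `positive` removes.
  ribbonMultiplicity : List Bool → List ℕ → ℕ
  ribbonMultiplicity p λs = sumMatch p R λ w → maybeTo (λ μ → 𝟙 (positive μ ≟ᴸ λs)) (shapeOf R w)

  -- The words in `ribbon-shapes` are grouped by the shape they grow. A word of length `R` grows a
  -- shape with `R` boxes, which lies in the square and is found there exactly once.
  ribbon-schur : ∀ p α → suc (length p) ≡ R → ribbon p α ≡
    sumOver (partitionsInSquare R) (λ λs → ribbonMultiplicity p λs * length (tableaux (λs , []) α))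
  ribbon-schur p α size = begin
    ribbon p α
      ≡⟨ sym (ribbon-shapes R p α (≤-reflexive size)) ⟩
    sumMatch p R (grown R α)
      ≡⟨ (sumW-congᵇ (suc (length p)) R λ w (lw , _) → cong (matches p w *_) (sym (expand w (trans lw size) (shapeOf R w) refl))) ⟩
    sumMatch p R (λ w → sumOver Λs λ λs → X w λs * K λs)
      ≡⟨ (sumW-cong (suc (length p)) R λ w → trans (sym (sumOver-*ˡ Λs (matches p w) _))
           (sumOver-cong Λs λ λs → sym (*-assoc (matches p w) (X w λs) (K λs)))) ⟩
    sumW (suc (length p)) R (λ w → sumOver Λs λ λs → matches p w * X w λs * K λs)
      ≡⟨ sym (sumOver-sumW Λs (suc (length p)) R _) ⟩
    sumOver Λs (λ λs → sumW (suc (length p)) R λ w → matches p w * X w λs * K λs)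
      ≡⟨ (sumOver-cong Λs λ λs → trans (sumW-cong (suc (length p)) R λ w → *-comm _ (K λs))
           (trans (sumW-*ˡ (suc (length p)) R (K λs) _) (*-comm (K λs) _))) ⟩
    sumOver Λs (λ λs → ribbonMultiplicity p λs * K λs) ∎
    where
    open ≡-Reasoning
    Λs : List (List ℕ)
    Λs = partitionsInSquare R
    X : List ℕ → List ℕ → ℕ
    X w λs = maybeTo (λ μ → 𝟙 (positive μ ≟ᴸ λs)) (shapeOf R w)
    K : List ℕ → ℕ
    K λs = length (tableaux (λs , []) α)
    expand : ∀ w → length w ≡ R → ∀ s → shapeOf R w ≡ s →
      sumOver Λs (λ λs → maybeTo (λ μ → 𝟙 (positive μ ≟ᴸ λs)) s * K λs) ≡ maybeTo (λ μ → kostka μ α) s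
    expand w lw nothing  e = sumOver-0 Λs
    expand w lw (just μ) e with link , rows , boxes ← shapeOf-grown R w μ e = trans
      (sumOver-unique K (partitionsInSquare-unique R)
        (∈-partitionsInSquare R (positive μ) (positive-partition μ (linked-tail link))
          (≤-trans (length-filter (0 <?_) μ) (≤-reflexive rows))
          (AllP.filter⁺ (0 <?_) (All.map (λ b → ≤-trans b (≤-reflexive (trans boxes lw))) (total-≥ μ)))))
      (tableaux-positive μ α (linked-tail link))

length-pattern : ∀ s ss → suc (length (ribbonPattern (s ∷ ss))) ≡ ribbonSize (s ∷ ss)
length-pattern s []        = cong suc (trans (length-replicate s) (sym (+-identityʳ s)))
length-pattern s (s′ ∷ ss) = trans (cong suc (trans (length-++ (ribbonPattern (s′ ∷ ss))) (cong (λ k → length (ribbonPattern (s′ ∷ ss)) + suc k) (length-replicate s))))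
  (trans (cong (_+ suc s) (length-pattern s′ ss)) (+-comm (ribbonSize (s′ ∷ ss)) (suc s)))

multiplicity : ℕ → ℕ → List ℕ → ℕ
multiplicity n k λs = sumOver (hookRibbons n) λ ss → 𝟙 (length ss ≟ suc k) * ribbonMultiplicity (suc n) (ribbonPattern ss) λs

schur-expansion : ∀ n k α → sumOver (H̃ (suc n) k) (λ D → length (tableaux D α)) ≡
  sumOver (partitionsInSquare (suc n)) (λ λs → multiplicity n k λs * length (tableaux (λs , []) α))
schur-expansion n k α = begin
  sumOver (H̃ (suc n) k) (λ D → length (tableaux D α))
    ≡⟨ sum-H̃ n k α ⟩
  sumOver (hookRibbons n) (λ ss → 𝟙 (length ss ≟ suc k) * ribbonOf ss α)
    ≡⟨ sumOver-congAll (All.tabulate λ {ss} ss∈ → trans (cong (𝟙 (length ss ≟ suc k) *_) (expand ss ss∈)) (sym (sumOver-*ˡ Λs (𝟙 (length ss ≟ suc k)) (λ λs → c ss λs * K λs)))) ⟩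
  sumOver (hookRibbons n) (λ ss → sumOver Λs λ λs → 𝟙 (length ss ≟ suc k) * (c ss λs * K λs))
    ≡⟨ sumOver-swap (hookRibbons n) Λs _ ⟩
  sumOver Λs (λ λs → sumOver (hookRibbons n) λ ss → 𝟙 (length ss ≟ suc k) * (c ss λs * K λs))
    ≡⟨ (sumOver-cong Λs λ λs → trans (sumOver-cong (hookRibbons n) λ ss → sym (*-assoc (𝟙 (length ss ≟ suc k)) (c ss λs) (K λs)))
         (sumOver-*ʳ (hookRibbons n) (K λs) _)) ⟩
  sumOver Λs (λ λs → multiplicity n k λs * K λs) ∎
  where
  open ≡-Reasoning
  Λs : List (List ℕ)
  Λs = partitionsInSquare (suc n)
  K : List ℕ → ℕ
  K λs = length (tableaux (λs , []) α)
  c : List ℕ → List ℕ → ℕ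
  c ss = ribbonMultiplicity (suc n) (ribbonPattern ss)
  expand : ∀ ss → ss ∈ hookRibbons n → ribbonOf ss α ≡ sumOver Λs (λ λs → c ss λs * K λs)
  expand ss ss∈ with s , t , refl , _ , e ← hookRibbons-sound n ss∈ =
    ribbon-schur (suc n) (ribbonPattern (s ∷ t)) α (trans (length-pattern s t) e)

-- All rows but the lowest have at least two cells and the lowest has at least one. The bound makes
-- the truncated difference in the exponent of 1 + t a true one.
interior-length : ∀ j s u → Interior (s ∷ u) → ribbonSize (s ∷ u) ≡ suc j → 2 * length u ≤ j
interior-length j s []       _         e = z≤n
interior-length j s (x ∷ u) (1≤s , ok) e with ribbonSize (x ∷ u) in eq
... | zero   = contradiction eq (ribbonSize-pos x u)
... | suc j′ = ≤-trans (≤-reflexive (*-suc 2 (length u))) (≤-trans (+-monoʳ-≤ 2 (interior-length j′ x u ok eq))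
  (≤-trans (+-monoˡ-≤ (suc j′) 1≤s) (≤-reflexive (suc-injective e))))

half-≤ : ∀ k n → 2 * k ≤ n → k ≤ ⌊ n /2⌋
half-≤ k n le = ≤-trans (≤-reflexive (trans (n≡⌊n+n/2⌋ k) (cong (λ z → ⌊ k + z /2⌋) (sym (+-identityʳ k))))) (⌊n/2⌋-mono le)

does-cong : ∀ {P Q : Set} (p : Dec P) (q : Dec Q) → (P → Q) → (Q → P) → does p ≡ does q
does-cong (yes _) (yes _) _ _ = refl
does-cong (no _)  (no _)  _ _ = refl
does-cong (yes p) (no ¬q) f _ = contradiction (f p) ¬q
does-cong (no ¬p) (yes q) _ g = contradiction (g q) ¬p

ribbonPattern-widen : ∀ s ss a → ribbonPattern ((s + suc a) ∷ ss) ≡ ribbonPattern (s ∷ ss) ++ false ∷ replicate a false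
ribbonPattern-widen s ss a = go ss
  where
  lengthen : ∀ s → replicate (s + suc a) false ≡ replicate s false ++ false ∷ replicate a false
  lengthen zero    = refl
  lengthen (suc s) = cong (false ∷_) (lengthen s)
  go : ∀ ss → ribbonPattern ((s + suc a) ∷ ss) ≡ ribbonPattern (s ∷ ss) ++ false ∷ replicate a false
  go []        = lengthen s
  go (s′ ∷ ss) = trans (cong (λ z → ribbonPattern (s′ ∷ ss) ++ true ∷ z) (lengthen s))
    (sym (++-assoc (ribbonPattern (s′ ∷ ss)) (true ∷ replicate s false) (false ∷ replicate a false)))

-- Passage to the coefficient ring and to power series in t

module _ {c ℓ₁ ℓ₂} (R : OrderedCommutativeRing c ℓ₁ ℓ₂) where
  private
    module R = OrderedCommutativeRing R
    module S = SymmetricFunctions R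
    X T : CommutativeRing c ℓ₁
    X = SeriesRing.seriesRing R.commutativeRing
    T = PowerSeriesRing.powerSeriesRing X
    module X = CommutativeRing X
    module T = CommutativeRing T
    module XP = PowerSeriesRing X
    module TP = PowerSeriesRing T
    module ∑R = RingSum R.commutativeRing
    module ∑X = RingSum X
    module ∑T = RingSum T
    open RawSemiringDefinitions (RawRing.rawSemiring R.rawRing) using () renaming (_×_ to _×ᴿ_)

    ι : ℕ → R.Carrier
    ι n = n ×ᴿ R.1#

    ι-+ : ∀ m n → ι (m + n) R.≈ ι m R.+ ι n
    ι-+ = MonoidMultiples.×-homo-+ R.+-monoid R.1#

    ι-* : ∀ m n → ι (m * n) R.≈ ι m R.* ι n
    ι-* = Multiples.×1-homo-* R.semiring

    ι-𝟙 : ∀ {P : Set} (p : Dec P) → ι (𝟙 p) R.≈ (if does p then R.1# else R.0#)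
    ι-𝟙 (yes _) = R.+-identityʳ R.1#
    ι-𝟙 (no _)  = R.refl

    ι-sumTo : ∀ n f → ι (sumTo n f) R.≈ ∑R.∑< n (λ i → ι (f i))
    ι-sumTo zero    f = R.reflexive (cong ι (sumTo-zero f))
    ι-sumTo (suc n) f = R.trans (R.reflexive (cong ι (sumTo-suc n f)))
      (R.trans (ι-+ (f 0) _) (R.+-congˡ (ι-sumTo n (λ i → f (suc i)))))

    ι-nonneg : ∀ n → R.0# R.≼ ι n
    ι-nonneg zero    = IsPartialOrder.refl R.isPartialOrder
    ι-nonneg (suc n) = IsPartialOrder.trans R.isPartialOrder R.0≼1
      (IsPartialOrder.trans R.isPartialOrder (IsPartialOrder.reflexive R.isPartialOrder (R.sym (R.+-identityʳ R.1#)))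
        (R.+-monoʳ-≼ R.1# (ι-nonneg n)))

    series : (List ℕ → ℕ) → X.Carrier
    series f α = ι (f α)

    h-suc : ∀ m i → i ≤ m → (λ β → S.h m (i ∷ β)) X.≈ S.h (m ∸ i)
    h-suc m i i≤m β = R.reflexive (cong (λ b → if b then R.1# else R.0#)
      (does-cong (i + total β ≟ m) (total β ≟ m ∸ i)
        (λ e → trans (sym (m+n∸m≡n i (total β))) (cong (_∸ i) e)) (λ e → trans (cong (i +_) e) (m+[n∸m]≡n i≤m))))

    h-0 : ∀ m i → ¬ i ≤ m → (λ β → S.h m (i ∷ β)) X.≈ X.0#
    h-0 m i i≰m β = R.reflexive (cong (λ b → if b then R.1# else R.0#)
      (dec-false (i + total β ≟ m) λ e → i≰m (subst (i ≤_) e (m≤m+n i _))))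

    -- Fixing the exponent `i` of the first variable in h of degree m leaves h of degree m - i in
    -- the other variables, or zero if `i` exceeds `m`; this is the recursion of `H`.
    h-*-series : ∀ m g α → (S.h m X.* series g) α R.≈ ι (H m g α)
    h-*-series m g []      = R.trans
      (R.*-congʳ (R.trans (R.sym (ι-𝟙 (0 ≟ m))) (R.reflexive (cong ι (𝟙-cong (0 ≟ m) (m ≟ 0) sym sym)))))
      (R.sym (ι-* (𝟙 (m ≟ 0)) (g [])))
    h-*-series m g (a ∷ α) = R.trans
      (R.reflexive (∑R.sum-∑< (suc a) (λ i → ((λ β → S.h m (i ∷ β)) X.* series (λ γ → g (a ∸ i ∷ γ))) α)))
      (R.trans (∑R.∑<-cong (suc a) λ i → term i (i ≤? m)) (R.sym (ι-sumTo (suc a) _)))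
      where
      term : ∀ i → Dec (i ≤ m) → ((λ β → S.h m (i ∷ β)) X.* series (λ γ → g (a ∸ i ∷ γ))) α R.≈
        ι (𝟙 (i ≤? m) * H (m ∸ i) (λ γ → g (a ∸ i ∷ γ)) α)
      term i (yes i≤m) = R.trans (X.*-congʳ {series (λ γ → g (a ∸ i ∷ γ))} (h-suc m i i≤m) α)
        (R.trans (h-*-series (m ∸ i) (λ γ → g (a ∸ i ∷ γ)) α) (R.reflexive (cong ι (sym (𝟙-yes* (i ≤? m) i≤m)))))
      term i (no i≰m) = R.trans (X.*-congʳ {series (λ γ → g (a ∸ i ∷ γ))} (h-0 m i i≰m) α)
        (R.trans (X.zeroˡ (series (λ γ → g (a ∸ i ∷ γ))) α) (R.reflexive (cong ι (sym (𝟙-no* (i ≤? m) i≰m)))))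

    C-cong : ∀ {f g} → f X.≈ g → S.C f T.≈ S.C g
    C-cong e zero    = e
    C-cong e (suc n) = X.refl

    C-+ : ∀ f g → S.C (f X.+ g) T.≈ S.C f T.+ S.C g
    C-+ f g zero    = X.refl
    C-+ f g (suc n) = X.sym (X.+-identityˡ X.0#)

    C-* : ∀ f g → (S.C f T.* S.C g) T.≈ S.C (f X.* g)
    C-* f g zero    = XP.*-constantˡ f (S.C g) 0
    C-* f g (suc n) = X.trans (XP.*-constantˡ f (S.C g) (suc n)) (X.zeroʳ f)

    hᵀ : ℕ → T.Carrier
    hᵀ m = S.C (S.h m)

    N : List ℕ → T.Carrier
    N ss = S.C (series (ribbonOf ss))

    module Rec = Recurrence T S.t hᵀ N
    open Rec using (G)

    h₀ : hᵀ 0 T.≈ T.1#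
    h₀ = T.refl

    N-row : ∀ a → N (a ∷ []) T.≈ hᵀ (suc a)
    N-row a = C-cong λ α → R.trans (R.reflexive (cong ι (ribbon-row a α))) (ι-𝟙 (total α ≟ suc a))

    N-split : ∀ a s ss → hᵀ (suc a) T.* N (s ∷ ss) T.≈ N (a ∷ s ∷ ss) T.+ N ((s + suc a) ∷ ss)
    N-split a s ss = T.trans (C-* (S.h (suc a)) (series (ribbonOf (s ∷ ss)))) (T.trans
      (C-cong λ α → R.trans (h-*-series (suc a) (ribbonOf (s ∷ ss)) α)
        (R.trans (R.reflexive (cong ι (trans (ribbon-suffix (ribbonPattern (s ∷ ss)) a α)
            (cong (λ p → ribbonOf (a ∷ s ∷ ss) α + ribbon p α) (sym (ribbonPattern-widen s ss a))))))
          (ι-+ (ribbonOf (a ∷ s ∷ ss) α) (ribbonOf ((s + suc a) ∷ ss) α))))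
      (C-+ (series (ribbonOf (a ∷ s ∷ ss))) (series (ribbonOf ((s + suc a) ∷ ss)))))

    t-0 : ∀ x → (S.t T.* x) 0 X.≈ X.0#
    t-0 x = X.trans (X.+-identityʳ _) (X.zeroˡ (x 0))

    t-suc : ∀ x n → (S.t T.* x) (suc n) X.≈ x n
    t-suc x n = X.trans (X.+-congʳ (X.zeroˡ (x (suc n)))) (X.trans (X.+-identityˡ _)
      (X.trans (XP.*-congᴾ {λ i → S.t (suc i)} {T.1#} {x} {x} (λ { zero → X.refl ; (suc i) → X.refl }) T.refl n)
               (T.*-identityˡ x n)))

    -- Induction on the power of t: the coefficient of `S.t T.* y` in degree n + 1 is that of `y` in
    -- degree n, where `x` and `y` are already known to agree.
    cancel : ∀ x y → x T.+ S.t T.* y T.≈ y T.+ S.t T.* x → x T.≈ y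
    cancel x y e zero    = X.trans (X.sym (X.trans (X.+-congˡ (t-0 y)) (X.+-identityʳ (x 0))))
      (X.trans (e 0) (X.trans (X.+-congˡ (t-0 x)) (X.+-identityʳ (y 0))))
    cancel x y e (suc n) = RingProperties.+-cancelʳ X.ring (y n) (x (suc n)) (y (suc n))
      (X.trans (X.sym (X.+-congˡ (t-suc y n))) (X.trans (e (suc n)) (X.+-congˡ (X.trans (t-suc x n) (cancel x y e n)))))

    open RawSemiringDefinitions (RawRing.rawSemiring T.rawRing) using () renaming (_^_ to _^ᵀ_)

    -- Adding the convolution of `Q` with t H(z) to both sides, and likewise t h on the right of the
    -- original equation, removes the minus signs.
    defining : ∀ Q → S.IsQ Q → Rec.Defining h₀ N-row N-split Q
    defining Q isQ n = begin
      ∑T.∑< (suc n) (λ i → Q i T.* plus (n ∸ i)) T.+ S.t T.* hᵀ n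
        ≈⟨ T.+-congʳ (T.trans (∑T.∑<-cong (suc n) split-term) (∑T.∑<-+ (suc n) (λ i → Q i T.* (plus (n ∸ i) T.+ T.- minus (n ∸ i))) (λ i → Q i T.* minus (n ∸ i)))) ⟩
      (∑T.∑< (suc n) (λ i → Q i T.* (plus (n ∸ i) T.+ T.- minus (n ∸ i))) T.+ Σ⁻) T.+ S.t T.* hᵀ n
        ≈⟨ T.+-congʳ (T.+-congʳ equation) ⟩
      ((T.1# T.+ T.- S.t) T.* hᵀ n T.+ Σ⁻) T.+ S.t T.* hᵀ n
        ≈⟨ T.trans (T.+-congʳ (T.+-comm _ _)) (T.+-assoc _ _ _) ⟩
      Σ⁻ T.+ ((T.1# T.+ T.- S.t) T.* hᵀ n T.+ S.t T.* hᵀ n)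
        ≈⟨ T.+-congˡ (T.trans (T.sym (T.distribʳ (hᵀ n) (T.1# T.+ T.- S.t) S.t)) (T.trans (T.*-congʳ {hᵀ n} (T.trans (T.+-assoc T.1# (T.- S.t) S.t)
             (T.trans (T.+-congˡ {T.1#} (T.-‿inverseˡ S.t)) (T.+-identityʳ T.1#)))) (T.*-identityˡ (hᵀ n)))) ⟩
      Σ⁻ T.+ hᵀ n ∎
      where
      open SetoidReasoning T.setoid
      plus minus : ℕ → T.Carrier
      plus m = hᵀ m T.* S.t ^ᵀ m
      minus m = S.t T.* hᵀ m
      Σ⁻ : T.Carrier
      Σ⁻ = ∑T.∑< (suc n) (λ i → Q i T.* minus (n ∸ i))
      split-term : ∀ i → Q i T.* plus (n ∸ i) T.≈ Q i T.* (plus (n ∸ i) T.+ T.- minus (n ∸ i)) T.+ Q i T.* minus (n ∸ i)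
      split-term i = T.trans (T.*-congˡ {Q i} (T.sym (T.trans (T.+-assoc (plus (n ∸ i)) _ _)
          (T.trans (T.+-congˡ (T.-‿inverseˡ (minus (n ∸ i)))) (T.+-identityʳ (plus (n ∸ i)))))))
        (T.distribˡ (Q i) _ _)
      equation : ∑T.∑< (suc n) (λ i → Q i T.* (plus (n ∸ i) T.+ T.- minus (n ∸ i))) T.≈ (T.1# T.+ T.- S.t) T.* hᵀ n
      equation = T.trans
        (∑T.∑<-cong (suc n) λ i → T.*-congˡ {Q i} (T.+-congˡ {plus (n ∸ i)} (T.-‿cong (T.sym (TP.*-constantˡ S.t S.H[z] (n ∸ i))))))
        (T.trans (T.reflexive (sym (TP.convolution Q (λ m → S.H[tz] m T.+ T.- RawRing._*_ S.R[[x]][[t]][[z]] (S.Cz S.t) S.H[z] m) n)))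
        (T.trans (isQ n) (TP.*-constantˡ (T.1# T.+ T.- S.t) S.H[z] n)))

    Q̃-G : ∀ Q → S.IsQ Q → ∀ n → S.Q̃ Q (suc n) T.≈ G (suc n)
    Q̃-G Q isQ n = T.trans
      (T.+-congˡ {hᵀ (suc n)} (T.*-congˡ {S.t} (T.reflexive (∑T.sum-∑< (suc n) (λ i → hᵀ (n ∸ i) T.* Q (suc i))))))
      (Rec.Q̃-G h₀ N-row N-split cancel Q (defining Q isQ) n)

    ∑ᵀ : ∀ {A : Set} → List A → (A → T.Carrier) → T.Carrier
    ∑ᵀ []       f = T.0#
    ∑ᵀ (x ∷ xs) f = f x T.+ ∑ᵀ xs f

    ∑ᵀ-congAll : ∀ {A : Set} {xs : List A} {f g} → All (λ x → f x T.≈ g x) xs → ∑ᵀ xs f T.≈ ∑ᵀ xs g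
    ∑ᵀ-congAll []       = T.refl
    ∑ᵀ-congAll (e ∷ es) = T.+-cong e (∑ᵀ-congAll es)

    ∑ᵀ-++ : ∀ {A : Set} (xs : List A) {ys} f → ∑ᵀ (xs ++ ys) f T.≈ ∑ᵀ xs f T.+ ∑ᵀ ys f
    ∑ᵀ-++ []       f = T.sym (T.+-identityˡ _)
    ∑ᵀ-++ (x ∷ xs) f = T.trans (T.+-congˡ {f x} (∑ᵀ-++ xs f)) (T.sym (T.+-assoc (f x) _ _))

    ∑ᵀ-map : ∀ {A B : Set} (g : A → B) xs f → ∑ᵀ (map g xs) f T.≈ ∑ᵀ xs (f ∘ g)
    ∑ᵀ-map g []       f = T.refl
    ∑ᵀ-map g (x ∷ xs) f = T.+-congˡ {f (g x)} (∑ᵀ-map g xs f)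

    ∑ᵀ-*ˡ : ∀ {A : Set} (xs : List A) x f → x T.* ∑ᵀ xs f T.≈ ∑ᵀ xs (λ y → x T.* f y)
    ∑ᵀ-*ˡ []       x f = T.zeroʳ x
    ∑ᵀ-*ˡ (y ∷ xs) x f = T.trans (T.distribˡ x (f y) (∑ᵀ xs f)) (T.+-congˡ {x T.* f y} (∑ᵀ-*ˡ xs x f))

    ∑ᵀ-*ʳ : ∀ {A : Set} (xs : List A) x f → ∑ᵀ xs f T.* x T.≈ ∑ᵀ xs (λ y → f y T.* x)
    ∑ᵀ-*ʳ []       x f = T.zeroˡ x
    ∑ᵀ-*ʳ (y ∷ xs) x f = T.trans (T.distribʳ x (f y) (∑ᵀ xs f)) (T.+-congˡ {f y T.* x} (∑ᵀ-*ʳ xs x f))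

    ∑ᵀ-swap : ∀ {A : Set} (xs : List A) n (f : ℕ → A → T.Carrier) →
      ∑T.∑< n (λ k → ∑ᵀ xs (f k)) T.≈ ∑ᵀ xs (λ x → ∑T.∑< n (λ k → f k x))
    ∑ᵀ-swap []       n f = ∑T.∑<-0 n
    ∑ᵀ-swap (x ∷ xs) n f = T.trans (∑T.∑<-+ n (λ k → f k x) (λ k → ∑ᵀ xs (f k))) (T.+-congˡ {∑T.∑< n (λ k → f k x)} (∑ᵀ-swap xs n f))

    weight : ℕ → ℕ → T.Carrier
    weight j k = S.t ^ᵀ k T.* (T.1# T.+ S.t) ^ᵀ (j ∸ 2 * k)

    -- The hypothesis ensures that the truncated exponent grows with `j`: without it `suc j ∸ 2 * k`
    -- need not be the successor of `j ∸ 2 * k`.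
    weight-cell : ∀ j k x → 2 * k ≤ j → (T.1# T.+ S.t) T.* (weight j k T.* x) T.≈ weight (suc j) k T.* x
    weight-cell j k x le = T.trans (T.sym (T.*-assoc (T.1# T.+ S.t) (weight j k) x)) (T.*-congʳ {x} (T.trans
      (T.sym (T.*-assoc (T.1# T.+ S.t) (S.t ^ᵀ k) _)) (T.trans (T.*-congʳ {(T.1# T.+ S.t) ^ᵀ (j ∸ 2 * k)} (T.*-comm (T.1# T.+ S.t) (S.t ^ᵀ k)))
        (T.trans (T.*-assoc (S.t ^ᵀ k) (T.1# T.+ S.t) _)
          (T.*-congˡ {S.t ^ᵀ k} (T.reflexive (cong ((T.1# T.+ S.t) ^ᵀ_) (sym (+-∸-assoc 1 le)))))))))

    weight-row : ∀ j k x → S.t T.* (weight j k T.* x) T.≈ weight (suc (suc j)) (suc k) T.* x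
    weight-row j k x = T.trans (T.sym (T.*-assoc S.t (weight j k) x)) (T.*-congʳ {x} (T.trans
      (T.sym (T.*-assoc S.t (S.t ^ᵀ k) _))
      (T.*-congˡ {S.t T.* S.t ^ᵀ k} (T.reflexive (cong (λ z → (T.1# T.+ S.t) ^ᵀ (suc (suc j) ∸ z)) (sym (*-suc 2 k)))))))

    term : ℕ → (List ℕ → T.Carrier) → List ℕ → T.Carrier
    term j f ss = weight j (length ss ∸ 1) T.* f ss

    term-cell : ∀ j (f : List ℕ → T.Carrier) (g : List ℕ → List ℕ) → (∀ ss → length (g ss) ≡ length ss) →
      (T.1# T.+ S.t) T.* ∑ᵀ (interiorRibbons j) (term j (f ∘ g)) T.≈ ∑ᵀ (interiorRibbons j) (term (suc j) f ∘ g)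
    term-cell j f g lg = T.trans (∑ᵀ-*ˡ (interiorRibbons j) (T.1# T.+ S.t) (term j (f ∘ g))) (∑ᵀ-congAll (All.tabulate λ {ss} ss∈ →
      T.trans (one ss (interiorRibbons-sound j ss∈)) (T.reflexive (cong (λ l → weight (suc j) (l ∸ 1) T.* f (g ss)) (sym (lg ss))))))
      where
      one : ∀ ss → ss ≢ [] × Interior ss × ribbonSize ss ≡ suc j →
        (T.1# T.+ S.t) T.* term j (f ∘ g) ss T.≈ weight (suc j) (length ss ∸ 1) T.* f (g ss)
      one []      (ne , _)      = contradiction refl ne
      one (s ∷ u) (_ , ok , e) = weight-cell j (length u) (f (g (s ∷ u))) (interior-length j s u ok e)

    term-row : ∀ j (f : List ℕ → T.Carrier) s →
      S.t T.* ∑ᵀ (interiorRibbons j) (term j (λ ss → f (s ∷ ss))) T.≈ ∑ᵀ (map (s ∷_) (interiorRibbons j)) (term (suc (suc j)) f)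
    term-row j f s = T.trans (∑ᵀ-*ˡ (interiorRibbons j) S.t (term j (λ ss → f (s ∷ ss)))) (T.trans (∑ᵀ-congAll (All.tabulate λ {ss} ss∈ →
        one ss (proj₁ (interiorRibbons-sound j ss∈)))) (T.sym (∑ᵀ-map (s ∷_) (interiorRibbons j) _)))
      where
      one : ∀ ss → ss ≢ [] → S.t T.* term j (λ ss → f (s ∷ ss)) ss T.≈ term (suc (suc j)) f (s ∷ ss)
      one []      ne = contradiction refl ne
      one (x ∷ u) _  = weight-row j (length u) (f (s ∷ x ∷ u))

    length-widen : ∀ ss → length (widen ss) ≡ length ss
    length-widen []       = refl
    length-widen (s ∷ ss) = refl

    -- The recursions of `P` and `D` are those of the two lists of ribbons: widening the top row
    -- raises the weight by `1# + t`, a new row of two cells raises it by `t`.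
    P-sum : ∀ j f → Rec.P j f T.≈ ∑ᵀ (interiorRibbons j) (term j f)
    D-sum : ∀ j f → S.t T.* Rec.D j f T.≈ ∑ᵀ (doubledRibbons j) (term (suc j) f)
    P-sum zero    f = T.sym (T.trans (T.+-identityʳ _) (T.trans (T.*-congʳ {f (0 ∷ [])} (T.*-identityˡ T.1#)) (T.*-identityˡ (f (0 ∷ [])))))
    P-sum (suc j) f = T.trans
      (T.+-cong (T.trans (T.*-congˡ {T.1# T.+ S.t} (P-sum j (f ∘ widen)))
          (T.trans (term-cell j f widen length-widen) (T.sym (∑ᵀ-map widen (interiorRibbons j) _)))) (D-sum j f))
      (T.sym (∑ᵀ-++ (map widen (interiorRibbons j)) _))
    D-sum zero    f = T.zeroʳ S.t
    D-sum (suc j) f = T.trans (T.*-congˡ {S.t} (P-sum j (λ ss → f (1 ∷ ss)))) (term-row j f 1)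

    G-sum : ∀ n → G (suc n) T.≈ ∑ᵀ (hookRibbons n) (term (suc n) N)
    G-sum n = T.trans (top n) (T.sym (∑ᵀ-++ (interiorRibbons n) _))
      where
      interior : ∀ n → (T.1# T.+ S.t) T.* Rec.P n N T.≈ ∑ᵀ (interiorRibbons n) (term (suc n) N)
      interior n = T.trans (T.*-congˡ {T.1# T.+ S.t} (P-sum n N)) (term-cell n N id λ _ → refl)
      top : ∀ n → G (suc n) T.≈ ∑ᵀ (interiorRibbons n) (term (suc n) N) T.+ ∑ᵀ (shortTopRibbons n) (term (suc n) N)
      top zero    = T.trans (interior 0) (T.sym (T.+-identityʳ _))
      top (suc n) = T.+-cong (interior (suc n)) (T.trans (T.*-congˡ {S.t} (P-sum n (λ ss → N (0 ∷ ss)))) (term-row n N 0))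

    ∑-series : ∀ {A : Set} (xs : List A) (f : A → X.Carrier) (g : A → List ℕ → ℕ) →
      (∀ x → f x X.≈ series (g x)) → S.∑ xs f X.≈ series (λ α → sumOver xs (λ x → g x α))
    ∑-series []       f g e α = R.refl
    ∑-series (x ∷ xs) f g e α = R.trans (R.+-cong (e x α) (∑-series xs f g e α)) (R.sym (ι-+ (g x α) _))

    C-sumOver : ∀ {A : Set} (xs : List A) (g : A → List ℕ → ℕ) →
      S.C (series (λ α → sumOver xs (λ x → g x α))) T.≈ ∑ᵀ xs (λ x → S.C (series (g x)))
    C-sumOver []       g = λ { zero → X.refl ; (suc n) → X.refl }
    C-sumOver (x ∷ xs) g = T.trans (C-cong λ α → ι-+ (g x α) _)
      (T.trans (C-+ (series (g x)) (series (λ α → sumOver xs (λ y → g y α)))) (T.+-congˡ {S.C (series (g x))} (C-sumOver xs g)))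

    γ̃-series : ∀ n k → S.γ̃ n k X.≈ series (λ α → sumOver (H̃ n k) (λ D → length (tableaux D α)))
    γ̃-series n k = ∑-series (H̃ n k) S.skewSchur (λ D α → length (tableaux D α)) (λ _ _ → R.refl)

    selected : ℕ → List ℕ → T.Carrier
    selected k ss = S.C (series (λ α → 𝟙 (length ss ≟ suc k) * ribbonOf ss α))

    C-γ̃ : ∀ n k → S.C (S.γ̃ (suc n) k) T.≈ ∑ᵀ (hookRibbons n) (selected k)
    C-γ̃ n k = T.trans (C-cong λ α → R.trans (γ̃-series (suc n) k α) (R.reflexive (cong ι (sum-H̃ n k α))))
      (C-sumOver (hookRibbons n) (λ ss α → 𝟙 (length ss ≟ suc k) * ribbonOf ss α))

    selected-yes : ∀ k ss → length ss ≡ suc k → selected k ss T.≈ N ss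
    selected-yes k ss e = C-cong λ α → R.reflexive (cong ι (𝟙-yes* (length ss ≟ suc k) e))

    selected-no : ∀ k ss → length ss ≢ suc k → selected k ss T.≈ T.0#
    selected-no k ss ne = T.trans (C-cong λ α → R.reflexive (cong ι (𝟙-no* (length ss ≟ suc k) ne))) λ { zero → X.refl ; (suc n) → X.refl }

    -- Exchanging the sums leaves for each ribbon a sum over `k` in which only one term survives,
    -- with `k` one less than the number of rows. That this `k` lies in the range up to half of the
    -- size is `rows-bound`.
    γ-G : ∀ n → S.γ-expansion (suc n) (S.γ̃ (suc n)) T.≈ G (suc n)
    γ-G n = begin
      S.γ-expansion (suc n) (S.γ̃ (suc n))
        ≡⟨ ∑T.sum-∑< K (λ k → S.C (S.γ̃ (suc n) k) T.* S.t ^ᵀ k T.* (T.1# T.+ S.t) ^ᵀ (suc n ∸ 2 * k)) ⟩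
      ∑T.∑< K (λ k → S.C (S.γ̃ (suc n) k) T.* S.t ^ᵀ k T.* (T.1# T.+ S.t) ^ᵀ (suc n ∸ 2 * k))
        ≈⟨ (∑T.∑<-cong K λ k → T.trans (T.*-assoc (S.C (S.γ̃ (suc n) k)) (S.t ^ᵀ k) _)
             (T.trans (T.*-congʳ {weight (suc n) k} (C-γ̃ n k)) (∑ᵀ-*ʳ (hookRibbons n) (weight (suc n) k) (selected k)))) ⟩
      ∑T.∑< K (λ k → ∑ᵀ (hookRibbons n) (λ ss → selected k ss T.* weight (suc n) k))
        ≈⟨ ∑ᵀ-swap (hookRibbons n) K (λ k ss → selected k ss T.* weight (suc n) k) ⟩
      ∑ᵀ (hookRibbons n) (λ ss → ∑T.∑< K (λ k → selected k ss T.* weight (suc n) k))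
        ≈⟨ ∑ᵀ-congAll (All.tabulate λ {ss} ss∈ → pick ss (hookRibbons-sound n ss∈)) ⟩
      ∑ᵀ (hookRibbons n) (term (suc n) N)
        ≈⟨ T.sym (G-sum n) ⟩
      G (suc n) ∎
      where
      open SetoidReasoning T.setoid
      K : ℕ
      K = suc ⌊ suc n /2⌋
      -- Unlike in `interior-length`, the top row may consist of a single cell. The top and the
      -- lowest row together still have two cells, and every other row has two.
      rows-bound : ∀ s u → Interior u → ribbonSize (s ∷ u) ≡ suc n → 2 * length u ≤ suc n
      rows-bound s []       _  e = z≤n
      rows-bound s (x ∷ u) ok e with ribbonSize (x ∷ u) in eq
      ... | zero  = contradiction eq (ribbonSize-pos x u)
      ... | suc j = ≤-trans (≤-reflexive (*-suc 2 (length u))) (≤-trans (+-monoʳ-≤ 2 (interior-length j x u ok eq))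
                      (≤-trans (s≤s (m≤n+m (suc j) s)) (≤-reflexive e)))
      pick : ∀ ss → ∃[ s ] ∃[ u ] ss ≡ s ∷ u × Interior u × ribbonSize ss ≡ suc n →
        ∑T.∑< K (λ k → selected k ss T.* weight (suc n) k) T.≈ term (suc n) N ss
      pick .(s ∷ u) (s , u , refl , ok , e) = T.trans
        (∑T.∑<-single K (λ k → selected k (s ∷ u) T.* weight (suc n) k) (length u) (s≤s (half-≤ (length u) (suc n) (rows-bound s u ok e)))
          λ k _ k≢ → T.trans (T.*-congʳ {weight (suc n) k} (selected-no k (s ∷ u) λ e′ → k≢ (sym (suc-injective e′)))) (T.zeroˡ (weight (suc n) k)))
        (T.trans (T.*-congʳ {weight (suc n) (length u)} (selected-yes (length u) (s ∷ u) refl)) (T.*-comm (N (s ∷ u)) (weight (suc n) (length u))))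

    γ̃-positive : ∀ n k → S.SchurPositive (S.γ̃ (suc n) k)
    γ̃-positive n k = partitionsInSquare (suc n) , (λ λs → ι (multiplicity n k λs)) , partitionsInSquare-unique (suc n) ,
      AllP.all-filter partition? (concatMap (λ r → words r (upTo (suc (suc n)))) (upTo (suc (suc n)))) ,
      All.universal (λ λs → ι-nonneg (multiplicity n k λs)) (partitionsInSquare (suc n)) ,
      λ α → R.trans (γ̃-series (suc n) k α) (R.trans (R.reflexive (cong ι (schur-expansion n k α)))
        (R.sym (∑-series (partitionsInSquare (suc n)) _ (λ λs α → multiplicity n k λs * length (tableaux (λs , []) α))
          (λ λs α → R.sym (ι-* (multiplicity n k λs) (length (tableaux (λs , []) α)))) α)))

  γ̃-theorem : ∀ Q → S.IsQ Q → ∀ n → S.Q̃ Q (suc n) T.≈ S.γ-expansion (suc n) (S.γ̃ (suc n)) × S.SchurγPositive (S.Q̃ Q (suc n))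
  γ̃-theorem Q isQ n = expansion , suc n , S.γ̃ (suc n) , (λ k _ → γ̃-positive n k) , expansion
    where
    expansion : S.Q̃ Q (suc n) T.≈ S.γ-expansion (suc n) (S.γ̃ (suc n))
    expansion = T.trans (Q̃-G Q isQ n) (T.sym (γ-G n))

theorem3p4 : ∀ {c ℓ₁ ℓ₂} (R : OrderedCommutativeRing c ℓ₁ ℓ₂) → let open SymmetricFunctions R in
    (Q : ℕ → RawRing.Carrier R[[x]][[t]]) → (∀ n → Q n ∈Λ[t]) → IsQ Q →
    ∀ n → 1 ≤ n → Q̃ Q n ≈ γ-expansion n (γ̃ n) × SchurγPositive (Q̃ Q n)
theorem3p4 R Q _ isQ (suc n) _ = γ̃-theorem R Q isQ n
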